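{- There is a randomized (Monte-Carlo) algorithm that, given a graph $G$ with $n$ vertices, numbers $k,\ell\in\mathbb{N}$, and an elimination forest of $G$ of depth $\tau$, solves \textsc{Partial Cycle Cover} on $(G,k,\ell)$ in $4^{\tau}n^{\mathcal{O}(1)}$ time and polynomial space. The algorithm never outputs a false positive (it never answers yes on a no-instance), and on a yes-instance it answers no with probability at most $\frac12$.
   Context: All graphs are finite, undirected and simple. A partial cycle cover of a graph $G=(V,E)$ is a set $C\subseteq E$ such that every vertex of the graph $(V,C)$ has degree $0$ or $2$; equivalently, $C$ is the edge set of a family of vertex-disjoint simple cycles of $G$. The vertices it covers are those of degree $2$ in $(V,C)$. \textsc{Partial Cycle Cover}: given a graph $G$ and $k,\ell\in\mathbb{N}$, decide whether $G$ has a partial cycle cover consisting of at most $k$ cycles that covers exactly $\ell$ vertices. An elimination forest of $G=(V,E)$ is a rooted forest on vertex set $V$ (whose edges need not be edges of $G$) such that for every edge $\{u,v\}\in E$, one of $u,v$ is an ancestor of the other in the forest. Its depth is the maximum number of vertices on a path from a root to a leaf. -}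

module Defs where

open import Data.Bool.Base using (Bool; true; false; T; if_then_else_)
open import Data.Fin.Base using (Fin; toℕ)
open import Data.Fin.Properties using (any?) renaming (_≟_ to _≟ᶠ_)
open import Data.Integer.Base using (+_)
open import Data.List.Base using (List; []; _∷_; _++_; [_]; map; zip; length; filter; filterᵇ; allFin; cartesianProductWith; foldr)
open import Data.List.Membership.Propositional using (_∈_)
open import Data.List.Relation.Binary.Disjoint.Propositional using (Disjoint)
open import Data.List.Relation.Unary.All using (All)
open import Data.List.Relation.Unary.AllPairs using (AllPairs)
open import Data.List.Relation.Unary.Any using (Any)
open import Data.List.Relation.Unary.Unique.Propositional using (Unique)
open import Data.Maybe.Base using (Maybe; just; nothing; maybe)
open import Data.Maybe.Properties using (≡-dec)
open import Data.Nat.Base using (ℕ; zero; suc; _+_; _∸_; _⊔_; _≤_; _^_)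
open import Data.Nat.ListAction using (sum)
open import Data.Nat.Logarithm using (⌈log₂_⌉)
open import Data.Nat.Properties using (_≟_; m^n≢0)
open import Data.Product.Base using (∃; _×_; _,_; proj₁; uncurry; ∃-syntax)
open import Data.Rational.Unnormalised.Base using (ℚᵘ; _/_)
open import Data.Sum.Base using (_⊎_)
open import Data.Vec.Base as Vec using (Vec)
open import Function.Bundles using (_⇔_)
open import Relation.Binary.PropositionalEquality using (_≡_; _≢_; refl)
open import Relation.Nullary.Decidable using (Dec; ¬?)
open import Relation.Nullary.Negation using (¬_; contradiction)

record Graph (n : ℕ) : Set where
  field
    adj    : Fin n → Fin n → Bool
    sym    : ∀ u v → adj u v ≡ adj v u
    irrefl : ∀ v → adj v v ≡ false

  Edge : Fin n → Fin n → Set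
  Edge u v = T (adj u v)

  degree : Fin n → ℕ
  degree v = length (filterᵇ (adj v) (allFin n))

open Graph public

-- A set C ⊆ E is represented by the graph (V , C).
_⊆ᴱ_ : ∀ {n} → Graph n → Graph n → Set
C ⊆ᴱ G = ∀ u v → Edge C u v → Edge G u v

record IsPartialCycleCover {n : ℕ} (G C : Graph n) : Set where
  field
    subset  : C ⊆ᴱ G
    degrees : ∀ v → degree C v ≡ 0 ⊎ degree C v ≡ 2

covered : ∀ {n} → Graph n → List (Fin n)
covered {n} C = filter (λ v → degree C v ≟ 2) (allFin n)

-- The list v₁ , … , vₘ stands for the closed walk v₁ v₂ … vₘ v₁.
cyclicPairs : ∀ {A : Set} → List A → List (A × A)
cyclicPairs []       = []
cyclicPairs (x ∷ xs) = zip (x ∷ xs) (xs ++ [ x ])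

record IsSimpleCycle {n : ℕ} (G : Graph n) (vs : List (Fin n)) : Set where
  field
    length≥3 : 3 ≤ length vs
    distinct : Unique vs
    edges    : All (uncurry (Edge G)) (cyclicPairs vs)

OnCycle : ∀ {n} → Fin n → Fin n → List (Fin n) → Set
OnCycle u v vs = (u , v) ∈ cyclicPairs vs ⊎ (v , u) ∈ cyclicPairs vs

-- C is the edge set of the family cs of vertex-disjoint simple cycles of G.
record IsCycleFamily {n : ℕ} (G C : Graph n) (cs : List (List (Fin n))) : Set where
  field
    cycles   : All (IsSimpleCycle G) cs
    disjoint : AllPairs Disjoint cs
    edgeSet  : ∀ u v → Edge C u v ⇔ Any (OnCycle u v) cs

PartialCycleCover : ∀ {n} → Graph n → ℕ → ℕ → Set
PartialCycleCover {n} G k ℓ =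
  ∃[ C ] IsPartialCycleCover G C
       × (∃[ cs ] IsCycleFamily G C cs × length cs ≤ k)
       × length (covered C) ≡ ℓ

-- RootPath parent v d : the path from a root down to v has d vertices.
data RootPath {n : ℕ} (parent : Fin n → Maybe (Fin n)) : Fin n → ℕ → Set where
  root  : ∀ {v} → parent v ≡ nothing → RootPath parent v 1
  child : ∀ {u v d} → parent v ≡ just u → RootPath parent u d → RootPath parent v (suc d)

-- The field `rooted` rules out cyclic parent pointers.
record RootedForest (n : ℕ) : Set where
  field
    parent : Fin n → Maybe (Fin n)
    rooted : ∀ v → ∃ (RootPath parent v)

  data Ancestor (u : Fin n) : Fin n → Set where
    here  : ∀ {v} → parent v ≡ just u → Ancestor u v
    there : ∀ {w v} → parent v ≡ just w → Ancestor u w → Ancestor u v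

  level : Fin n → ℕ
  level v = proj₁ (rooted v)

  Leaf : Fin n → Set
  Leaf v = ¬ (∃[ u ] parent u ≡ just v)

  leaf? : ∀ v → Dec (Leaf v)
  leaf? v = ¬? (any? (λ u → ≡-dec _≟ᶠ_ (parent u) (just v)))

  depth : ℕ
  depth = foldr _⊔_ 0 (map level (filter leaf? (allFin n)))

open RootedForest public using (parent; depth)

IsEliminationForest : ∀ {n} → Graph n → RootedForest n → Set
IsEliminationForest G F = ∀ u v → Edge G u v → Ancestor u v ⊎ Ancestor v u
  where open RootedForest F using (Ancestor)

-- Probabilistic random-access machine: structured programs over a random-access
-- memory of natural numbers, with a read-only random-access input, fair coin
-- flips, and unit-cost addition, truncated subtraction, load and store.
-- Multiplication is deliberately absent: at unit cost it makes a RAM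
-- unreasonably strong.

Memory : Set
Memory = List ℕ

-- Cells beyond the end of the list hold 0.
read : List ℕ → ℕ → ℕ
read []      _       = 0
read (x ∷ m) zero    = x
read (x ∷ m) (suc a) = read m a

write : Memory → ℕ → ℕ → Memory
write []      zero    v = v ∷ []
write []      (suc a) v = 0 ∷ write [] a v
write (x ∷ m) zero    v = v ∷ m
write (x ∷ m) (suc a) v = x ∷ write m a v

-- ⌈log₂ (1 + x)⌉ is the number of binary digits of x. Every cell up to the
-- largest address written is charged, whether or not it is in use.
memoryBits : Memory → ℕ
memoryBits m = sum (map (λ x → suc ⌈log₂ suc x ⌉) m)

infixl 6 _⊕_ _⊖_
data Expr : Set where
  lit     : ℕ → Expr
  inp mem : Expr → Expr
  _⊕_ _⊖_ : Expr → Expr → Expr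

infix  5 _≔_
infixr 4 _⨾_
data Program : Set where
  skip  : Program
  _≔_   : Expr → Expr → Program
  flip  : Expr → Program
  _⨾_   : Program → Program → Program
  cond  : Expr → Program → Program → Program
  while : Expr → Program → Program

cost : Expr → ℕ
cost (lit _) = 1
cost (inp e) = suc (cost e)
cost (mem e) = suc (cost e)
cost (e ⊕ f) = suc (cost e + cost f)
cost (e ⊖ f) = suc (cost e + cost f)

bit : Bool → ℕ
bit b = if b then 1 else 0

module Semantics (input : List ℕ) where

  eval : Memory → Expr → ℕ
  eval m (lit x) = x
  eval m (inp e) = read input (eval m e)
  eval m (mem e) = read m (eval m e)
  eval m (e ⊕ f) = eval m e + eval m f
  eval m (e ⊖ f) = eval m e ∸ eval m f

  -- Exec P m ρ m′ ρ′ t s : started in memory m with the coin results ρ ahead,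
  -- P halts in memory m′ with the coin results ρ′ still unused, after t time
  -- units, the peak memory being s bits. A flip with no coin left is stuck.
  data Exec : Program → Memory → List Bool → Memory → List Bool → ℕ → ℕ → Set where
    skip   : ∀ {m ρ} →
             Exec skip m ρ m ρ 1 (memoryBits m)
    assign : ∀ {a e m ρ} → let m′ = write m (eval m a) (eval m e) in
             Exec (a ≔ e) m ρ m′ ρ (suc (cost a + cost e)) (memoryBits m ⊔ memoryBits m′)
    flip   : ∀ {a m b ρ} → let m′ = write m (eval m a) (bit b) in
             Exec (flip a) m (b ∷ ρ) m′ ρ (suc (cost a)) (memoryBits m ⊔ memoryBits m′)
    seq    : ∀ {P Q m m′ m″ ρ ρ′ ρ″ t t′ s s′} →
             Exec P m ρ m′ ρ′ t s → Exec Q m′ ρ′ m″ ρ″ t′ s′ →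
             Exec (P ⨾ Q) m ρ m″ ρ″ (t + t′) (s ⊔ s′)
    then   : ∀ {e P Q m m′ ρ ρ′ t s} → eval m e ≢ 0 →
             Exec P m ρ m′ ρ′ t s →
             Exec (cond e P Q) m ρ m′ ρ′ (suc (cost e + t)) s
    else   : ∀ {e P Q m m′ ρ ρ′ t s} → eval m e ≡ 0 →
             Exec Q m ρ m′ ρ′ t s →
             Exec (cond e P Q) m ρ m′ ρ′ (suc (cost e + t)) s
    loop   : ∀ {e P m m′ m″ ρ ρ′ ρ″ t t′ s s′} → eval m e ≢ 0 →
             Exec P m ρ m′ ρ′ t s → Exec (while e P) m′ ρ′ m″ ρ″ t′ s′ →
             Exec (while e P) m ρ m″ ρ″ (suc (cost e + t + t′)) (s ⊔ s′)
    done   : ∀ {e P m ρ} → eval m e ≡ 0 →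
             Exec (while e P) m ρ m ρ (suc (cost e)) (memoryBits m)

  deterministic : ∀ {P m ρ m₁ m₂ ρ₁ ρ₂ t₁ t₂ s₁ s₂} →
                  Exec P m ρ m₁ ρ₁ t₁ s₁ → Exec P m ρ m₂ ρ₂ t₂ s₂ →
                  (m₁ , ρ₁ , t₁ , s₁) ≡ (m₂ , ρ₂ , t₂ , s₂)
  deterministic skip skip = refl
  deterministic assign assign = refl
  deterministic flip flip = refl
  deterministic (seq p q) (seq p′ q′)
    with refl ← deterministic p p′ with refl ← deterministic q q′ = refl
  deterministic (then _ p) (then _ p′) with refl ← deterministic p p′ = refl
  deterministic (then x _) (else y _) = contradiction y x
  deterministic (else x _) (then y _) = contradiction x y
  deterministic (else _ p) (else _ p′) with refl ← deterministic p p′ = refl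
  deterministic (loop _ p q) (loop _ p′ q′)
    with refl ← deterministic p p′ with refl ← deterministic q q′ = refl
  deterministic (loop x _ _) (done y) = contradiction y x
  deterministic (done x) (loop y _ _) = contradiction x y
  deterministic (done _) (done _) = refl

-- The work memory is initially empty; the input is not charged as space.
record Run (P : Program) (input : List ℕ) (coins : List Bool) : Set where
  open Semantics input
  field
    {final}    : Memory
    {unused}   : List Bool
    time space : ℕ
    exec       : Exec P [] coins final unused time space

  -- A nonzero value in cell 0 means yes.
  answer : Bool
  answer with read final 0
  ... | zero  = false
  ... | suc _ = true

open Run public using (time; space; answer)

-- Number of vertices, k, ℓ, the adjacency matrix row by row, and then the parent
-- of each vertex (0 for a root, 1 + u for parent u).
encode : ∀ {n} → Graph n → ℕ → ℕ → RootedForest n → List ℕ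
encode {n} G k ℓ F =
  n ∷ k ∷ ℓ ∷ cartesianProductWith (λ u v → bit (adj G u v)) (allFin n) (allFin n)
    ++ map (λ v → maybe (λ u → suc (toℕ u)) 0 (parent F v)) (allFin n)

count : ∀ r → (Vec Bool r → Bool) → ℕ
count zero    A = bit (A Vec.[])
count (suc r) A = count r (λ ρ → A (true Vec.∷ ρ)) + count r (λ ρ → A (false Vec.∷ ρ))

-- The probability of A under r independent fair coins.
Pr : ∀ {r} → (Vec Bool r → Bool) → ℚᵘ
Pr {r} A = _/_ (+ count r A) (2 ^ r) {{m^n≢0 2 r}}

{-# OPTIONS --safe #-}
module Submission where

-- A partial cycle cover C with c cycles has exactly 2 ^ c orientations in which
-- every vertex has in- and out-degree 0 or 1, so C has at most k cycles iff 2 ^ (k + 1)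
-- does not divide this number. The orientations are counted by inclusion–exclusion
-- over the in- and out-slots of the vertices: four states per vertex, a factor for
-- each vertex and a factor for each edge. On an elimination forest of depth τ this
-- sum is evaluated by branching along root paths in 4 ^ τ polynomially long steps;
-- as it is linear in the factor collected so far, one accumulator per level suffices.
-- Numbers of edges, covered vertices and a random edge weight are recorded in the
-- exponent of 2 ^ b, so that the whole generating function is one natural number
-- with polynomially many bits. By the isolation lemma, with probability at least ½
-- the lightest C whose number of orientations is not divisible by 2 ^ (k + 1) is
-- unique, and then the coefficient at its weight is not divisible either.

open import Defs renaming (sym to adj-sym)
open import Data.Bool.Base using (Bool; true; false; not; T; if_then_else_; _∧_; _∨_)
open import Data.Bool.Properties using (T-≡; ∧-zeroʳ; ∨-comm)
open import Data.Empty using (⊥)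
open import Data.Fin using (Fin; zero; suc; toℕ; #_)
open import Data.Fin.Properties using (any?; toℕ<n; toℕ-injective) renaming (_≟_ to _≟ᶠ_)
open import Data.Integer.Base as ℤ using ()
open import Data.Integer.Properties using (pos-*)
open import Data.List.Base using (List; []; _∷_; _++_; [_]; map; length; filter; filterᵇ; concat; concatMap; foldl; foldr; zip; allFin; tabulate; downFrom; cartesianProductWith)
open import Data.List.Membership.Propositional using (_∈_; _∉_; find; lose)
open import Data.List.Membership.Propositional.Properties using (∈-++⁺ˡ; ∈-++⁺ʳ; ∈-++⁻; ∈-map⁺; ∈-map⁻; ∈-filter⁺; ∈-filter⁻; ∈-∃++; ∈-allFin; ∈-concatMap⁺; ∈-concatMap⁻; ∈-downFrom⁺)
open import Data.List.Membership.Propositional.Properties.WithK using (unique∧set⇒bag)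
open import Data.List.Properties using (++-assoc; map-++; map-id; map-tabulate; length-++; length-map; length-filter; length-tabulate; length-downFrom; ≡-dec) renaming (++-identityʳ to ++-identityʳᴸ)
open import Data.List.Relation.Binary.BagAndSetEquality using (∼bag⇒↭)
open import Data.List.Relation.Binary.Disjoint.Propositional using (Disjoint)
open import Data.List.Relation.Binary.Permutation.Propositional as ↭ using (_↭_; ↭-refl; ↭-sym; ↭-trans; ↭-prep)
open import Data.List.Relation.Binary.Permutation.Propositional.Properties using (↭-length; All-resp-↭; ∈-resp-↭; ++⁺ˡ) renaming (shift to ↭-shift; map⁺ to ↭-map⁺)
open import Data.List.Relation.Unary.All as All using (All; []; _∷_; all?)
open import Data.List.Relation.Unary.AllPairs using (AllPairs; []; _∷_)
open import Data.List.Relation.Unary.Any as Any using (Any; here; there)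
open import Data.List.Relation.Unary.Unique.Propositional using (Unique)
open import Data.List.Relation.Unary.Unique.Propositional.Properties using (allFin⁺) renaming (++⁺ to unique-++⁺; concat⁺ to unique-concat⁺; map⁺ to unique-map⁺; downFrom⁺ to unique-downFrom⁺)
open import Data.Maybe.Base using (Maybe; just; nothing; maybe)
open import Data.Maybe.Properties using (just-injective) renaming (≡-dec to Maybe-≡-dec)
open import Data.Nat.Base
open import Data.Nat.DivMod using (_/_; _%_; m%n<n; m%n≤m; m<n⇒m%n≡m; m<n⇒m/n≡0; m*n/n≡m; m≡m%n+[m/n]*n; [m+kn]%n≡m%n; /-congʳ; +-distrib-/-∣ʳ; m/n/o≡m/[n*o])
open import Data.Nat.Divisibility
open import Data.Nat.Logarithm using (⌈log₂_⌉; ⌈log₂⌉-mono-≤; ⌈log₂2^n⌉≡n)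
open import Data.Nat.Properties
open import Data.Nat.Tactic.RingSolver using (solve-∀)
open import Data.Product.Base as Prod using (Σ-syntax; _×_; _,_; proj₁; proj₂)
open import Data.Product.Properties using () renaming (≡-dec to ×-≡-dec)
open import Data.Rational.Unnormalised.Base as ℚᵘ using (½; *≤*) renaming (_≤_ to _≤ℚ_)
open import Data.Sum.Base as Sum using (_⊎_; inj₁; inj₂; [_,_]′)
open import Data.Unit.Base using (⊤; tt)
open import Data.Vec.Base as Vec using (Vec; []; _∷_; toList)
open import Function.Base using (_∘_; id)
open import Function.Bundles using (Equivalence; mk⇔)
open import Relation.Binary.Definitions using (DecidableEquality; tri<; tri≈; tri>)
open import Relation.Binary.PropositionalEquality using (_≡_; _≢_; refl; sym; trans; cong; cong₂; subst; subst₂; module ≡-Reasoning)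
open import Relation.Nullary.Decidable using (Dec; does; yes; no; _×-dec_; _⊎-dec_; ¬?; decidable-stable)
open import Relation.Nullary.Negation using (¬_; contradiction)

-- Inclusion-exclusion by itself only guarantees that every slot is used at least once. To force
-- exactly once, a vertex outside the cover receives a loop filling both of its slots, and arcs and
-- loops together are required to number n. That digit is then at least n, with equality exactly for
-- the wanted configurations, so reading the coefficients with this digit equal to n is enough. The
-- machine has no multiplication. Every factor of the sum is therefore a small combination of 1 and
-- a power of two, so that multiplying the accumulator by it takes only doublings, additions and
-- subtractions. A random weight has at least 2 n² possible values because there are at most n²
-- edges, and each of them spoils uniqueness for at most one value of its own weight.

private variable
  A A′ : Set

-- Finite sums and products.

∑ ∏ : List A → (A → ℕ) → ℕ
∑ []       f = 0
∑ (x ∷ xs) f = f x + ∑ xs f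
∏ []       f = 1
∏ (x ∷ xs) f = f x * ∏ xs f

∑-cong : ∀ (xs : List A) {f g} → (∀ x → x ∈ xs → f x ≡ g x) → ∑ xs f ≡ ∑ xs g
∑-cong []       e = refl
∑-cong (x ∷ xs) e = cong₂ _+_ (e x (here refl)) (∑-cong xs (λ y → e y ∘ there))

∏-cong : ∀ (xs : List A) {f g} → (∀ x → x ∈ xs → f x ≡ g x) → ∏ xs f ≡ ∏ xs g
∏-cong []       e = refl
∏-cong (x ∷ xs) e = cong₂ _*_ (e x (here refl)) (∏-cong xs (λ y → e y ∘ there))

∑-mono : ∀ (xs : List A) {f g} → (∀ x → x ∈ xs → f x ≤ g x) → ∑ xs f ≤ ∑ xs g
∑-mono []       e = z≤n
∑-mono (x ∷ xs) e = +-mono-≤ (e x (here refl)) (∑-mono xs (λ y → e y ∘ there))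

∑-const : ∀ (xs : List A) c → ∑ xs (λ _ → c) ≡ length xs * c
∑-const []       c = refl
∑-const (x ∷ xs) c = cong (c +_) (∑-const xs c)

∑-zero : ∀ (xs : List A) {f} → (∀ x → x ∈ xs → f x ≡ 0) → ∑ xs f ≡ 0
∑-zero xs e = trans (∑-cong xs e) (trans (∑-const xs 0) (*-zeroʳ (length xs)))

∑-*ˡ : ∀ c (xs : List A) f → c * ∑ xs f ≡ ∑ xs (λ x → c * f x)
∑-*ˡ c []       f = *-zeroʳ c
∑-*ˡ c (x ∷ xs) f = trans (*-distribˡ-+ c (f x) _) (cong (c * f x +_) (∑-*ˡ c xs f))

∑-*ʳ : ∀ c (xs : List A) f → ∑ xs f * c ≡ ∑ xs (λ x → f x * c)
∑-*ʳ c []       f = refl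
∑-*ʳ c (x ∷ xs) f = trans (*-distribʳ-+ c (f x) _) (cong (f x * c +_) (∑-*ʳ c xs f))

private
  swap₄ : ∀ a b c d → (a + b) + (c + d) ≡ (a + c) + (b + d)
  swap₄ = solve-∀

  swap₄* : ∀ a b c d → (a * b) * (c * d) ≡ (a * c) * (b * d)
  swap₄* = solve-∀

∑-+ : ∀ (xs : List A) f g → ∑ xs f + ∑ xs g ≡ ∑ xs (λ x → f x + g x)
∑-+ []       f g = refl
∑-+ (x ∷ xs) f g = trans (swap₄ (f x) _ (g x) _) (cong (f x + g x +_) (∑-+ xs f g))

∏-* : ∀ (xs : List A) f g → ∏ xs f * ∏ xs g ≡ ∏ xs (λ x → f x * g x)
∏-* []       f g = refl
∏-* (x ∷ xs) f g = trans (swap₄* (f x) _ (g x) _) (cong (f x * g x *_) (∏-* xs f g))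

∑-swap : ∀ (xs : List A) (ys : List A′) (f : A → A′ → ℕ) → ∑ xs (λ x → ∑ ys (f x)) ≡ ∑ ys (λ y → ∑ xs (λ x → f x y))
∑-swap []       ys f = sym (∑-zero ys λ _ _ → refl)
∑-swap (x ∷ xs) ys f = trans (cong (∑ ys (f x) +_) (∑-swap xs ys f)) (∑-+ ys (f x) _)

∑-++ : ∀ (xs ys : List A) f → ∑ (xs ++ ys) f ≡ ∑ xs f + ∑ ys f
∑-++ []       ys f = refl
∑-++ (x ∷ xs) ys f = trans (cong (f x +_) (∑-++ xs ys f)) (sym (+-assoc (f x) _ _))

∏-++ : ∀ (xs ys : List A) f → ∏ (xs ++ ys) f ≡ ∏ xs f * ∏ ys f
∏-++ []       ys f = sym (+-identityʳ _)
∏-++ (x ∷ xs) ys f = trans (cong (f x *_) (∏-++ xs ys f)) (sym (*-assoc (f x) _ _))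

∑-map : ∀ (g : A′ → A) (xs : List A′) f → ∑ (map g xs) f ≡ ∑ xs (f ∘ g)
∑-map g []       f = refl
∑-map g (x ∷ xs) f = cong (f (g x) +_) (∑-map g xs f)

∏-map : ∀ (g : A′ → A) (xs : List A′) f → ∏ (map g xs) f ≡ ∏ xs (f ∘ g)
∏-map g []       f = refl
∏-map g (x ∷ xs) f = cong (f (g x) *_) (∏-map g xs f)

∑-concatMap : ∀ (g : A′ → List A) (xs : List A′) f → ∑ (concatMap g xs) f ≡ ∑ xs (λ x → ∑ (g x) f)
∑-concatMap g []       f = refl
∑-concatMap g (x ∷ xs) f = trans (∑-++ (g x) _ f) (cong (∑ (g x) f +_) (∑-concatMap g xs f))

∏-filterᵇ : ∀ (p : A → Bool) xs f → (∀ x → p x ≡ false → f x ≡ 1) → ∏ xs f ≡ ∏ (filterᵇ p xs) f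
∏-filterᵇ p []       f e = refl
∏-filterᵇ p (x ∷ xs) f e with p x in eq
... | true  = cong (f x *_) (∏-filterᵇ p xs f e)
... | false = trans (cong₂ _*_ (e x eq) (∏-filterᵇ p xs f e)) (+-identityʳ _)

∈-filterᵇ⁻ : ∀ (p : A → Bool) {xs x} → x ∈ filterᵇ p xs → x ∈ xs × p x ≡ true
∈-filterᵇ⁻ p {y ∷ xs} x∈ with p y in eq
∈-filterᵇ⁻ p {y ∷ xs} (here refl) | true = here refl , eq
∈-filterᵇ⁻ p {y ∷ xs} (there x∈)  | true with i , e ← ∈-filterᵇ⁻ p x∈ = there i , e
∈-filterᵇ⁻ p {y ∷ xs} x∈          | false with i , e ← ∈-filterᵇ⁻ p x∈ = there i , e

∈-filterᵇ⁺ : ∀ (p : A → Bool) {xs x} → x ∈ xs → p x ≡ true → x ∈ filterᵇ p xs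
∈-filterᵇ⁺ p {y ∷ xs} (here refl) e rewrite e = here refl
∈-filterᵇ⁺ p {y ∷ xs} (there x∈) e with p y
... | true  = there (∈-filterᵇ⁺ p x∈ e)
... | false = ∈-filterᵇ⁺ p x∈ e

filterᵇ-unique : ∀ (p : A → Bool) {xs} → Unique xs → Unique (filterᵇ p xs)
filterᵇ-unique p [] = []
filterᵇ-unique p {x ∷ xs} (x∉ ∷ u) with p x
... | true  = All.tabulate (λ y∈ → All.lookup x∉ (proj₁ (∈-filterᵇ⁻ p y∈))) ∷ filterᵇ-unique p u
... | false = filterᵇ-unique p u

∏-one : ∀ (xs : List A) {f} → (∀ x → x ∈ xs → f x ≡ 1) → ∏ xs f ≡ 1
∏-one []       e = refl
∏-one (x ∷ xs) e = trans (cong₂ _*_ (e x (here refl)) (∏-one xs (λ y → e y ∘ there))) refl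

∏-^ : ∀ (xs : List A) b f → ∏ xs (λ x → b ^ f x) ≡ b ^ ∑ xs f
∏-^ []       b f = refl
∏-^ (x ∷ xs) b f = trans (cong (b ^ f x *_) (∏-^ xs b f)) (sym (^-distribˡ-+-* b (f x) _))

∑-∈-≤ : ∀ {xs : List A} {x} f → x ∈ xs → f x ≤ ∑ xs f
∑-∈-≤ f (here refl) = m≤m+n _ _
∑-∈-≤ f (there p)   = ≤-trans (∑-∈-≤ f p) (m≤n+m _ _)

∧-true : ∀ {a b} → a ∧ b ≡ true → a ≡ true × b ≡ true
∧-true {true} {true} _ = refl , refl

-- Sums over all assignments of values to a list of keys.
module Assignments {K V : Set} (_≟_ : DecidableEquality K) (vals : List V) where

  infixl 20 _[_↦_]
  _[_↦_] : (K → V) → K → V → K → V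
  (σ [ k ↦ v ]) j = if does (k ≟ j) then v else σ j

  ↦-≡ : ∀ σ k v → (σ [ k ↦ v ]) k ≡ v
  ↦-≡ σ k v with k ≟ k
  ... | yes _ = refl
  ... | no ne = contradiction refl ne

  ↦-≢ : ∀ σ k {j} v → k ≢ j → (σ [ k ↦ v ]) j ≡ σ j
  ↦-≢ σ k {j} v ne with k ≟ j
  ... | yes e = contradiction e ne
  ... | no _  = refl

  ↦-cong : ∀ {σ τ} k v → (∀ j → k ≢ j → σ j ≡ τ j) → ∀ j → (σ [ k ↦ v ]) j ≡ (τ [ k ↦ v ]) j
  ↦-cong k v e j with k ≟ j
  ... | yes _ = refl
  ... | no ne = e j ne

  -- Keys outside of `ks` keep their value under `σ`, so a partially made choice is just an argument
  -- of the sum.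
  Σ* : List K → (K → V) → ((K → V) → ℕ) → ℕ
  Σ* []       σ F = F σ
  Σ* (k ∷ ks) σ F = ∑ vals (λ v → Σ* ks (σ [ k ↦ v ]) F)

  private
    outside : ∀ {k ks} {σ τ : K → V} {v} → (∀ j → j ∉ ks → τ j ≡ (σ [ k ↦ v ]) j) → ∀ j → j ∉ k ∷ ks → τ j ≡ σ j
    outside {k} {σ = σ} {v = v} o j j∉ = trans (o j (j∉ ∘ there)) (↦-≢ σ k v λ { refl → j∉ (here refl) })

  Σ*-cong : ∀ ks {σ F G} → (∀ τ → (∀ j → j ∉ ks → τ j ≡ σ j) → F τ ≡ G τ) → Σ* ks σ F ≡ Σ* ks σ G
  Σ*-cong []       e = e _ λ _ _ → refl
  Σ*-cong (k ∷ ks) e = ∑-cong vals λ v _ → Σ*-cong ks λ τ o → e τ (outside o)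

  Σ*-mono : ∀ ks {σ F G} → (∀ τ → F τ ≤ G τ) → Σ* ks σ F ≤ Σ* ks σ G
  Σ*-mono []       e = e _
  Σ*-mono (k ∷ ks) e = ∑-mono vals λ v _ → Σ*-mono ks e

  Σ*-const : ∀ ks {σ} c → Σ* ks σ (λ _ → c) ≡ length vals ^ length ks * c
  Σ*-const []       c = sym (+-identityʳ c)
  Σ*-const (k ∷ ks) c = trans (∑-cong vals λ v _ → Σ*-const ks c)
    (trans (∑-const vals _) (sym (*-assoc (length vals) _ c)))

  Σ*-*ˡ : ∀ ks {σ} c F → Σ* ks σ (λ τ → c * F τ) ≡ c * Σ* ks σ F
  Σ*-*ˡ []       c F = refl
  Σ*-*ˡ (k ∷ ks) c F = trans (∑-cong vals λ v _ → Σ*-*ˡ ks c F) (sym (∑-*ˡ c vals _))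

  Σ*-∑ : ∀ ks {σ} (xs : List A) (F : A → (K → V) → ℕ) →
         Σ* ks σ (λ τ → ∑ xs (λ x → F x τ)) ≡ ∑ xs (λ x → Σ* ks σ (F x))
  Σ*-∑ []       xs F = refl
  Σ*-∑ (k ∷ ks) xs F = trans (∑-cong vals λ v _ → Σ*-∑ ks xs F) (∑-swap vals xs _)

  -- Distributivity of products over sums. As the keys are distinct, the value chosen for `k` is not
  -- overwritten later, and its factor can be moved out of the remaining sum.
  Σ*-∏ : ∀ {ks} → Unique ks → ∀ {σ} (g : K → V → ℕ) →
         Σ* ks σ (λ τ → ∏ ks (λ k → g k (τ k))) ≡ ∏ ks (λ k → ∑ vals (g k))
  Σ*-∏ {[]}     _        g = refl
  Σ*-∏ {k ∷ ks} (k∉ ∷ u) {σ} g = trans (∑-cong vals λ v _ →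
      trans (Σ*-cong ks λ τ o → cong (λ w → g k w * _) (trans (o k (λ k∈ → All.lookup k∉ k∈ refl)) (↦-≡ σ k v)))
     (trans (Σ*-*ˡ ks (g k v) _) (cong (g k v *_) (Σ*-∏ u g))))
    (sym (∑-*ʳ _ vals (g k)))

  -- Assignments that differ only in the order of two updates agree pointwise but are not
  -- propositionally equal, so reordering updates requires that `F` respect pointwise equality.
  Extensional : ((K → V) → ℕ) → Set
  Extensional F = ∀ {σ τ} → (∀ j → σ j ≡ τ j) → F σ ≡ F τ

  Σ*-ext : ∀ ks {F} → Extensional F → Extensional (λ σ → Σ* ks σ F)
  Σ*-ext []       ext e = ext e
  Σ*-ext (k ∷ ks) ext e = ∑-cong vals λ v _ → Σ*-ext ks ext (↦-cong k v λ j _ → e j)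

  private
    ↦-comm : ∀ σ {k j} v w → k ≢ j → ∀ i → (σ [ k ↦ v ] [ j ↦ w ]) i ≡ (σ [ j ↦ w ] [ k ↦ v ]) i
    ↦-comm σ {k} {j} v w ne i with k ≟ i | j ≟ i
    ... | yes refl | yes refl = contradiction refl ne
    ... | yes refl | no _     = refl
    ... | no _     | yes refl = refl
    ... | no _     | no _     = refl

  Σ*-delay : ∀ {ks k} → k ∉ ks → ∀ {F} → Extensional F → ∀ σ v →
             Σ* ks (σ [ k ↦ v ]) F ≡ Σ* ks σ (λ τ → F (τ [ k ↦ v ]))
  Σ*-delay {[]}     k∉ ext σ v = refl
  Σ*-delay {j ∷ ks} k∉ ext σ v = ∑-cong vals λ w _ →
    trans (Σ*-ext ks ext (↦-comm σ v w λ { refl → k∉ (here refl) }))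
          (Σ*-delay (k∉ ∘ there) ext (σ [ j ↦ w ]) v)

  -- If every line in direction k carries total at most 1, the whole sum is at
  -- most the number of lines.
  Σ*-lines : ∀ {ks k} → Unique ks → k ∈ ks → ∀ {F} → Extensional F →
             (∀ σ → ∑ vals (λ v → F (σ [ k ↦ v ])) ≤ 1) →
             ∀ σ → length vals * Σ* ks σ F ≤ length vals ^ length ks
  Σ*-lines {k ∷ ks} (k∉ ∷ u) (here refl) {F} ext line σ = *-monoʳ-≤ (length vals) (begin
      ∑ vals (λ v → Σ* ks (σ [ k ↦ v ]) F)
    ≡⟨ ∑-cong vals (λ v _ → Σ*-delay (λ k∈ → All.lookup k∉ k∈ refl) ext σ v) ⟩
      ∑ vals (λ v → Σ* ks σ (λ τ → F (τ [ k ↦ v ])))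
    ≡⟨ Σ*-∑ ks vals _ ⟨
      Σ* ks σ (λ τ → ∑ vals (λ v → F (τ [ k ↦ v ])))
    ≤⟨ Σ*-mono ks line ⟩
      Σ* ks σ (λ _ → 1)
    ≡⟨ trans (Σ*-const ks 1) (*-identityʳ _) ⟩
      length vals ^ length ks ∎)
    where open ≤-Reasoning
  Σ*-lines {j ∷ ks} {k} (j∉ ∷ u) (there k∈) {F} ext line σ = begin
      length vals * ∑ vals (λ v → Σ* ks (σ [ j ↦ v ]) F)
    ≡⟨ ∑-*ˡ (length vals) vals _ ⟩
      ∑ vals (λ v → length vals * Σ* ks (σ [ j ↦ v ]) F)
    ≤⟨ ∑-mono vals (λ v _ → Σ*-lines u k∈ ext line (σ [ j ↦ v ])) ⟩
      ∑ vals (λ _ → length vals ^ length ks)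
    ≡⟨ ∑-const vals _ ⟩
      length vals * length vals ^ length ks ∎
    where open ≤-Reasoning

-- The inclusion-exclusion sum and its recursion along a forest.

Slots : Set
Slots = Bool × Bool

∅ : Slots
∅ = false , false

slots : List Slots
slots = (false , false) ∷ (true , false) ∷ (false , true) ∷ (true , true) ∷ []

module Preorder {n : ℕ} (par : Fin n → Maybe (Fin n)) where

  isChild : Maybe (Fin n) → Fin n → Bool
  isChild p c = does (Maybe-≡-dec _≟ᶠ_ (par c) p)

  mutual
    -- The number is fuel, counted in levels, since parent pointers offer no structural recursion.
    -- The depth of the forest is enough fuel to reach every vertex (`dfs-complete`).
    sub : ℕ → Fin n → List (Fin n)
    sub zero    v = []
    sub (suc f) v = v ∷ forest f (just v) (allFin n)

    forest : ℕ → Maybe (Fin n) → List (Fin n) → List (Fin n)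
    forest f p []       = []
    forest f p (c ∷ cs) = (if isChild p c then sub f c else []) ++ forest f p cs

module EdgeOrder {n : ℕ} (adj : Fin n → Fin n → Bool) where

  -- Every edge is listed once, when the later of its endpoints is processed;
  -- δ marks the vertices processed so far.
  edgesFrom : (Fin n → Bool) → List (Fin n) → List (Fin n × Fin n)
  edgesFrom δ []      = []
  edgesFrom δ (v ∷ π) = map (_, v) (filterᵇ (λ u → adj u v ∧ δ u) (allFin n)) ++ edgesFrom (λ u → if does (v ≟ᶠ u) then true else δ u) π

-- A vertex has an in-slot and an out-slot. Inclusion–exclusion over the set of
-- slots that may be used is carried out with 2 ^ cQ ∸ 1 in the place of −1: an
-- unused slot then contributes 2 ^ cQ instead of 0.
module Weights {n : ℕ} (adj : Fin n → Fin n → Bool) (cQ cL : ℕ) (wt : Fin n → Fin n → ℕ) (vals : List Slots) where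

  minusOne : ℕ
  minusOne = 2 ^ cQ ∸ 1

  shift : Fin n → Fin n → ℕ
  shift u v = cQ + wt u v + wt v u

  -- The summand `2 ^ cL` is a loop at the vertex. It occupies both slots, hence is available only
  -- if both are allowed, and it marks a vertex left uncovered.
  vertexFactor : Slots → ℕ
  vertexFactor (x , y) = (if x then 1 else minusOne) * (if y then 1 else minusOne) * (if x ∧ y then 1 + 2 ^ cL else 1)

  arcs : Slots → Slots → ℕ
  arcs (x , y) (x′ , y′) = bit (y ∧ x′) + bit (y′ ∧ x)

  edgeFactor : Fin n → Fin n → Slots → Slots → ℕ
  edgeFactor u v s t = 1 + arcs s t * 2 ^ shift u v

  pairFactor : Fin n → Fin n → Slots → Slots → ℕ
  pairFactor u v s t = if adj u v then edgeFactor u v s t else 1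

  local : Fin n → (Fin n → Slots) → ℕ
  local v σ = vertexFactor (σ v) * ∏ (allFin n) (λ u → pairFactor u v (σ u) (σ v))

  localAcc : Fin n → (Fin n → Slots) → ℕ → ℕ
  localAcc v σ acc = foldl (λ a u → a * pairFactor u v (σ u) (σ v)) (acc * vertexFactor (σ v)) (allFin n)

  localAcc≡ : ∀ v σ acc → localAcc v σ acc ≡ acc * local v σ
  localAcc≡ v σ acc = trans (go (allFin n) _) (*-assoc acc _ _)
    where
    go : ∀ us a → foldl (λ a u → a * pairFactor u v (σ u) (σ v)) a us ≡ a * ∏ us (λ u → pairFactor u v (σ u) (σ v))
    go []       a = sym (*-identityʳ a)
    go (u ∷ us) a = trans (go us _) (*-assoc a _ _)

  open Assignments {Fin n} {Slots} _≟ᶠ_ vals public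
  open EdgeOrder adj public

  module Tree (par : Fin n → Maybe (Fin n)) where
    open Preorder par public

    mutual
      -- The value of one child's subtree becomes the accumulator of the next child. A product of
      -- subtree values thus arises without multiplying two large numbers, and the slots chosen
      -- inside a subtree are forgotten on leaving it.
      treeAcc : ℕ → Fin n → (Fin n → Slots) → ℕ → ℕ
      treeAcc zero    v σ acc = acc
      treeAcc (suc f) v σ acc = ∑ vals (λ s → forestAcc f (just v) (σ [ v ↦ s ]) (localAcc v (σ [ v ↦ s ]) acc) (allFin n))

      forestAcc : ℕ → Maybe (Fin n) → (Fin n → Slots) → ℕ → List (Fin n) → ℕ
      forestAcc f p σ acc []       = acc
      forestAcc f p σ acc (c ∷ cs) = forestAcc f p σ (if isChild p c then treeAcc f c σ acc else acc) cs

  -- The link between the recursion on the forest and the plain sum over all assignments: the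
  -- vertices are branched on one after the other, without separate treatment of subtrees.
  naive : List (Fin n) → (Fin n → Slots) → ℕ
  naive []      σ = 1
  naive (v ∷ π) σ = ∑ vals (λ s → local v (σ [ v ↦ s ]) * naive π (σ [ v ↦ s ]))

  Sep : List (Fin n) → List (Fin n) → Set
  Sep xs ys = ∀ {x y} → x ∈ xs → y ∈ ys → adj x y ≡ false

  private
    pairFactor-cong : ∀ u v {s s′} t → (adj u v ≡ true → s ≡ s′) → pairFactor u v s t ≡ pairFactor u v s′ t
    pairFactor-cong u v t e with adj u v
    ... | true  = cong (λ s → edgeFactor u v s t) (e refl)
    ... | false = refl

  local-cong : ∀ v {σ τ} → σ v ≡ τ v → (∀ u → adj u v ≡ true → σ u ≡ τ u) → local v σ ≡ local v τ
  local-cong v {σ} {τ} e₀ e rewrite e₀ = cong (vertexFactor (τ v) *_) (∏-cong (allFin n) λ u _ → pairFactor-cong u v (τ v) (e u))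

  naive-cong : ∀ π {σ τ} → (∀ v → v ∈ π → ∀ u → adj u v ≡ true → σ u ≡ τ u) → naive π σ ≡ naive π τ
  naive-cong []      e = refl
  naive-cong (v ∷ π) {σ} {τ} e = ∑-cong vals λ s _ → cong₂ _*_
    (local-cong v (trans (↦-≡ σ v s) (sym (↦-≡ τ v s))) λ u a → up s u (e v (here refl) u a))
    (naive-cong π λ w w∈ u a → up s u (e w (there w∈) u a))
    where
    up : ∀ s u → σ u ≡ τ u → (σ [ v ↦ s ]) u ≡ (τ [ v ↦ s ]) u
    up s u eq with v ≟ᶠ u
    ... | yes _ = refl
    ... | no _  = eq

  module Separated (par : Fin n → Maybe (Fin n))
    (sep : ∀ f p {c c′} → Preorder.isChild par p c ≡ true → Preorder.isChild par p c′ ≡ true → c ≢ c′ → Sep (Preorder.sub par f c) (Preorder.sub par f c′)) where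
    open Tree par

    sep-forest : ∀ f p {c} cs → isChild p c ≡ true → All (c ≢_) cs → Sep (sub f c) (forest f p cs)
    sep-forest f p []       ch []       x∈ ()
    sep-forest f p (d ∷ cs) ch (ne ∷ a) x∈ y∈ with isChild p d in chd
    ... | false = sep-forest f p cs ch a x∈ y∈
    ... | true with ∈-++⁻ (sub f d) y∈
    ...   | inj₁ y∈d = sep f p ch chd ne x∈ y∈d
    ...   | inj₂ y∈r = sep-forest f p cs ch a x∈ y∈r

    -- The slots of v may be forgotten once its subtree has been processed,
    -- because nothing that follows is adjacent to v.
    mutual
      tree-naive : ∀ f v σ acc π → Sep (sub f v) π → acc * naive (sub f v ++ π) σ ≡ treeAcc f v σ acc * naive π σ
      tree-naive zero    v σ acc π s = refl
      tree-naive (suc f) v σ acc π s = begin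
          acc * ∑ vals (λ t → local v (σ [ v ↦ t ]) * naive (forest f (just v) (allFin n) ++ π) (σ [ v ↦ t ]))
        ≡⟨ ∑-*ˡ acc vals _ ⟩
          ∑ vals (λ t → acc * (local v (σ [ v ↦ t ]) * naive (forest f (just v) (allFin n) ++ π) (σ [ v ↦ t ])))
        ≡⟨ ∑-cong vals (λ t _ → trans (sym (*-assoc acc _ _))
             (trans (cong (_* naive (forest f (just v) (allFin n) ++ π) (σ [ v ↦ t ])) (sym (localAcc≡ v (σ [ v ↦ t ]) acc)))
             (trans (forest-naive f (just v) (σ [ v ↦ t ]) _ (allFin n) (allFin⁺ n) π (λ x∈ → s (there x∈)))
                    (cong (forestAcc f (just v) (σ [ v ↦ t ]) _ (allFin n) *_) (naive-cong π (forget t)))))) ⟩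
          ∑ vals (λ t → forestAcc f (just v) (σ [ v ↦ t ]) (localAcc v (σ [ v ↦ t ]) acc) (allFin n) * naive π σ)
        ≡⟨ ∑-*ʳ (naive π σ) vals _ ⟨
          treeAcc (suc f) v σ acc * naive π σ ∎
        where
        open ≡-Reasoning
        forget : ∀ t w → w ∈ π → ∀ u → adj u w ≡ true → (σ [ v ↦ t ]) u ≡ σ u
        forget t w w∈ u a = ↦-≢ σ v t λ { refl → contradiction (trans (sym a) (s (here refl) w∈)) λ () }

      forest-naive : ∀ f p σ acc cs → Unique cs → ∀ π → Sep (forest f p cs) π →
                     acc * naive (forest f p cs ++ π) σ ≡ forestAcc f p σ acc cs * naive π σ
      forest-naive f p σ acc []       u π s = refl
      forest-naive f p σ acc (c ∷ cs) (c∉ ∷ u) π s with isChild p c in ch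
      ... | false = forest-naive f p σ acc cs u π s
      ... | true  = begin
          acc * naive ((sub f c ++ forest f p cs) ++ π) σ
        ≡⟨ cong (λ z → acc * naive z σ) (++-assoc (sub f c) _ π) ⟩
          acc * naive (sub f c ++ forest f p cs ++ π) σ
        ≡⟨ tree-naive f c σ acc _ sp ⟩
          treeAcc f c σ acc * naive (forest f p cs ++ π) σ
        ≡⟨ forest-naive f p σ _ cs u π (λ x∈ → s (∈-++⁺ʳ (sub f c) x∈)) ⟩
          forestAcc f p σ (treeAcc f c σ acc) cs * naive π σ ∎
        where
        open ≡-Reasoning
        sp : Sep (sub f c) (forest f p cs ++ π)
        sp x∈ y∈ with ∈-++⁻ (forest f p cs) y∈
        ... | inj₁ y∈f = sep-forest f p cs ch c∉ x∈ y∈f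
        ... | inj₂ y∈π = s (∈-++⁺ˡ x∈) y∈π

    forestAcc≡naive : ∀ f p σ → forestAcc f p σ 1 (allFin n) ≡ naive (forest f p (allFin n)) σ
    forestAcc≡naive f p σ = begin
        forestAcc f p σ 1 (allFin n)
      ≡⟨ *-identityʳ _ ⟨
        forestAcc f p σ 1 (allFin n) * 1
      ≡⟨ forest-naive f p σ 1 (allFin n) (allFin⁺ n) [] (λ _ ()) ⟨
        1 * naive (forest f p (allFin n) ++ []) σ
      ≡⟨ +-identityʳ _ ⟩
        naive (forest f p (allFin n) ++ []) σ
      ≡⟨ cong (λ z → naive z σ) (++-identityʳᴸ (forest f p (allFin n))) ⟩
        naive (forest f p (allFin n)) σ ∎
      where open ≡-Reasoning

  edgeProduct : List (Fin n × Fin n) → (Fin n → Slots) → ℕ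
  edgeProduct E σ = ∏ E (λ (u , v) → edgeFactor u v (σ u) (σ v))

  module _ (irr : ∀ v → adj v v ≡ false) where

    -- The factor of an edge is collected when its later endpoint is branched on: an earlier
    -- neighbour then has its final slots, while a later one still has `∅`, which makes the factor
    -- of the pair 1. This is the rule by which `edgesFrom` lists each edge once.
    naive-expand : ∀ δ {π} → Unique π → (∀ v → v ∈ π → δ v ≡ false) → ∀ σ → (∀ u → δ u ≡ false → σ u ≡ ∅) →
                   naive π σ ≡ Σ* π σ (λ τ → ∏ π (λ v → vertexFactor (τ v)) * edgeProduct (edgesFrom δ π) τ)
    naive-expand δ {[]}    u fresh σ init = refl
    naive-expand δ {v ∷ π} (v∉ ∷ u) fresh σ init = ∑-cong vals λ s _ →
      trans (cong (local v (σ [ v ↦ s ]) *_) (naive-expand δ′ u fresh′ (σ [ v ↦ s ]) (init′ s)))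
      (trans (sym (Σ*-*ˡ π (local v (σ [ v ↦ s ])) _)) (Σ*-cong π λ τ o → step s τ o))
      where
      δ′ : Fin n → Bool
      δ′ u = if does (v ≟ᶠ u) then true else δ u
      new : List (Fin n)
      new = filterᵇ (λ u → adj u v ∧ δ u) (allFin n)
      fresh′ : ∀ w → w ∈ π → δ′ w ≡ false
      fresh′ w w∈ with v ≟ᶠ w
      ... | yes refl = contradiction refl (All.lookup v∉ w∈)
      ... | no _ = fresh w (there w∈)
      init′ : ∀ s u → δ′ u ≡ false → (σ [ v ↦ s ]) u ≡ ∅
      init′ s u e with v ≟ᶠ u
      init′ s u () | yes _
      ... | no _ = init u e
      v∉π : v ∉ π
      v∉π v∈ = All.lookup v∉ v∈ refl
      trivial : ∀ s u → adj u v ∧ δ u ≡ false → pairFactor u v ((σ [ v ↦ s ]) u) s ≡ 1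
      trivial s u e with adj u v in a
      ... | false = refl
      ... | true = trans (cong (λ z → edgeFactor u v z s) (trans (↦-≢ σ v s λ { refl → contradiction (trans (sym a) (irr v)) λ () }) (init u e))) (cong (λ z → 1 + bit z * 2 ^ shift u v) (∧-zeroʳ (proj₂ s)))
      split : ∀ a b c d → (a * b) * (c * d) ≡ (a * c) * (b * d)
      split = solve-∀
      step : ∀ s τ → (∀ j → j ∉ π → τ j ≡ (σ [ v ↦ s ]) j) →
             local v (σ [ v ↦ s ]) * (∏ π (λ v → vertexFactor (τ v)) * edgeProduct (edgesFrom δ′ π) τ) ≡
             vertexFactor (τ v) * ∏ π (λ v → vertexFactor (τ v)) * edgeProduct (map (_, v) new ++ edgesFrom δ′ π) τ
      step s τ o = begin
          local v σ′ * (∏ π (λ v → vertexFactor (τ v)) * edgeProduct (edgesFrom δ′ π) τ)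
        ≡⟨ cong (_* (∏ π (λ v → vertexFactor (τ v)) * edgeProduct (edgesFrom δ′ π) τ)) loc≡ ⟩
          (vertexFactor (τ v) * ∏ new (λ u → edgeFactor u v (τ u) (τ v))) * (∏ π (λ v → vertexFactor (τ v)) * edgeProduct (edgesFrom δ′ π) τ)
        ≡⟨ split (vertexFactor (τ v)) _ _ _ ⟩
          (vertexFactor (τ v) * ∏ π (λ v → vertexFactor (τ v))) * (∏ new (λ u → edgeFactor u v (τ u) (τ v)) * edgeProduct (edgesFrom δ′ π) τ)
        ≡⟨ cong ((vertexFactor (τ v) * ∏ π (λ v → vertexFactor (τ v))) *_)
             (trans (cong (_* edgeProduct (edgesFrom δ′ π) τ) (sym (∏-map (_, v) new _))) (sym (∏-++ (map (_, v) new) _ _))) ⟩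
          vertexFactor (τ v) * ∏ π (λ v → vertexFactor (τ v)) * edgeProduct (map (_, v) new ++ edgesFrom δ′ π) τ ∎
        where
        open ≡-Reasoning
        σ′ : Fin n → Slots
        σ′ = σ [ v ↦ s ]
        τv : τ v ≡ s
        τv = trans (o v v∉π) (↦-≡ σ v s)
        σ′v : σ′ v ≡ s
        σ′v = ↦-≡ σ v s
        on-new : ∀ u → u ∈ new → pairFactor u v (σ′ u) s ≡ edgeFactor u v (τ u) (τ v)
        on-new u u∈ with a , d ← ∧-true {adj u v} {δ u} (proj₂ (∈-filterᵇ⁻ (λ u → adj u v ∧ δ u) {allFin n} u∈))
          rewrite a = cong₂ (edgeFactor u v) (sym (o u λ u∈π → contradiction (trans (sym d) (fresh u (there u∈π))) λ ())) (sym τv)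
        loc≡ : local v σ′ ≡ vertexFactor (τ v) * ∏ new (λ u → edgeFactor u v (τ u) (τ v))
        loc≡ = begin
            vertexFactor (σ′ v) * ∏ (allFin n) (λ u → pairFactor u v (σ′ u) (σ′ v))
          ≡⟨ cong (λ z → vertexFactor z * ∏ (allFin n) (λ u → pairFactor u v (σ′ u) z)) σ′v ⟩
            vertexFactor s * ∏ (allFin n) (λ u → pairFactor u v (σ′ u) s)
          ≡⟨ cong₂ (λ z w → vertexFactor z * w) (sym τv)
               (trans (∏-filterᵇ _ (allFin n) _ (trivial s)) (∏-cong new on-new)) ⟩
            vertexFactor (τ v) * ∏ new (λ u → edgeFactor u v (τ u) (τ v)) ∎

-- Duplicate-free lists up to permutation.

private
  strengthen : ∀ {x y : A} {xs} → x ≢ y → y ∈ x ∷ xs → y ∈ xs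
  strengthen ne (here refl) = contradiction refl ne
  strengthen ne (there q)   = q

⊆⇒↭ : ∀ {xs ys : List A} → Unique xs → (∀ {x} → x ∈ xs → x ∈ ys) → Σ[ zs ∈ List A ] (ys ↭ xs ++ zs)
⊆⇒↭ {xs = []}     {ys} u sub = ys , ↭-refl
⊆⇒↭ {xs = x ∷ xs} (x∉ ∷ u) sub with as , bs , refl ← ∈-∃++ (sub (here refl))
  with zs , p ← ⊆⇒↭ {xs = xs} {as ++ bs} u (λ y∈ → strengthen (All.lookup x∉ y∈) (∈-resp-↭ (↭-shift x as bs) (sub (there y∈)))) = zs , ↭-trans (↭-shift x as bs) (↭-prep x p)

⊆⇒length≤ : ∀ {xs ys : List A} → Unique xs → (∀ {x} → x ∈ xs → x ∈ ys) → length xs ≤ length ys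
⊆⇒length≤ {xs = xs} u sub with zs , p ← ⊆⇒↭ u sub = ≤-trans (m≤m+n _ (length zs)) (≤-reflexive (sym (trans (↭-length p) (length-++ xs))))

unique⇒↭ : ∀ {xs ys : List A} → Unique xs → Unique ys → (∀ {x} → x ∈ xs → x ∈ ys) → (∀ {x} → x ∈ ys → x ∈ xs) → ys ↭ xs
unique⇒↭ u v sub sup = ∼bag⇒↭ (unique∧set⇒bag v u (mk⇔ sup sub))

-- Levels, subtrees and separation in an elimination forest.

module ForestFacts {n : ℕ} (F : RootedForest n) where
  open RootedForest F using (rooted; Ancestor; here; there; level; leaf?)

  par : Fin n → Maybe (Fin n)
  par = parent F

  open Preorder par

  plevel′ : Maybe (Fin n) → ℕ
  plevel′ = maybe level 0

  rootPath-unique : ∀ {v d d′} → RootPath par v d → RootPath par v d′ → d ≡ d′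
  rootPath-unique (root e)    (root e′)     = refl
  rootPath-unique (root e)    (child e′ p)  = contradiction (trans (sym e) e′) λ ()
  rootPath-unique (child e p) (root e′)     = contradiction (trans (sym e) e′) λ ()
  rootPath-unique (child e p) (child e′ p′) with refl ← just-injective (trans (sym e) e′) = cong suc (rootPath-unique p p′)

  level≡ : ∀ v → level v ≡ suc (plevel′ (par v))
  level≡ v with rooted v
  ... | _ , root e    rewrite e = refl
  ... | _ , child e p rewrite e = cong suc (rootPath-unique p (proj₂ (rooted _)))

  level-child : ∀ {u v} → par u ≡ just v → level u ≡ suc (level v)
  level-child {u} e = trans (level≡ u) (cong (suc ∘ plevel′) e)

  ≤-foldr : ∀ (f : Fin n → ℕ) {xs x} → x ∈ xs → f x ≤ foldr _⊔_ 0 (map f xs)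
  ≤-foldr f (here refl) = m≤m⊔n _ _
  ≤-foldr f (there p)   = ≤-trans (≤-foldr f p) (m≤n⊔m _ _)

  -- `depth` is a maximum over leaves only. From any vertex one descends to children until a leaf is
  -- met; each descent raises the level by one, and the largest level `top` of any vertex bounds
  -- their number.
  level≤depth : ∀ v → level v ≤ depth F
  level≤depth v = go (top ∸ level v) v ≤-refl
    where
    top : ℕ
    top = foldr _⊔_ 0 (map level (allFin n))
    go : ∀ k v → top ∸ level v ≤ k → level v ≤ depth F
    go k v le with any? (λ u → Maybe-≡-dec _≟ᶠ_ (par u) (just v))
    ... | no leaf = ≤-foldr level (∈-filter⁺ leaf? (∈-allFin v) leaf)
    go zero    v le | yes (u , e) = contradiction (≤-trans (≤-trans (≤-reflexive (sym (level-child e))) (≤-foldr level (∈-allFin u))) (m∸n≡0⇒m≤n (n≤0⇒n≡0 le))) (<⇒≱ ≤-refl)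
    go (suc k) v le | yes (u , e) = ≤-trans (n≤1+n _) (≤-trans (≤-reflexive (sym (level-child e)))
      (go k u (≤-trans (≤-reflexive (trans (cong (top ∸_) (level-child e)) (sym (pred[m∸n]≡m∸[1+n] top (level v))))) (pred-mono-≤ le))))

  data _⊑_ (c : Fin n) : Fin n → Set where
    self : c ⊑ c
    step : ∀ {x y} → par x ≡ just y → c ⊑ y → c ⊑ x

  ⊑-trans : ∀ {a b c} → a ⊑ b → b ⊑ c → a ⊑ c
  ⊑-trans p self       = p
  ⊑-trans p (step e q) = step e (⊑-trans p q)

  ancestor⇒⊑ : ∀ {u v} → Ancestor u v → u ⊑ v
  ancestor⇒⊑ (here e)    = step e self
  ancestor⇒⊑ (there e a) = step e (ancestor⇒⊑ a)

  ⊑-level : ∀ {c x} → c ⊑ x → level c ≤ level x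
  ⊑-level self       = ≤-refl
  ⊑-level (step e p) = ≤-trans (⊑-level p) (≤-trans (n≤1+n _) (≤-reflexive (sym (level-child e))))

  -- The ancestors of `x` form a chain along which the level is strictly monotone.
  ⊑-same : ∀ {a b x} → a ⊑ x → b ⊑ x → level a ≡ level b → a ≡ b
  ⊑-same self       self        e = refl
  ⊑-same self       (step e q)  l = contradiction (≤-trans (≤-reflexive (trans (sym (level-child e)) l)) (⊑-level q)) (<⇒≱ ≤-refl)
  ⊑-same (step e p) self        l = contradiction (≤-trans (≤-reflexive (trans (sym (level-child e)) (sym l))) (⊑-level p)) (<⇒≱ ≤-refl)
  ⊑-same (step e p) (step e′ q) l with refl ← just-injective (trans (sym e) e′) = ⊑-same p q l

  ⊑-first : ∀ {c x} → c ⊑ x → c ≡ x ⊎ Σ[ d ∈ Fin n ] (par d ≡ just c × d ⊑ x)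
  ⊑-first self = inj₁ refl
  ⊑-first (step {x} e p) with ⊑-first p
  ... | inj₁ refl         = inj₂ (x , e , self)
  ... | inj₂ (d , e′ , q) = inj₂ (d , e′ , step e q)

  root⊑ : ∀ {v d} → RootPath par v d → Σ[ r ∈ Fin n ] (par r ≡ nothing × r ⊑ v)
  root⊑ (root e)    = _ , e , self
  root⊑ (child e p) with r , e′ , q ← root⊑ p = r , e′ , step e q

  isChild⇒≡ : ∀ p c → isChild p c ≡ true → par c ≡ p
  isChild⇒≡ p c e with Maybe-≡-dec _≟ᶠ_ (par c) p
  ... | yes eq = eq

  ≡⇒isChild : ∀ {p c} → par c ≡ p → isChild p c ≡ true
  ≡⇒isChild {p} {c} e with Maybe-≡-dec _≟ᶠ_ (par c) p
  ... | yes _ = refl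
  ... | no ne = contradiction e ne

  mutual
    ∈-sub⇒⊑ : ∀ f {c x} → x ∈ sub f c → c ⊑ x
    ∈-sub⇒⊑ (suc f) (here refl) = self
    ∈-sub⇒⊑ (suc f) {c} (there x∈) with d , _ , e , p ← ∈-forest⇒⊑ f (just c) (allFin n) x∈ = ⊑-trans (step e self) p

    ∈-forest⇒⊑ : ∀ f p cs {x} → x ∈ forest f p cs → Σ[ d ∈ Fin n ] (d ∈ cs × par d ≡ p × d ⊑ x)
    ∈-forest⇒⊑ f p (c ∷ cs) x∈ with isChild p c in ch
    ... | false with d , d∈ , r ← ∈-forest⇒⊑ f p cs x∈ = d , there d∈ , r
    ... | true with ∈-++⁻ (sub f c) x∈
    ...   | inj₁ q = c , here refl , isChild⇒≡ p c ch , ∈-sub⇒⊑ f q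
    ...   | inj₂ q with d , d∈ , r ← ∈-forest⇒⊑ f p cs q = d , there d∈ , r

  ∈-forest : ∀ f p {cs c x} → c ∈ cs → par c ≡ p → x ∈ sub f c → x ∈ forest f p cs
  ∈-forest f p {c ∷ cs} (here refl) e x∈ rewrite ≡⇒isChild e = ∈-++⁺ˡ x∈
  ∈-forest f p {d ∷ cs} (there c∈)  e x∈ = ∈-++⁺ʳ (if isChild p d then sub f d else []) (∈-forest f p c∈ e x∈)

  -- Each unit of fuel pays for one level, beginning with that of `c`.
  ⊑⇒∈-sub : ∀ f {c x} → c ⊑ x → level x < level c + f → x ∈ sub f c
  ⊑⇒∈-sub zero    p l = contradiction (⊑-level p) (<⇒≱ (≤-trans l (≤-reflexive (+-identityʳ _))))
  ⊑⇒∈-sub (suc f) {c} {x} p l with ⊑-first p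
  ... | inj₁ refl = here refl
  ... | inj₂ (d , e , q) = there (∈-forest f (just c) (∈-allFin d) e (⊑⇒∈-sub f q (≤-trans l (≤-reflexive (trans (+-suc (level c) f) (cong (_+ f) (sym (level-child e))))))))

  children-level : ∀ {c c′} → par c ≡ par c′ → level c ≡ level c′
  children-level {c} {c′} e = trans (level≡ c) (trans (cong (suc ∘ plevel′) e) (sym (level≡ c′)))

  mutual
    sub-unique : ∀ f c → Unique (sub f c)
    sub-unique zero    c = []
    sub-unique (suc f) c = All.tabulate (λ {x} x∈ → λ { refl → let d , _ , e , p = ∈-forest⇒⊑ f (just c) (allFin n) x∈ in
        contradiction (≤-trans (≤-reflexive (sym (level-child e))) (⊑-level p)) (<⇒≱ ≤-refl) }) ∷ forest-unique f (just c) (allFin⁺ n)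

    forest-unique : ∀ f p {cs} → Unique cs → Unique (forest f p cs)
    forest-unique f p {[]} u = []
    forest-unique f p {c ∷ cs} (c∉ ∷ u) with isChild p c in ch
    ... | false = forest-unique f p u
    ... | true  = unique-++⁺ (sub-unique f c) (forest-unique f p u) λ (x∈ , y∈) →
      let d , d∈ , e , q = ∈-forest⇒⊑ f p cs y∈ in
      All.lookup c∉ d∈ (⊑-same (∈-sub⇒⊑ f x∈) q (children-level (trans (isChild⇒≡ p c ch) (sym e))))

  dfs : List (Fin n)
  dfs = forest (depth F) nothing (allFin n)

  dfs-unique : Unique dfs
  dfs-unique = forest-unique (depth F) nothing (allFin⁺ n)

  dfs-complete : ∀ v → v ∈ dfs
  dfs-complete v with r , e , p ← root⊑ (proj₂ (rooted v)) =
    ∈-forest (depth F) nothing (∈-allFin r) e (⊑⇒∈-sub (depth F) p (≤-trans (s≤s (level≤depth v)) (≤-reflexive (cong (_+ depth F) (sym (trans (level≡ r) (cong (suc ∘ plevel′) e)))))))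

  length-dfs : length dfs ≡ n
  length-dfs = trans (↭-length (unique⇒↭ (allFin⁺ n) dfs-unique (λ {x} _ → dfs-complete x) (λ {x} _ → ∈-allFin x))) (length-tabulate {n = n} id)

  module _ {G : Graph n} (elim : IsEliminationForest G F) where

    -- An edge between the two subtrees would make one of its endpoints a descendant of both `c` and
    -- `c′`. These are on the same level, so they would coincide.
    separated : ∀ f p {c c′} → isChild p c ≡ true → isChild p c′ ≡ true → c ≢ c′ →
                ∀ {x y} → x ∈ sub f c → y ∈ sub f c′ → adj G x y ≡ false
    separated f p {c} {c′} ch ch′ ne {x} {y} x∈ y∈ with adj G x y in a
    ... | false = refl
    ... | true with elim x y (Equivalence.from T-≡ a)
    ...   | inj₁ an = contradiction (⊑-same (⊑-trans (∈-sub⇒⊑ f x∈) (ancestor⇒⊑ an)) (∈-sub⇒⊑ f y∈) same) ne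
      where
      same : level c ≡ level c′
      same = children-level (trans (isChild⇒≡ p c ch) (sym (isChild⇒≡ p c′ ch′)))
    ...   | inj₂ an = contradiction (⊑-same (∈-sub⇒⊑ f x∈) (⊑-trans (∈-sub⇒⊑ f y∈) (ancestor⇒⊑ an)) same) ne
      where
      same : level c ≡ level c′
      same = children-level (trans (isChild⇒≡ p c ch) (sym (isChild⇒≡ p c′ ch′)))

-- Indicators, edge subsets and orientations.

𝟙 : Dec A → ℕ
𝟙 p = bit (does p)

𝟙-cong : (p : Dec A) (q : Dec A′) → (A → A′) → (A′ → A) → 𝟙 p ≡ 𝟙 q
𝟙-cong (yes _) (yes _) f g = refl
𝟙-cong (yes p) (no ¬q) f g = contradiction (f p) ¬q
𝟙-cong (no ¬p) (yes q) f g = contradiction (g q) ¬p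
𝟙-cong (no _)  (no _)  f g = refl

𝟙-yes : (p : Dec A) → A → 𝟙 p ≡ 1
𝟙-yes (yes _) x = refl
𝟙-yes (no ¬p) x = contradiction x ¬p

𝟙-no : (p : Dec A) → ¬ A → 𝟙 p ≡ 0
𝟙-no (yes p) x = contradiction p x
𝟙-no (no _)  x = refl

𝟙-× : (p : Dec A) (q : Dec A′) → 𝟙 (p ×-dec q) ≡ 𝟙 p * 𝟙 q
𝟙-× (yes _) (yes _) = refl
𝟙-× (yes _) (no _)  = refl
𝟙-× (no _)  (yes _) = refl
𝟙-× (no _)  (no _)  = refl

-- Expanding products of sums.

subs : List A → List (List A)
subs []      = [] ∷ []
subs (e ∷ E) = subs E ++ map (e ∷_) (subs E)

subs⇒⊆ : ∀ (E : List A) {C} → C ∈ subs E → ∀ {e} → e ∈ C → e ∈ E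
subs⇒⊆ []      (here refl) ()
subs⇒⊆ (x ∷ E) C∈ e∈ with ∈-++⁻ (subs E) C∈
... | inj₁ p = there (subs⇒⊆ E p e∈)
... | inj₂ p with ∈-map⁻ (x ∷_) p
subs⇒⊆ (x ∷ E) C∈ (here q)  | inj₂ p | C , r , refl = here q
subs⇒⊆ (x ∷ E) C∈ (there q) | inj₂ p | C , r , refl = there (subs⇒⊆ E r q)

subs-unique : ∀ {B : Set} (f : A → B) E {C} → C ∈ subs E → Unique (map f E) → Unique (map f C)
subs-unique f []      (here refl) u = u
subs-unique f (x ∷ E) C∈ (x∉ ∷ u) with ∈-++⁻ (subs E) C∈
... | inj₁ p = subs-unique f E p u
... | inj₂ p with C , r , refl ← ∈-map⁻ (x ∷_) p = All.tabulate (λ y∈ → let e , e∈ , q = ∈-map⁻ f y∈ in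
        subst (f x ≢_) (sym q) (All.lookup x∉ (∈-map⁺ f (subs⇒⊆ E r e∈)))) ∷ subs-unique f E r u

∏-subs : ∀ (E : List A) g → ∏ E (λ e → 1 + g e) ≡ ∑ (subs E) (λ C → ∏ C g)
∏-subs []      g = refl
∏-subs (e ∷ E) g = begin
    (1 + g e) * ∏ E (λ e → 1 + g e)
  ≡⟨ cong ((1 + g e) *_) (∏-subs E g) ⟩
    ∑ (subs E) (λ C → ∏ C g) + g e * ∑ (subs E) (λ C → ∏ C g)
  ≡⟨ cong (∑ (subs E) (λ C → ∏ C g) +_) (trans (∑-*ˡ (g e) (subs E) _) (sym (∑-map (e ∷_) (subs E) _))) ⟩
    ∑ (subs E) (λ C → ∏ C g) + ∑ (map (e ∷_) (subs E)) (λ C → ∏ C g)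
  ≡⟨ ∑-++ (subs E) _ _ ⟨
    ∑ (subs (e ∷ E)) (λ C → ∏ C g) ∎
  where open ≡-Reasoning

orients : List (A × A) → List (List (A × A))
orients []            = [] ∷ []
orients ((u , v) ∷ C) = map ((u , v) ∷_) (orients C) ++ map ((v , u) ∷_) (orients C)

∏-orients : ∀ (C : List (A × A)) α t → ∏ C (λ (u , v) → (α (u , v) + α (v , u)) * t (u , v)) ≡ ∏ C t * ∑ (orients C) (λ D → ∏ D α)
∏-orients []            α t = refl
∏-orients ((u , v) ∷ C) α t = begin
    (α (u , v) + α (v , u)) * t (u , v) * ∏ C (λ (u , v) → (α (u , v) + α (v , u)) * t (u , v))
  ≡⟨ cong ((α (u , v) + α (v , u)) * t (u , v) *_) (∏-orients C α t) ⟩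
    (α (u , v) + α (v , u)) * t (u , v) * (∏ C t * Σα)
  ≡⟨ eq (α (u , v)) (α (v , u)) (t (u , v)) (∏ C t) Σα ⟩
    t (u , v) * ∏ C t * (α (u , v) * Σα + α (v , u) * Σα)
  ≡⟨ cong (t (u , v) * ∏ C t *_) (sym (trans (∑-++ (map ((u , v) ∷_) (orients C)) _ _) (cong₂ _+_ (half (u , v)) (half (v , u))))) ⟩
    t (u , v) * ∏ C t * ∑ (orients ((u , v) ∷ C)) (λ D → ∏ D α) ∎
  where
  open ≡-Reasoning
  Σα : ℕ
  Σα = ∑ (orients C) (λ D → ∏ D α)
  eq : ∀ a b t p s → (a + b) * t * (p * s) ≡ t * p * (a * s + b * s)
  eq = solve-∀
  half : ∀ e → ∑ (map (e ∷_) (orients C)) (λ D → ∏ D α) ≡ α e * Σα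
  half e = trans (∑-map (e ∷_) (orients C) _) (sym (∑-*ˡ (α e) (orients C) _))

length-orients : ∀ (C : List (A × A)) {D} → D ∈ orients C → length D ≡ length C
length-orients []            (here refl) = refl
length-orients ((u , v) ∷ C) D∈ with ∈-++⁻ (map ((u , v) ∷_) (orients C)) D∈
... | inj₁ p with D , D∈ , refl ← ∈-map⁻ _ p = cong suc (length-orients C D∈)
... | inj₂ p with D , D∈ , refl ← ∈-map⁻ _ p = cong suc (length-orients C D∈)

-- Degrees, open slots and loops.

module Degrees {n : ℕ} where

  Arc : Set
  Arc = Fin n × Fin n

  inn out inc : List Arc → Fin n → ℕ
  inn D v = ∑ D (λ e → 𝟙 (proj₂ e ≟ᶠ v))
  out D v = ∑ D (λ e → 𝟙 (proj₁ e ≟ᶠ v))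
  inc D v = inn D v + out D v

  ∑-𝟙 : ∀ {π : List (Fin n)} → Unique π → ∀ {a} → a ∈ π → ∑ π (λ v → 𝟙 (a ≟ᶠ v)) ≡ 1
  ∑-𝟙 {v ∷ π} (v∉ ∷ u) {a} a∈ with a ≟ᶠ v
  ... | yes refl = cong suc (∑-zero π λ w w∈ → 𝟙-no (a ≟ᶠ w) λ { refl → All.lookup v∉ w∈ refl })
  ∑-𝟙 {v ∷ π} (v∉ ∷ u) (here refl) | no ne = contradiction refl ne
  ∑-𝟙 {v ∷ π} (v∉ ∷ u) (there a∈)  | no ne = ∑-𝟙 u a∈

  module _ {π : List (Fin n)} (u : Unique π) (complete : ∀ v → v ∈ π) where

    handshake : ∀ D → ∑ π (inc D) ≡ 2 * length D
    handshake D = trans (sym (∑-+ π (inn D) (out D))) (trans (cong₂ _+_ (side proj₂) (side proj₁)) (cong (length D +_) (sym (+-identityʳ _))))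
      where
      side : ∀ (f : Arc → Fin n) → ∑ π (λ v → ∑ D (λ e → 𝟙 (f e ≟ᶠ v))) ≡ length D
      side f = trans (∑-swap π D (λ v e → 𝟙 (f e ≟ᶠ v))) (trans (∑-cong D λ e _ → ∑-𝟙 u (complete (f e))) (trans (∑-const D 1) (*-identityʳ _)))

  z : ℕ → ℕ
  z zero    = 1
  z (suc _) = 0

  Good : List Arc → Fin n → Set
  Good D v = (inn D v ≡ 1 × out D v ≡ 1) ⊎ inc D v ≡ 0

  good? : ∀ D v → Dec (Good D v)
  good? D v = ((inn D v ≟ 1) ×-dec (out D v ≟ 1)) ⊎-dec (inc D v ≟ 0)

  missing : List Arc → Fin n → ℕ
  missing D v = z (inn D v) + z (out D v)

  isolated : List Arc → List (Fin n) → ℕ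
  isolated D π = ∑ π (λ v → 𝟙 (inc D v ≟ 0))

  -- The possible values of (slots left open plus loops , loops), a loop being
  -- an alternative to the slots of a vertex.
  loops : List Arc → List (Fin n) → List (ℕ × ℕ)
  loops D []      = (0 , 0) ∷ []
  loops D (v ∷ π) = map (λ (d , l) → missing D v + d , l) (loops D π) ++ map (λ (d , l) → suc d , suc l) (loops D π)

  loops-length : ∀ D π → length (loops D π) ≡ 2 ^ length π
  loops-length D []      = refl
  loops-length D (v ∷ π) = trans (length-++ (map _ (loops D π))) (cong₂ _+_ (trans (length-map _ (loops D π)) (loops-length D π))
    (trans (length-map _ (loops D π)) (trans (loops-length D π) (sym (+-identityʳ _)))))

  loops-≤ : ∀ D π {d l} → (d , l) ∈ loops D π → l ≤ length π
  loops-≤ D []      (here refl) = z≤n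
  loops-≤ D (v ∷ π) x∈ with ∈-++⁻ (map _ (loops D π)) x∈
  ... | inj₁ p with _ , y∈ , refl ← ∈-map⁻ _ p = m≤n⇒m≤1+n (loops-≤ D π y∈)
  ... | inj₂ p with _ , y∈ , refl ← ∈-map⁻ _ p = s≤s (loops-≤ D π y∈)

  private
    slot≥ : ∀ a o → 2 ≤ 2 * (z a + z o) + (a + o)
    slot≥ zero    zero    = s≤s (s≤s z≤n)
    slot≥ zero    (suc o) = s≤s (s≤s z≤n)
    slot≥ (suc a) zero    = s≤s (s≤s z≤n)
    slot≥ (suc a) (suc o) = s≤s (subst (1 ≤_) (sym (+-suc a o)) (s≤s z≤n))

    slot≡ : ∀ a o → 2 * (z a + z o) + (a + o) ≡ 2 → a ≡ 1 × o ≡ 1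
    slot≡ zero    zero    ()
    slot≡ zero    (suc o) ()
    slot≡ (suc a) zero    ()
    slot≡ (suc zero) (suc zero) e = refl , refl
    slot≡ (suc zero) (suc (suc o)) ()
    slot≡ (suc (suc a)) (suc o) e with () ← trans (sym (cong (2 +_) (+-suc a o))) e

    rearr : ∀ m d s t → 2 * (m + d) + (s + t) ≡ (2 * m + s) + (2 * d + t)
    rearr = solve-∀

    twice : ∀ k → 2 * suc k ≡ 2 + 2 * k
    twice = solve-∀

    split-≡ : ∀ {a b x y} → a ≤ x → b ≤ y → x + y ≡ a + b → x ≡ a × y ≡ b
    split-≡ {a} {b} {x} {y} p q e = ≤-antisym (+-cancelʳ-≤ y x a (≤-trans (≤-reflexive e) (+-monoʳ-≤ a q))) p
                                  , ≤-antisym (+-cancelˡ-≤ x y b (≤-trans (≤-reflexive e) (+-monoˡ-≤ b p))) q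

  -- Vertex by vertex: an open slot counts 2, a loop 2 and an incident arc 1, so every vertex
  -- accounts for at least 2. With `handshake` this says that the number of arcs plus `d` is at
  -- least the number of vertices, so a coefficient at exactly that number sees extremal
  -- configurations only.
  loops-≥ : ∀ D π {d l} → (d , l) ∈ loops D π → 2 * length π ≤ 2 * d + ∑ π (inc D)
  loops-≥ D []      (here refl) = z≤n
  loops-≥ D (v ∷ π) x∈ with ∈-++⁻ (map _ (loops D π)) x∈
  ... | inj₁ p with (d , l) , y∈ , refl ← ∈-map⁻ _ p =
    subst₂ _≤_ (sym (twice (length π))) (sym (rearr (missing D v) d (inc D v) _)) (+-mono-≤ (slot≥ (inn D v) (out D v)) (loops-≥ D π y∈))
  ... | inj₂ p with (d , l) , y∈ , refl ← ∈-map⁻ _ p =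
    subst₂ _≤_ (sym (twice (length π))) (sym (rearr 1 d (inc D v) _)) (+-mono-≤ (m≤m+n 2 (inc D v)) (loops-≥ D π y∈))

  Tight : List Arc → List (Fin n) → ℕ → ℕ × ℕ → Set
  Tight D π t (d , l) = 2 * d + ∑ π (inc D) ≡ 2 * length π × l ≡ t

  tight? : ∀ D π t x → Dec (Tight D π t x)
  tight? D π t (d , l) = (2 * d + ∑ π (inc D) ≟ 2 * length π) ×-dec (l ≟ t)

  Balanced : List Arc → List (Fin n) → ℕ → Set
  Balanced D π t = All (Good D) π × isolated D π ≡ t

  balanced? : ∀ D π t → Dec (Balanced D π t)
  balanced? D π t = all? (good? D) π ×-dec (isolated D π ≟ t)

  -- Equality in `loops-≥` forces equality at every vertex: either both slots are used exactly once
  -- and there is no loop, or there is a loop and no arc. Given `D`, the loops of a tight choice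
  -- therefore sit precisely at the isolated vertices, and the choice is unique; it exists iff all
  -- other vertices have in- and out-degree 1.
  loops-count : ∀ D π t → ∑ (loops D π) (λ x → 𝟙 (tight? D π t x)) ≡ 𝟙 (balanced? D π t)
  loops-count D []      t = trans (+-identityʳ _) (𝟙-cong (tight? D [] t (0 , 0)) (balanced? D [] t) (λ (_ , e) → [] , e) (λ (_ , e) → refl , e))
  loops-count D (v ∷ π) t = trans (∑-++ (map _ (loops D π)) _ _)
    (trans (cong₂ _+_ (∑-map _ (loops D π) _) (∑-map _ (loops D π) _)) (go (inc D v ≟ 0)))
    where
    S : ℕ
    S = ∑ π (inc D)
    no-loop : ∀ {d l} → (d , l) ∈ loops D π → Tight D (v ∷ π) t (missing D v + d , l) → (inn D v ≡ 1 × out D v ≡ 1) × Tight D π t (d , l)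
    no-loop {d} {l} y∈ (e , f) with p , q ← split-≡ (slot≥ (inn D v) (out D v)) (loops-≥ D π y∈)
      (trans (sym (rearr (missing D v) d (inc D v) S)) (trans e (twice (length π)))) = slot≡ _ _ p , q , f
    loop : ∀ {d l} → (d , l) ∈ loops D π → Tight D (v ∷ π) t (suc d , suc l) → inc D v ≡ 0 × (2 * d + S ≡ 2 * length π × suc l ≡ t)
    loop {d} {l} y∈ (e , f) with p , q ← split-≡ (m≤m+n 2 (inc D v)) (loops-≥ D π y∈)
      (trans (sym (rearr 1 d (inc D v) S)) (trans e (twice (length π)))) = +-cancelˡ-≡ 2 (inc D v) 0 p , q , f
    go : Dec (inc D v ≡ 0) →
         ∑ (loops D π) (λ (d , l) → 𝟙 (tight? D (v ∷ π) t (missing D v + d , l))) +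
         ∑ (loops D π) (λ (d , l) → 𝟙 (tight? D (v ∷ π) t (suc d , suc l))) ≡ 𝟙 (balanced? D (v ∷ π) t)
    go (yes i) = trans (cong₂ _+_
        (∑-zero (loops D π) λ (d , l) y∈ → 𝟙-no (tight? D (v ∷ π) t (missing D v + d , l)) λ x → contradiction (trans (sym (proj₁ (proj₁ (no-loop y∈ x)))) (m+n≡0⇒m≡0 (inn D v) i)) λ ())
        refl) (by t refl)
      where
      iso : isolated D (v ∷ π) ≡ suc (isolated D π)
      iso = cong (_+ isolated D π) (𝟙-yes (inc D v ≟ 0) i)
      by : ∀ t′ → t ≡ t′ → ∑ (loops D π) (λ (d , l) → 𝟙 (tight? D (v ∷ π) t (suc d , suc l))) ≡ 𝟙 (balanced? D (v ∷ π) t)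
      by zero refl = trans (∑-zero (loops D π) λ (d , l) _ → 𝟙-no (tight? D (v ∷ π) 0 (suc d , suc l)) λ ())
        (sym (𝟙-no (balanced? D (v ∷ π) 0) λ (_ , e) → contradiction (trans (sym iso) e) λ ()))
      by (suc t′) refl = trans (∑-cong (loops D π) λ (d , l) y∈ → 𝟙-cong (tight? D (v ∷ π) t (suc d , suc l)) (tight? D π t′ (d , l))
            (λ x → let (_ , e , f) = loop y∈ x in e , suc-injective f)
            (λ (e , f) → trans (rearr 1 d (inc D v) S) (trans (cong₂ _+_ (cong (2 +_) i) e) (sym (twice (length π)))) , cong suc f))
        (trans (loops-count D π t′) (𝟙-cong (balanced? D π t′) (balanced? D (v ∷ π) t)
            (λ (g , e) → (inj₂ i ∷ g) , trans iso (cong suc e))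
            (λ { ((_ ∷ g) , e) → g , suc-injective (trans (sym iso) e) })))
    go (no ¬i) = trans (cong₂ _+_ (∑-cong (loops D π) λ (d , l) y∈ →
          trans (𝟙-cong (tight? D (v ∷ π) t (missing D v + d , l)) (both ×-dec tight? D π t (d , l)) (no-loop y∈) back) (𝟙-× both (tight? D π t (d , l))))
        (∑-zero (loops D π) λ (d , l) y∈ → 𝟙-no (tight? D (v ∷ π) t (suc d , suc l)) λ x → ¬i (proj₁ (loop y∈ x))))
      (trans (+-identityʳ _) (trans (sym (∑-*ˡ (𝟙 both) (loops D π) _)) (trans (cong (𝟙 both *_) (loops-count D π t))
        (trans (sym (𝟙-× both (balanced? D π t))) (𝟙-cong (both ×-dec balanced? D π t) (balanced? D (v ∷ π) t)
          (λ (b , g , e) → (inj₁ b ∷ g) , trans iso e)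
          (λ { ((inj₁ b ∷ g) , e) → b , g , trans (sym iso) e ; ((inj₂ i ∷ g) , e) → contradiction i ¬i }))))))
      where
      both : Dec (inn D v ≡ 1 × out D v ≡ 1)
      both = (inn D v ≟ 1) ×-dec (out D v ≟ 1)
      iso : isolated D (v ∷ π) ≡ isolated D π
      iso = cong (_+ isolated D π) (𝟙-no (inc D v ≟ 0) ¬i)
      one : ∀ {a o} → a ≡ 1 × o ≡ 1 → 2 * (z a + z o) + (a + o) ≡ 2
      one (refl , refl) = refl
      back : ∀ {d l} → (inn D v ≡ 1 × out D v ≡ 1) × Tight D π t (d , l) → Tight D (v ∷ π) t (missing D v + d , l)
      back {d} (b , e , f) = trans (rearr (missing D v) d (inc D v) S) (trans (cong₂ _+_ (one b) e) (sym (twice (length π)))) , f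

-- Reading a coefficient off a value of a polynomial.

coefficient : ∀ X es t → length es < X → Σ[ lo ∈ ℕ ] Σ[ hi ∈ ℕ ]
              (∑ es (X ^_) ≡ lo + (∑ es (λ e → 𝟙 (e ≟ t)) + X * hi) * X ^ t × lo < X ^ t)
coefficient X es t short = let lo , hi , e , p = go es in lo , hi , e , *-cancelʳ-< X lo (X ^ t) (≤-<-trans p (subst (_< X ^ t * X) (*-comm (X ^ t) (length es))
    (*-monoʳ-< (X ^ t) {{>-nonZero (m^n>0 X {{>-nonZero (≤-<-trans z≤n short)}} t)}} short)))
  where
  -- The bound on `lo * X` is the inductive form of `lo < X ^ t`: each exponent below `t` adds at
  -- most one `X ^ t` to the left-hand side, and there are fewer than `X` exponents in all.
  go : ∀ es → Σ[ lo ∈ ℕ ] Σ[ hi ∈ ℕ ]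
       (∑ es (X ^_) ≡ lo + (∑ es (λ e → 𝟙 (e ≟ t)) + X * hi) * X ^ t × lo * X ≤ length es * X ^ t)
  go [] = 0 , 0 , sym (cong (_* X ^ t) (*-zeroʳ X)) , z≤n
  go (e ∷ es) with go es | <-cmp e t
  ... | lo , hi , eq , le | tri< e<t e≢t _ = X ^ e + lo , hi ,
    trans (cong (X ^ e +_) eq) (trans (sym (+-assoc (X ^ e) lo _))
      (cong (λ c → X ^ e + lo + (c + ∑ es (λ e → 𝟙 (e ≟ t)) + X * hi) * X ^ t) (sym (𝟙-no (e ≟ t) e≢t)))) ,
    subst (_≤ X ^ t + length es * X ^ t) (sym (*-distribʳ-+ X (X ^ e) lo)) (+-mono-≤ small le)
    where
    small : X ^ e * X ≤ X ^ t
    small = subst (_≤ X ^ t) (*-comm X (X ^ e)) (^-monoʳ-≤ X {{>-nonZero (≤-<-trans z≤n short)}} e<t)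
  ... | lo , hi , eq , le | tri≈ _ refl _ = lo , hi ,
    trans (cong (X ^ e +_) eq) (trans (solve′ (X ^ e) lo (∑ es (λ d → 𝟙 (d ≟ e)) + X * hi))
      (cong (λ c → lo + (c + ∑ es (λ d → 𝟙 (d ≟ e)) + X * hi) * X ^ e) (sym (𝟙-yes (e ≟ e) refl)))) ,
    ≤-trans le (m≤n+m _ (X ^ e))
    where
    solve′ : ∀ p l c → p + (l + c * p) ≡ l + (1 + c) * p
    solve′ = solve-∀
  ... | lo , hi , eq , le | tri> _ e≢t t<e with k , refl ← m≤n⇒∃[o]m+o≡n t<e = lo , X ^ k + hi ,
    trans (cong₂ _+_ (trans (^-distribˡ-+-* X (suc t) k) refl) eq) (trans (solve′ X (X ^ t) (X ^ k) lo (∑ es (λ e → 𝟙 (e ≟ t))) hi)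
      (cong (λ c → lo + (c + ∑ es (λ e → 𝟙 (e ≟ t)) + X * (X ^ k + hi)) * X ^ t) (sym (𝟙-no (suc t + k ≟ t) e≢t)))) ,
    ≤-trans le (m≤n+m _ (X ^ t))
    where
    solve′ : ∀ x p k l c h → x * p * k + (l + (c + x * h) * p) ≡ l + (c + x * (k + h)) * p
    solve′ = solve-∀

-- Binary digits and divisibility by powers of two.

private
  2^≢0 : ∀ k → NonZero (2 ^ k)
  2^≢0 k = m^n≢0 2 k

bitAt : ℕ → ℕ → ℕ
bitAt y i = _/_ y (2 ^ i) {{2^≢0 i}} % 2

bits-zero⇒∣ : ∀ y k → (∀ j → j < k → bitAt y j ≡ 0) → 2 ^ k ∣ y
bits-zero⇒∣ y zero    b = 1∣ y
bits-zero⇒∣ y (suc k) b with divides z refl ← bits-zero⇒∣ y k (λ j j<k → b j (m<n⇒m<1+n j<k))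
  with divides w e ← m%n≡0⇒n∣m z 2 (trans (cong (_% 2) (sym (m*n/n≡m z (2 ^ k) {{2^≢0 k}}))) (b k ≤-refl)) =
  divides w (trans (cong (_* 2 ^ k) e) (*-assoc w 2 (2 ^ k)))

∣⇒bits-zero : ∀ y k → 2 ^ k ∣ y → ∀ j → j < k → bitAt y j ≡ 0
∣⇒bits-zero _ k (divides w refl) j j<k with i , refl ← m≤n⇒∃[o]m+o≡n j<k = n∣m⇒m%n≡0 _ 2
  (subst (2 ∣_) (sym (trans (cong (λ z → _/_ z (2 ^ j) {{2^≢0 j}}) (trans (cong (w *_) (^-distribˡ-+-* 2 (suc j) i)) (eq w (2 ^ j) (2 ^ i)))) (m*n/n≡m _ (2 ^ j) {{2^≢0 j}})))
    (n∣m*n (w * 2 ^ i)))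
  where
  eq : ∀ w p q → w * (2 * p * q) ≡ w * q * 2 * p
  eq = solve-∀

bitAt-shift : ∀ lo y t j → lo < 2 ^ t → bitAt (lo + y * 2 ^ t) (t + j) ≡ bitAt y j
bitAt-shift lo y t j lo< = cong (_% 2) (trans (m/n/o lo y)
    (cong (λ z → _/_ z (2 ^ j) {{2^≢0 j}}) (trans (+-distrib-/-∣ʳ lo {{2^≢0 t}} (n∣m*n y)) (cong₂ _+_ (m<n⇒m/n≡0 {{2^≢0 t}} lo<) (m*n/n≡m y (2 ^ t) {{2^≢0 t}})))))
  where
  m/n/o : ∀ lo y → _/_ (lo + y * 2 ^ t) (2 ^ (t + j)) {{2^≢0 (t + j)}} ≡ _/_ (_/_ (lo + y * 2 ^ t) (2 ^ t) {{2^≢0 t}}) (2 ^ j) {{2^≢0 j}}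
  m/n/o lo y = trans (/-congʳ {{2^≢0 (t + j)}} {{m*n≢0 (2 ^ t) (2 ^ j) {{2^≢0 t}} {{2^≢0 j}}}} (^-distribˡ-+-* 2 t j))
    (sym (m/n/o≡m/[n*o] (lo + y * 2 ^ t) (2 ^ t) (2 ^ j) {{2^≢0 t}} {{2^≢0 j}} {{m*n≢0 (2 ^ t) (2 ^ j) {{2^≢0 t}} {{2^≢0 j}}}}))

radix : ∀ q {a a′ r r′} → r < q → r′ < q → q * a + r ≡ q * a′ + r′ → a ≡ a′ × r ≡ r′
radix q@(suc _) {a} {a′} {r} {r′} r< r′< e = *-cancelˡ-≡ a a′ q (+-cancelʳ-≡ r (q * a) (q * a′) (trans e (cong (q * a′ +_) (sym r≡)))) , r≡
  where
  r≡ : r ≡ r′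
  r≡ = trans (sym (m<n⇒m%n≡m r<)) (trans (sym ([m+kn]%n≡m%n r a q)) (trans (cong (_% q) (trans (+-comm r _) (trans (cong (_+ r) (*-comm a q)) (trans e (trans (+-comm _ r′) (cong (r′ +_) (*-comm q a′)))))))
    (trans ([m+kn]%n≡m%n r′ a′ q) (m<n⇒m%n≡m r′<))))

length≡∑ : ∀ (xs : List A) → length xs ≡ ∑ xs (λ _ → 1)
length≡∑ xs = sym (trans (∑-const xs 1) (*-identityʳ _))

orients-length : ∀ (C : List (A × A)) → length (orients C) ≡ 2 ^ length C
orients-length []            = refl
orients-length ((u , v) ∷ C) = trans (length-++ (map _ (orients C))) (cong₂ _+_ (trans (length-map _ (orients C)) (orients-length C))
  (trans (length-map _ (orients C)) (trans (orients-length C) (sym (+-identityʳ _)))))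

∏-const : ∀ (xs : List A) c → ∏ xs (λ _ → c) ≡ c ^ length xs
∏-const []       c = refl
∏-const (x ∷ xs) c = cong (c *_) (∏-const xs c)

-- The generating function as a sum of powers of one number.

module Expansion {n : ℕ} (adj : Fin n → Fin n → Bool) (b Q q : ℕ) (ω : Fin n → Fin n → ℕ)
                 {π : List (Fin n)} (unique : Unique π) (complete : ∀ v → v ∈ π) where

  open Weights adj (b * Q) (b * (Q + q)) (λ u v → b * ω u v) slots
  open Degrees {n}

  -- Every ordered pair has a random weight of its own; adding both directions makes the weight of
  -- an edge independent of the way it is listed.
  weight : List Arc → ℕ
  weight C = ∑ C (λ (u , v) → ω u v + ω v u)

  -- A number with three digits: arcs plus open slots and loops, then loops, then weight. With at
  -- most n loops and weight below `q`, the two lower digits stay below `q * suc n`, which is the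
  -- value given to `Q`.
  exponent : List Arc → ℕ × ℕ → ℕ
  exponent C (d , l) = Q * (length C + d) + (q * l + weight C)

  exponents : List Arc → List ℕ
  exponents E = concatMap (λ C → concatMap (λ D → map (exponent C) (loops D π)) (orients C)) (subs E)

  ∑-exponents : ∀ E f → ∑ (exponents E) f ≡ ∑ (subs E) (λ C → ∑ (orients C) (λ D → ∑ (loops D π) (f ∘ exponent C)))
  ∑-exponents E f = trans (∑-concatMap _ (subs E) f) (∑-cong (subs E) λ C _ →
    trans (∑-concatMap _ (orients C) f) (∑-cong (orients C) λ D _ → ∑-map (exponent C) (loops D π) f))

  private
    arcOK : (Fin n → Slots) → Arc → ℕ
    arcOK τ (a , c) = bit (proj₂ (τ a) ∧ proj₁ (τ c))

    need : ℕ → Bool → ℕ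
    need zero    x = 1
    need (suc _) x = bit x

    ok : List Arc → Fin n → Slots → ℕ
    ok D v (x , y) = need (inn D v) x * need (out D v) y

    bit-idem : ∀ x → bit x ≡ bit x * bit x
    bit-idem true  = refl
    bit-idem false = refl

    bit-∧ : ∀ x y → bit (x ∧ y) ≡ bit x * bit y
    bit-∧ true  true  = refl
    bit-∧ true  false = refl
    bit-∧ false y     = refl

    need-+ : ∀ {a v : Fin n} k x → need (𝟙 (a ≟ᶠ v) + k) x ≡ (if does (a ≟ᶠ v) then bit x else 1) * need k x
    need-+ {a} {v} k       x with a ≟ᶠ v
    need-+         k       x | no _  = sym (+-identityʳ _)
    need-+         zero    x | yes _ = sym (*-identityʳ _)
    need-+         (suc k) x | yes _ = bit-idem x

    at : ∀ {π : List (Fin n)} → Unique π → ∀ {a} → a ∈ π → ∀ (g : Fin n → ℕ) → ∏ π (λ v → if does (a ≟ᶠ v) then g v else 1) ≡ g a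
    at {v ∷ π} (v∉ ∷ u) {a} a∈ g with a ≟ᶠ v
    ... | yes refl = trans (cong (g a *_) (∏-one π λ w w∈ → off w w∈)) (*-identityʳ _)
      where
      off : ∀ w → w ∈ π → (if does (a ≟ᶠ w) then g w else 1) ≡ 1
      off w w∈ with a ≟ᶠ w
      ... | yes refl = contradiction refl (All.lookup v∉ w∈)
      ... | no _ = refl
    at {v ∷ π} (v∉ ∷ u) (here refl) g | no ne = contradiction refl ne
    at {v ∷ π} (v∉ ∷ u) (there a∈) g | no ne = trans (+-identityʳ _) (at u a∈ g)

    -- Whether all arcs use allowed slots can be regrouped by vertices because `bit` is idempotent:
    -- it matters only whether a slot is used, not how often. The sum over all assignments then
    -- factors over the vertices.
    ∏-arcOK : ∀ τ D → ∏ D (arcOK τ) ≡ ∏ π (λ v → ok D v (τ v))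
    ∏-arcOK τ []            = sym (∏-one π λ _ _ → refl)
    ∏-arcOK τ ((a , c) ∷ D) = begin
        bit (proj₂ (τ a) ∧ proj₁ (τ c)) * ∏ D (arcOK τ)
      ≡⟨ cong₂ _*_ (bit-∧ (proj₂ (τ a)) _) (∏-arcOK τ D) ⟩
        bit (proj₂ (τ a)) * bit (proj₁ (τ c)) * ∏ π (λ v → ok D v (τ v))
      ≡⟨ cong₂ (λ y x → y * x * ∏ π (λ v → ok D v (τ v))) (at unique (complete a) (λ v → bit (proj₂ (τ v)))) (at unique (complete c) (λ v → bit (proj₁ (τ v)))) ⟨
        ∏ π Y * ∏ π X * ∏ π (λ v → ok D v (τ v))
      ≡⟨ trans (cong (_* ∏ π (λ v → ok D v (τ v))) (∏-* π Y X)) (∏-* π _ _) ⟩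
        ∏ π (λ v → Y v * X v * ok D v (τ v))
      ≡⟨ ∏-cong π (λ v _ → sym (trans (cong₂ _*_ (need-+ {c} {v} (inn D v) (proj₁ (τ v))) (need-+ {a} {v} (out D v) (proj₂ (τ v))))
           (eq (X v) (need (inn D v) (proj₁ (τ v))) (Y v) (need (out D v) (proj₂ (τ v)))))) ⟩
        ∏ π (λ v → ok ((a , c) ∷ D) v (τ v)) ∎
      where
      open ≡-Reasoning
      X Y : Fin n → ℕ
      X v = if does (c ≟ᶠ v) then bit (proj₁ (τ v)) else 1
      Y v = if does (a ≟ᶠ v) then bit (proj₂ (τ v)) else 1
      eq : ∀ x i y o → (x * i) * (y * o) ≡ y * x * (i * o)
      eq = solve-∀

    module _ (N L : ℕ) where
      h : Slots → ℕ
      h (x , y) = (if x then 1 else N) * (if y then 1 else N) * (if x ∧ y then 1 + L else 1)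

      -- Inclusion-exclusion at one vertex. A slot in use must be allowed and contributes 1; an idle
      -- slot may be allowed or not and contributes `1 + N`, a power of two for `N = minusOne`. The
      -- loop occurs only in the state with both slots allowed, where no demand fails, so `L`
      -- appears once whatever the degrees are.
      vertex-sum : ∀ i o → ∑ slots (λ s → h s * (need i (proj₁ s) * need o (proj₂ s))) ≡ suc N ^ (z i + z o) + L
      vertex-sum zero    zero    = eq N L
        where
        eq : ∀ N L → N * N * 1 * (1 * 1) + (1 * N * 1 * (1 * 1) + (N * 1 * 1 * (1 * 1) + (1 * 1 * (1 + L) * (1 * 1) + 0))) ≡ (1 + N) * ((1 + N) * 1) + L
        eq = solve-∀
      vertex-sum zero    (suc o) = eq N L
        where
        eq : ∀ N L → N * N * 1 * (1 * 0) + (1 * N * 1 * (1 * 0) + (N * 1 * 1 * (1 * 1) + (1 * 1 * (1 + L) * (1 * 1) + 0))) ≡ (1 + N) * 1 + L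
        eq = solve-∀
      vertex-sum (suc i) zero    = eq N L
        where
        eq : ∀ N L → N * N * 1 * (0 * 1) + (1 * N * 1 * (1 * 1) + (N * 1 * 1 * (0 * 1) + (1 * 1 * (1 + L) * (1 * 1) + 0))) ≡ (1 + N) * 1 + L
        eq = solve-∀
      vertex-sum (suc i) (suc o) = eq N L
        where
        eq : ∀ N L → N * N * 1 * (0 * 0) + (1 * N * 1 * (1 * 0) + (N * 1 * 1 * (0 * 1) + (1 * 1 * (1 + L) * (1 * 1) + 0))) ≡ 1 + L
        eq = solve-∀

    per-vertex : ∀ D v → ∑ slots (λ s → vertexFactor s * ok D v s) ≡ 2 ^ (b * (Q * missing D v)) + 2 ^ (b * (Q + q))
    per-vertex D v = trans (vertex-sum minusOne (2 ^ (b * (Q + q))) (inn D v) (out D v))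
      (cong (_+ 2 ^ (b * (Q + q))) (trans (cong (_^ missing D v) (m+[n∸m]≡n (m^n>0 2 (b * Q))))
        (trans (^-*-assoc 2 (b * Q) (missing D v)) (cong (2 ^_) (*-assoc b Q (missing D v))))))

    ∏-loops : ∀ D π → ∏ π (λ v → 2 ^ (b * (Q * missing D v)) + 2 ^ (b * (Q + q))) ≡ ∑ (loops D π) (λ (d , l) → 2 ^ (b * (Q * d + q * l)))
    ∏-loops D []      = sym (trans (+-identityʳ _) (cong (2 ^_) (eq b Q q)))
      where
      eq : ∀ b Q q → b * (Q * 0 + q * 0) ≡ 0
      eq = solve-∀
    ∏-loops D (v ∷ π) = trans (cong ((2 ^ (b * (Q * missing D v)) + 2 ^ (b * (Q + q))) *_) (∏-loops D π))
      (trans (*-distribʳ-+ (∑ (loops D π) (λ (d , l) → 2 ^ (b * (Q * d + q * l)))) (2 ^ (b * (Q * missing D v))) _)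
      (sym (trans (∑-++ (map _ (loops D π)) _ _) (cong₂ _+_
        (trans (∑-map _ (loops D π) _) (trans (∑-cong (loops D π) λ (d , l) _ →
          trans (cong (2 ^_) (eq₁ b Q q (missing D v) d l)) (^-distribˡ-+-* 2 (b * (Q * missing D v)) (b * (Q * d + q * l)))) (sym (∑-*ˡ (2 ^ (b * (Q * missing D v))) (loops D π) _))))
        (trans (∑-map _ (loops D π) _) (trans (∑-cong (loops D π) λ (d , l) _ →
          trans (cong (2 ^_) (eq₂ b Q q d l)) (^-distribˡ-+-* 2 (b * (Q + q)) (b * (Q * d + q * l)))) (sym (∑-*ˡ (2 ^ (b * (Q + q))) (loops D π) _))))))))
      where
      eq₁ : ∀ b Q q m d l → b * (Q * (m + d) + q * l) ≡ b * (Q * m) + b * (Q * d + q * l)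
      eq₁ = solve-∀
      eq₂ : ∀ b Q q d l → b * (Q * (1 + d) + q * (1 + l)) ≡ b * (Q + q) + b * (Q * d + q * l)
      eq₂ = solve-∀

    shiftᴬ : Arc → ℕ
    shiftᴬ (u , v) = shift u v

    ∑-shift : ∀ C → ∑ C shiftᴬ ≡ b * (Q * length C + weight C)
    ∑-shift []            = sym (eq b Q)
      where
      eq : ∀ b Q → b * (Q * 0 + 0) ≡ 0
      eq = solve-∀
    ∑-shift ((u , v) ∷ C) = trans (cong (shift u v +_) (∑-shift C)) (eq b Q (ω u v) (ω v u) (length C) (weight C))
      where
      eq : ∀ b Q x y l w → b * Q + b * x + b * y + b * (Q * l + w) ≡ b * (Q * (1 + l) + (x + y + w))
      eq = solve-∀

  -- Each edge factor is expanded into absence and two directions, and these choices are moved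
  -- outside of the sum over slots, which then becomes a product of `vertex-sum`s.
  expansion : ∀ E {σ} → Σ* π σ (λ τ → ∏ π (λ v → vertexFactor (τ v)) * edgeProduct E τ) ≡ ∑ (exponents E) ((2 ^ b) ^_)
  expansion E {σ} = begin
      Σ* π σ (λ τ → H τ * edgeProduct E τ)
    ≡⟨ Σ*-cong π (λ τ _ → pointwise τ) ⟩
      Σ* π σ (λ τ → ∑ (subs E) (λ C → ∑ (orients C) (λ D → 2 ^ ∑ C shiftᴬ * (H τ * ∏ D (arcOK τ)))))
    ≡⟨ trans (Σ*-∑ π (subs E) _) (∑-cong (subs E) λ C _ → Σ*-∑ π (orients C) _) ⟩
      ∑ (subs E) (λ C → ∑ (orients C) (λ D → Σ* π σ (λ τ → 2 ^ ∑ C shiftᴬ * (H τ * ∏ D (arcOK τ)))))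
    ≡⟨ ∑-cong (subs E) (λ C _ → ∑-cong (orients C) λ D _ → term C D) ⟩
      ∑ (subs E) (λ C → ∑ (orients C) (λ D → ∑ (loops D π) (λ x → (2 ^ b) ^ exponent C x)))
    ≡⟨ ∑-exponents E _ ⟨
      ∑ (exponents E) ((2 ^ b) ^_) ∎
    where
    open ≡-Reasoning
    H : (Fin n → Slots) → ℕ
    H τ = ∏ π (λ v → vertexFactor (τ v))
    pointwise : ∀ τ → H τ * edgeProduct E τ ≡ ∑ (subs E) (λ C → ∑ (orients C) (λ D → 2 ^ ∑ C shiftᴬ * (H τ * ∏ D (arcOK τ))))
    pointwise τ = trans (cong (H τ *_) (∏-subs E _)) (trans (∑-*ˡ (H τ) (subs E) _) (∑-cong (subs E) λ C _ →
      trans (cong (H τ *_) (trans (∏-orients C (arcOK τ) (λ e → 2 ^ shiftᴬ e)) (cong (_* ∑ (orients C) (λ D → ∏ D (arcOK τ))) (∏-^ C 2 shiftᴬ))))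
      (trans (sym (*-assoc (H τ) (2 ^ ∑ C shiftᴬ) _)) (trans (∑-*ˡ (H τ * 2 ^ ∑ C shiftᴬ) (orients C) _)
        (∑-cong (orients C) λ D _ → eq (H τ) (2 ^ ∑ C shiftᴬ) _)))))
      where
      eq : ∀ h t a → h * t * a ≡ t * (h * a)
      eq = solve-∀
    term : ∀ C D → Σ* π σ (λ τ → 2 ^ ∑ C shiftᴬ * (H τ * ∏ D (arcOK τ))) ≡ ∑ (loops D π) (λ x → (2 ^ b) ^ exponent C x)
    term C D = begin
        Σ* π σ (λ τ → 2 ^ ∑ C shiftᴬ * (H τ * ∏ D (arcOK τ)))
      ≡⟨ Σ*-*ˡ π (2 ^ ∑ C shiftᴬ) _ ⟩
        2 ^ ∑ C shiftᴬ * Σ* π σ (λ τ → H τ * ∏ D (arcOK τ))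
      ≡⟨ cong (2 ^ ∑ C shiftᴬ *_) (trans (Σ*-cong π λ τ _ → trans (cong (H τ *_) (∏-arcOK τ D)) (∏-* π _ _))
           (trans (Σ*-∏ unique (λ v s → vertexFactor s * ok D v s)) (trans (∏-cong π λ v _ → per-vertex D v) (∏-loops D π)))) ⟩
        2 ^ ∑ C shiftᴬ * ∑ (loops D π) (λ (d , l) → 2 ^ (b * (Q * d + q * l)))
      ≡⟨ ∑-*ˡ (2 ^ ∑ C shiftᴬ) (loops D π) _ ⟩
        ∑ (loops D π) (λ (d , l) → 2 ^ ∑ C shiftᴬ * 2 ^ (b * (Q * d + q * l)))
      ≡⟨ ∑-cong (loops D π) (λ (d , l) _ → trans (sym (^-distribˡ-+-* 2 (∑ C shiftᴬ) (b * (Q * d + q * l))))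
           (trans (cong (2 ^_) (trans (cong (_+ b * (Q * d + q * l)) (∑-shift C)) (eq b Q q (length C) d l (weight C)))) (sym (^-*-assoc 2 b (exponent C (d , l)))))) ⟩
        ∑ (loops D π) (λ x → (2 ^ b) ^ exponent C x) ∎
      where
      eq : ∀ b Q q c d l w → b * (Q * c + w) + b * (Q * d + q * l) ≡ b * (Q * (c + d) + (q * l + w))
      eq = solve-∀

  -- An edge is absent or has one of two directions, and a vertex has a loop or not. This number
  -- bounds all coefficients and so dictates the digit length `b`.
  length-exponents : ∀ E → length (exponents E) ≡ 3 ^ length E * 2 ^ length π
  length-exponents E = begin
      length (exponents E)
    ≡⟨ trans (length≡∑ (exponents E)) (∑-exponents E _) ⟩
      ∑ (subs E) (λ C → ∑ (orients C) (λ D → ∑ (loops D π) (λ _ → 1)))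
    ≡⟨ ∑-cong (subs E) (λ C _ → trans (∑-cong (orients C) λ D _ → trans (sym (length≡∑ (loops D π))) (loops-length D π))
         (trans (∑-const (orients C) _) (cong (_* 2 ^ length π) (trans (orients-length C) (sym (∏-const C 2)))))) ⟩
      ∑ (subs E) (λ C → ∏ C (λ _ → 2) * 2 ^ length π)
    ≡⟨ trans (sym (∑-*ʳ _ (subs E) _)) (cong (_* 2 ^ length π) (trans (sym (∏-subs E (λ _ → 2))) (∏-const E 3))) ⟩
      3 ^ length E * 2 ^ length π ∎
    where open ≡-Reasoning

  orientations : List Arc → ℕ → ℕ
  orientations C t = ∑ (orients C) (λ D → 𝟙 (balanced? D π t))

  target : ℕ → ℕ → ℕ
  target t w = Q * length π + (q * t + w)

  module _ (Q≡ : Q ≡ q * suc (length π)) where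

    -- Comparing digits, the leading one equals the number of vertices exactly if the choice of
    -- loops is tight, by `handshake`; `loops-count` then turns tight choices into balanced
    -- orientations.
    count-exponents : ∀ E → (∀ C → C ∈ subs E → weight C < q) → ∀ {t w} → t ≤ length π → w < q →
      ∑ (exponents E) (λ e → 𝟙 (e ≟ target t w)) ≡ ∑ (subs E) (λ C → 𝟙 (weight C ≟ w) * orientations C t)
    count-exponents E light {t} {w} t≤ w<q = trans (∑-exponents E _) (∑-cong (subs E) λ C C∈ →
      trans (∑-cong (orients C) λ D D∈ → trans (∑-cong (loops D π) λ x x∈ → trans
          (𝟙-cong (exponent C x ≟ target t w) ((weight C ≟ w) ×-dec tight? D π t x) (to C D D∈ x x∈ (light C C∈)) (from C D D∈ x x∈))
          (𝟙-× (weight C ≟ w) (tight? D π t x)))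
        (trans (sym (∑-*ˡ (𝟙 (weight C ≟ w)) (loops D π) _)) (cong (𝟙 (weight C ≟ w) *_) (loops-count D π t))))
      (sym (∑-*ˡ (𝟙 (weight C ≟ w)) (orients C) _)))
      where
      below : ∀ {l r} → l ≤ length π → r < q → q * l + r < Q
      below {l} {r} l≤ r< = subst (q * l + r <_) (sym (trans Q≡ (trans (*-suc q (length π)) (+-comm q _)))) (+-mono-≤-< (*-monoʳ-≤ q l≤) r<)
      double : ∀ C D d → D ∈ orients C → 2 * d + ∑ π (inc D) ≡ 2 * (length C + d)
      double C D d D∈ = trans (cong (2 * d +_) (trans (handshake unique complete D) (cong (2 *_) (length-orients C D∈))))
        (trans (+-comm (2 * d) _) (sym (*-distribˡ-+ 2 (length C) d)))
      to : ∀ C D → D ∈ orients C → ∀ x → x ∈ loops D π → weight C < q → exponent C x ≡ target t w → weight C ≡ w × Tight D π t x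
      to C D D∈ (d , l) x∈ wC e with e₁ , e₂ ← radix Q {length C + d} {length π} (below (loops-≤ D π x∈) wC) (below t≤ w<q) e
        with e₃ , e₄ ← radix q {l} {t} wC w<q e₂ = e₄ , trans (double C D d D∈) (cong (2 *_) e₁) , e₃
      from : ∀ C D → D ∈ orients C → ∀ x → x ∈ loops D π → weight C ≡ w × Tight D π t x → exponent C x ≡ target t w
      from C D D∈ (d , l) x∈ (refl , e , refl) = cong (λ k → Q * k + (q * l + weight C)) (*-cancelˡ-≡ _ _ 2 (trans (sym (double C D d D∈)) e))

-- Independence of orientation sums from the listing of the edges.

∑-↭ : ∀ {xs ys : List A} f → xs ↭ ys → ∑ xs f ≡ ∑ ys f
∑-↭ f ↭.refl          = refl
∑-↭ f (↭.prep x p)    = cong (f x +_) (∑-↭ f p)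
∑-↭ f (↭.swap x y p)  = trans (cong (λ z → f x + (f y + z)) (∑-↭ f p)) (eq (f x) (f y) _)
  where
  eq : ∀ a b c → a + (b + c) ≡ b + (a + c)
  eq = solve-∀
∑-↭ f (↭.trans p q)   = trans (∑-↭ f p) (∑-↭ f q)

∑-orients-∷ : ∀ (u v : A) C F → ∑ (orients ((u , v) ∷ C)) F ≡ ∑ (orients C) (F ∘ ((u , v) ∷_)) + ∑ (orients C) (F ∘ ((v , u) ∷_))
∑-orients-∷ u v C F = trans (∑-++ (map ((u , v) ∷_) (orients C)) _ F) (cong₂ _+_ (∑-map ((u , v) ∷_) (orients C) F) (∑-map ((v , u) ∷_) (orients C) F))

-- Balanced orientations are counted for edges listed in cyclic order, but the sum presents the
-- edges in the order of the edge list of the graph.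
∑-orients-↭ : ∀ {C C′ : List (A × A)} → C ↭ C′ → ∀ F → (∀ {D D′} → D ↭ D′ → F D ≡ F D′) → ∑ (orients C) F ≡ ∑ (orients C′) F
∑-orients-↭ ↭.refl F inv = refl
∑-orients-↭ (↭.prep {C} {C′} (u , v) p) F inv = trans (∑-orients-∷ u v C F) (trans
  (cong₂ _+_ (∑-orients-↭ p _ (inv ∘ ↭.prep _)) (∑-orients-↭ p _ (inv ∘ ↭.prep _))) (sym (∑-orients-∷ u v C′ F)))
∑-orients-↭ (↭.swap {C} {C′} (u , v) (x , y) p) F inv = begin
    ∑ (orients ((u , v) ∷ (x , y) ∷ C)) F
  ≡⟨ four (u , v) (x , y) C ⟩
    (a₁ C + a₂ C) + (a₃ C + a₄ C)
  ≡⟨ cong₂ _+_ (cong₂ _+_ (half _ _) (half _ _)) (cong₂ _+_ (half _ _) (half _ _)) ⟩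
    (S (x , y) (u , v) + S (y , x) (u , v)) + (S (x , y) (v , u) + S (y , x) (v , u))
  ≡⟨ eq (S (x , y) (u , v)) (S (y , x) (u , v)) (S (x , y) (v , u)) (S (y , x) (v , u)) ⟩
    (S (x , y) (u , v) + S (x , y) (v , u)) + (S (y , x) (u , v) + S (y , x) (v , u))
  ≡⟨ four (x , y) (u , v) C′ ⟨
    ∑ (orients ((x , y) ∷ (u , v) ∷ C′)) F ∎
  where
  open ≡-Reasoning
  S : _ → _ → ℕ
  S e f = ∑ (orients C′) (λ D → F (e ∷ f ∷ D))
  a₁ a₂ a₃ a₄ : List (_ × _) → ℕ
  a₁ C = ∑ (orients C) (λ D → F ((u , v) ∷ (x , y) ∷ D))
  a₂ C = ∑ (orients C) (λ D → F ((u , v) ∷ (y , x) ∷ D))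
  a₃ C = ∑ (orients C) (λ D → F ((v , u) ∷ (x , y) ∷ D))
  a₄ C = ∑ (orients C) (λ D → F ((v , u) ∷ (y , x) ∷ D))
  half : ∀ e f → ∑ (orients C) (λ D → F (e ∷ f ∷ D)) ≡ S f e
  half e f = trans (∑-cong (orients C) λ D _ → inv (↭.swap e f ↭.refl)) (∑-orients-↭ p _ (inv ∘ ↭.prep _ ∘ ↭.prep _))
  four : ∀ e f C → ∑ (orients (e ∷ f ∷ C)) F ≡
         (∑ (orients C) (λ D → F (e ∷ f ∷ D)) + ∑ (orients C) (λ D → F (e ∷ Prod.swap f ∷ D))) +
         (∑ (orients C) (λ D → F (Prod.swap e ∷ f ∷ D)) + ∑ (orients C) (λ D → F (Prod.swap e ∷ Prod.swap f ∷ D)))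
  four (a , b) (c , d) C = trans (∑-orients-∷ a b ((c , d) ∷ C) F) (cong₂ _+_ (∑-orients-∷ c d C _) (∑-orients-∷ c d C _))
  eq : ∀ a b c d → (a + b) + (c + d) ≡ (a + c) + (b + d)
  eq = solve-∀
∑-orients-↭ (↭.trans p q) F inv = trans (∑-orients-↭ p F inv) (∑-orients-↭ q F inv)

∑-orients-map : ∀ (g : A × A → A × A) → (∀ e → g e ≡ e ⊎ g e ≡ Prod.swap e) → ∀ C F → ∑ (orients (map g C)) F ≡ ∑ (orients C) F
∑-orients-map g flips []            F = refl
∑-orients-map g flips ((u , v) ∷ C) F with g (u , v) | flips (u , v)
... | _ | inj₁ refl = trans (∑-orients-∷ u v (map g C) F) (trans (cong₂ _+_ (∑-orients-map g flips C _) (∑-orients-map g flips C _)) (sym (∑-orients-∷ u v C F)))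
... | _ | inj₂ refl = trans (∑-orients-∷ v u (map g C) F) (trans (cong₂ _+_ (∑-orients-map g flips C _) (∑-orients-map g flips C _))
                          (trans (+-comm (∑ (orients C) _) _) (sym (∑-orients-∷ u v C F))))

∑-orients-orients : ∀ {C D : List (A × A)} → D ∈ orients C → ∀ F → ∑ (orients D) F ≡ ∑ (orients C) F
∑-orients-orients {C = []} (here refl) F = refl
∑-orients-orients {C = (u , v) ∷ C} D∈ F with ∈-++⁻ (map ((u , v) ∷_) (orients C)) D∈
... | inj₁ p with D , q , refl ← ∈-map⁻ _ p = trans (∑-orients-∷ u v D F) (trans (cong₂ _+_ (∑-orients-orients {C = C} q _) (∑-orients-orients {C = C} q _)) (sym (∑-orients-∷ u v C F)))
... | inj₂ p with D , q , refl ← ∈-map⁻ _ p = trans (∑-orients-∷ v u D F) (trans (cong₂ _+_ (∑-orients-orients {C = C} q _) (∑-orients-orients {C = C} q _))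
                          (trans (+-comm (∑ (orients C) _) _) (sym (∑-orients-∷ u v C F))))

-- The arcs of a path from `x` through `ys` to `z`. In contrast to `cyclicPairs`, it can be followed
-- arc by arc, which opens up a closed walk.
link : A → List A → A → List (A × A)
link x []       z = [ (x , z) ]
link x (y ∷ ys) z = (x , y) ∷ link y ys z

cyclicPairs≡ : ∀ (x : A) ys → cyclicPairs (x ∷ ys) ≡ link x ys x
cyclicPairs≡ x ys = go x ys x
  where
  go : ∀ {A : Set} (a : A) ys x → zip (a ∷ ys) (ys ++ [ x ]) ≡ link a ys x
  go a []       x = refl
  go a (y ∷ ys) x = cong ((a , y) ∷_) (go y ys x)

unique-++⁻ : ∀ (xs : List A) {ys} → Unique (xs ++ ys) → Unique xs × Unique ys × (∀ {v} → v ∈ xs → v ∉ ys)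
unique-++⁻ []       u        = [] , u , λ ()
unique-++⁻ (x ∷ xs) (x∉ ∷ u) with p , q , d ← unique-++⁻ xs u =
  All.tabulate (λ v∈ → All.lookup x∉ (∈-++⁺ˡ v∈)) ∷ p , q , λ { (here refl) v∈ → All.lookup x∉ (∈-++⁺ʳ xs v∈) refl ; (there v∈) → d v∈ }

-- Counting the balanced orientations of disjoint cycles.

module Orientations {n : ℕ} {π : List (Fin n)} (complete : ∀ v → v ∈ π) where
  open Degrees {n}

  Count : Set
  Count = Fin n → ℕ

  bump : Fin n → Count → Count
  bump v i w = 𝟙 (v ≟ᶠ w) + i w

  Goodᶜ : Count → Count → Fin n → Set
  Goodᶜ i o v = (i v ≡ 1 × o v ≡ 1) ⊎ i v + o v ≡ 0

  goodᶜ? : ∀ i o v → Dec (Goodᶜ i o v)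
  goodᶜ? i o v = ((i v ≟ 1) ×-dec (o v ≟ 1)) ⊎-dec (i v + o v ≟ 0)

  valid? : ∀ i o → Dec (All (Goodᶜ i o) π)
  valid? i o = all? (goodᶜ? i o) π

  -- The number of orientations of P that, on top of the in- and out-degrees
  -- i and o, make every vertex balanced.
  cnt : List Arc → Count → Count → ℕ
  cnt []            i o = 𝟙 (valid? i o)
  cnt ((u , v) ∷ P) i o = cnt P (bump v i) (bump u o) + cnt P (bump u i) (bump v o)

  good-cong : ∀ {i i′ o o′} → (∀ v → i v ≡ i′ v) → (∀ v → o v ≡ o′ v) → ∀ {v} → Goodᶜ i o v → Goodᶜ i′ o′ v
  good-cong ei eo {v} (inj₁ (a , b)) = inj₁ (trans (sym (ei v)) a , trans (sym (eo v)) b)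
  good-cong ei eo {v} (inj₂ e)       = inj₂ (trans (sym (cong₂ _+_ (ei v) (eo v))) e)

  cnt-cong : ∀ P {i i′ o o′} → (∀ v → i v ≡ i′ v) → (∀ v → o v ≡ o′ v) → cnt P i o ≡ cnt P i′ o′
  cnt-cong []            {i} {i′} {o} {o′} ei eo = 𝟙-cong (valid? i o) (valid? i′ o′) (All.map (good-cong ei eo)) (All.map (good-cong (sym ∘ ei) (sym ∘ eo)))
  cnt-cong ((u , v) ∷ P) ei eo = cong₂ _+_ (cnt-cong P (λ w → cong (𝟙 (v ≟ᶠ w) +_) (ei w)) (λ w → cong (𝟙 (u ≟ᶠ w) +_) (eo w)))
                                           (cnt-cong P (λ w → cong (𝟙 (u ≟ᶠ w) +_) (ei w)) (λ w → cong (𝟙 (v ≟ᶠ w) +_) (eo w)))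

  cnt-swap : ∀ P i o → cnt P i o ≡ cnt P o i
  cnt-swap [] i o = 𝟙-cong (valid? i o) (valid? o i) (All.map (λ {v} → mirror i o v)) (All.map (λ {v} → mirror o i v))
    where
    mirror : ∀ i o v → Goodᶜ i o v → Goodᶜ o i v
    mirror i o v (inj₁ (a , b)) = inj₁ (b , a)
    mirror i o v (inj₂ e) = inj₂ (trans (+-comm (o v) (i v)) e)
  cnt-swap ((u , v) ∷ P) i o = trans (cong₂ _+_ (cnt-swap P _ _) (cnt-swap P _ _)) (+-comm (cnt P (bump u o) (bump v i)) _)

  dead : ∀ P {i o v} → 2 ≤ i v → cnt P i o ≡ 0
  dead [] {i} {o} {v} le = 𝟙-no (valid? i o) λ ok → absurd le (All.lookup ok (complete v))
    where
    absurd : ∀ {a b} → 2 ≤ a → (a ≡ 1 × b ≡ 1) ⊎ a + b ≡ 0 → ⊥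
    absurd (s≤s ()) (inj₁ (refl , _))
    absurd (s≤s (s≤s _)) (inj₂ ())
  dead ((a , b) ∷ P) {i} {o} {v} le = cong₂ _+_ (dead P {v = v} (≤-trans le (m≤n+m (i v) _))) (dead P {v = v} (≤-trans le (m≤n+m (i v) _)))

  occ : List (Fin n) → Count
  occ c v = ∑ c (λ u → 𝟙 (u ≟ᶠ v))

  private
    self : ∀ (v : Fin n) → 𝟙 (v ≟ᶠ v) ≡ 1
    self v = 𝟙-yes (v ≟ᶠ v) refl

    other : ∀ (v w : Fin n) → v ≢ w → 𝟙 (v ≟ᶠ w) ≡ 0
    other v w = 𝟙-no (v ≟ᶠ w)

  -- A path entered at x can only be left forwards.
  cnt-link : ∀ x ys {z} P {i o} → i x ≡ 1 → o x ≡ 0 → i z ≡ 0 → o z ≡ 1 → Unique (x ∷ ys) → z ∉ x ∷ ys →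
             (∀ y → y ∈ ys → i y ≡ 0 × o y ≡ 0) →
             cnt (link x ys z ++ P) i o ≡ cnt P (λ v → occ ys v + (𝟙 (z ≟ᶠ v) + i v)) (λ v → occ (x ∷ ys) v + o v)
  cnt-link x [] {z} P {i} {o} ix ox iz oz u z∉ fresh = trans (cong (cnt P (bump z i) (bump x o) +_)
      (dead P {v = x} (≤-reflexive (sym (cong₂ _+_ (self x) ix))))) (trans (+-identityʳ _)
      (cnt-cong P (λ _ → refl) (λ v → cong (_+ o v) (sym (+-identityʳ _)))))
  cnt-link x (y ∷ ys) {z} P {i} {o} ix ox iz oz ((x≢y ∷ x∉) ∷ u) z∉ fresh = trans (cong (cnt (link y ys z ++ P) (bump y i) (bump x o) +_)
      (dead (link y ys z ++ P) {v = x} (≤-reflexive (sym (cong₂ _+_ (self x) ix))))) (trans (+-identityʳ _)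
      (trans (cnt-link y ys P
         (trans (cong₂ _+_ (self y) (proj₁ (fresh y (here refl)))) refl)
         (trans (cong₂ _+_ (other x y x≢y) (proj₂ (fresh y (here refl)))) refl)
         (trans (cong₂ _+_ (other y z λ { refl → z∉ (there (here refl)) }) iz) refl)
         (trans (cong₂ _+_ (other x z λ { refl → z∉ (here refl) }) oz) refl)
         u (z∉ ∘ there)
         (λ w w∈ → trans (cong₂ _+_ (other y w (All.lookup (head u) w∈)) (proj₁ (fresh w (there w∈)))) refl ,
                   trans (cong₂ _+_ (other x w (All.lookup x∉ w∈)) (proj₂ (fresh w (there w∈)))) refl))
        (cnt-cong P (λ v → eq₁ (occ ys v) (𝟙 (z ≟ᶠ v)) (𝟙 (y ≟ᶠ v)) (i v)) (λ v → eq₂ (𝟙 (y ≟ᶠ v) + occ ys v) (𝟙 (x ≟ᶠ v)) (o v)))))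
    where
    head : ∀ {y : Fin n} {ys} → Unique (y ∷ ys) → All (y ≢_) ys
    head (a ∷ _) = a
    eq₁ : ∀ m z y i → m + (z + (y + i)) ≡ y + m + (z + i)
    eq₁ = solve-∀
    eq₂ : ∀ m x o → m + (x + o) ≡ x + m + o
    eq₂ = solve-∀

  -- Once the first edge has a direction, `cnt-link` forces all the others. The two directions of
  -- the first edge are mirror images, exchanged by `cnt-swap`; hence the factor 2.
  cnt-cycle : ∀ a x ys P {i o} → Unique (a ∷ x ∷ ys) → (∀ y → y ∈ a ∷ x ∷ ys → i y ≡ 0 × o y ≡ 0) →
              cnt (cyclicPairs (a ∷ x ∷ ys) ++ P) i o ≡ 2 * cnt P (λ v → occ (a ∷ x ∷ ys) v + i v) (λ v → occ (a ∷ x ∷ ys) v + o v)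
  cnt-cycle a x ys P {i} {o} ((a≢x ∷ a∉) ∷ u) fresh = trans (cong (λ z → cnt (z ++ P) i o) (cyclicPairs≡ a (x ∷ ys))) (trans
      (cong₂ _+_ (fwd i o (λ y y∈ → fresh y y∈)) (trans (cnt-swap (link x ys a ++ P) _ _) (trans (fwd o i (λ y y∈ → Prod.swap (fresh y y∈))) (cnt-swap P _ _))))
      (cong (cnt P (λ v → occ (a ∷ x ∷ ys) v + i v) (λ v → occ (a ∷ x ∷ ys) v + o v) +_) (sym (+-identityʳ _))))
    where
    fwd : ∀ i o → (∀ y → y ∈ a ∷ x ∷ ys → i y ≡ 0 × o y ≡ 0) → cnt (link x ys a ++ P) (bump x i) (bump a o) ≡
          cnt P (λ v → occ (a ∷ x ∷ ys) v + i v) (λ v → occ (a ∷ x ∷ ys) v + o v)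
    fwd i o fr = trans (cnt-link x ys P
        (trans (cong₂ _+_ (self x) (proj₁ (fr x (there (here refl))))) refl)
        (trans (cong₂ _+_ (other a x a≢x) (proj₂ (fr x (there (here refl))))) refl)
        (trans (cong₂ _+_ (other x a (a≢x ∘ sym)) (proj₁ (fr a (here refl)))) refl)
        (trans (cong₂ _+_ (self a) (proj₂ (fr a (here refl)))) refl)
        u (λ { (here refl) → a≢x refl ; (there p) → All.lookup a∉ p refl })
        (λ w w∈ → trans (cong₂ _+_ (other x w λ { refl → notin u w∈ }) (proj₁ (fr w (there (there w∈))))) refl ,
                  trans (cong₂ _+_ (other a w (All.lookup a∉ w∈)) (proj₂ (fr w (there (there w∈))))) refl))
      (cnt-cong P (λ v → eq₁ (occ ys v) (𝟙 (a ≟ᶠ v)) (𝟙 (x ≟ᶠ v)) (i v)) (λ v → eq₂ (𝟙 (x ≟ᶠ v) + occ ys v) (𝟙 (a ≟ᶠ v)) (o v)))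
      where
      notin : ∀ {x : Fin n} {ys} → Unique (x ∷ ys) → x ∉ ys
      notin (p ∷ _) q = All.lookup p q refl
      eq₁ : ∀ m a x i → m + (a + (x + i)) ≡ a + (x + m) + i
      eq₁ = solve-∀
      eq₂ : ∀ m x o → m + (x + o) ≡ x + m + o
      eq₂ = solve-∀

  data Cycle : List (Fin n) → Set where
    cyc : ∀ a x ys → Cycle (a ∷ x ∷ ys)

  occ-∉ : ∀ c {v} → v ∉ c → occ c v ≡ 0
  occ-∉ c v∉ = ∑-zero c λ u u∈ → other u _ λ { refl → v∉ u∈ }

  occ-++ : ∀ c d v → occ (c ++ d) v ≡ occ c v + occ d v
  occ-++ c d v = ∑-++ c d _

  cnt-cycles : ∀ {cs} → All Cycle cs → Unique (concat cs) → ∀ {i o} → (∀ y → y ∈ concat cs → i y ≡ 0 × o y ≡ 0) →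
               cnt (concatMap cyclicPairs cs) i o ≡ 2 ^ length cs * 𝟙 (valid? (λ v → occ (concat cs) v + i v) (λ v → occ (concat cs) v + o v))
  cnt-cycles {[]} [] u fresh = sym (+-identityʳ _)
  cnt-cycles {c ∷ cs} (cyc a x ys ∷ all) u {i} {o} fresh with p , q , d ← unique-++⁻ c {concat cs} u = trans
      (cnt-cycle a x ys (concatMap cyclicPairs cs) p (λ y y∈ → fresh y (∈-++⁺ˡ y∈)))
      (trans (cong (2 *_) (cnt-cycles all q (λ y y∈ →
          trans (cong₂ _+_ (occ-∉ c λ y∈c → d y∈c y∈) (proj₁ (fresh y (∈-++⁺ʳ c y∈)))) refl ,
          trans (cong₂ _+_ (occ-∉ c λ y∈c → d y∈c y∈) (proj₂ (fresh y (∈-++⁺ʳ c y∈)))) refl)))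
       (trans (sym (*-assoc 2 (2 ^ length cs) _)) (cong (2 ^ length (c ∷ cs) *_) (cnt-cong [] (λ v → eq v (i v)) (λ v → eq v (o v))))))
    where
    eq : ∀ v k → occ (concat cs) v + (occ c v + k) ≡ occ (c ++ concat cs) v + k
    eq v k = trans (sym (+-assoc (occ (concat cs) v) (occ c v) k)) (cong (_+ k) (trans (+-comm (occ (concat cs) v) _) (sym (occ-++ c (concat cs) v))))

  ∑-cnt : ∀ P i o → ∑ (orients P) (λ D → 𝟙 (valid? (λ v → inn D v + i v) (λ v → out D v + o v))) ≡ cnt P i o
  ∑-cnt []            i o = +-identityʳ _
  ∑-cnt ((u , v) ∷ P) i o = trans (∑-orients-∷ u v P _) (cong₂ _+_
      (trans (∑-cong (orients P) λ D _ → cnt-cong [] (λ w → eq (𝟙 (v ≟ᶠ w)) (inn D w) (i w)) (λ w → eq (𝟙 (u ≟ᶠ w)) (out D w) (o w))) (∑-cnt P (bump v i) (bump u o)))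
      (trans (∑-cong (orients P) λ D _ → cnt-cong [] (λ w → eq (𝟙 (u ≟ᶠ w)) (inn D w) (i w)) (λ w → eq (𝟙 (v ≟ᶠ w)) (out D w) (o w))) (∑-cnt P (bump u i) (bump v o))))
    where
    eq : ∀ a b c → a + b + c ≡ b + (a + c)
    eq = solve-∀

  occ≤1 : ∀ {c} → Unique c → ∀ v → occ c v ≡ 0 ⊎ occ c v ≡ 1
  occ≤1 {[]} u v = inj₁ refl
  occ≤1 {x ∷ c} (x∉ ∷ u) v with x ≟ᶠ v
  ... | yes refl = inj₂ (cong suc (occ-∉ c λ p → All.lookup x∉ p refl))
  ... | no _ = occ≤1 u v

  -- Starting from degrees 0, each cycle contributes its two directions. Afterwards the vertices on
  -- the cycles have in- and out-degree 1 and all others have none, so every one of these choices is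
  -- valid.
  count-balanced : ∀ {cs} → All Cycle cs → Unique (concat cs) →
                   ∑ (orients (concatMap cyclicPairs cs)) (λ D → 𝟙 (all? (good? D) π)) ≡ 2 ^ length cs
  count-balanced {cs} all u = trans (∑-cong (orients (concatMap cyclicPairs cs)) λ D _ →
      𝟙-cong (all? (good? D) π) (valid? (λ v → inn D v + 0) (λ v → out D v + 0))
        (All.map (good-cong {inn D} {o = out D} (λ v → sym (+-identityʳ _)) (λ v → sym (+-identityʳ _))))
        (All.map (good-cong {i′ = inn D} {o′ = out D} (λ v → +-identityʳ _) (λ v → +-identityʳ _))))
    (trans (∑-cnt (concatMap cyclicPairs cs) (λ _ → 0) (λ _ → 0))
    (trans (cnt-cycles all u (λ _ _ → refl , refl))
    (trans (cong (2 ^ length cs *_) (𝟙-yes (valid? _ _) (All.tabulate λ {v} _ → fine v (occ≤1 u v)))) (*-identityʳ _))))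
    where
    fine : ∀ v → occ (concat cs) v ≡ 0 ⊎ occ (concat cs) v ≡ 1 → Goodᶜ (λ v → occ (concat cs) v + 0) (λ v → occ (concat cs) v + 0) v
    fine v (inj₁ e) rewrite e = inj₂ refl
    fine v (inj₂ e) rewrite e = inj₁ (refl , refl)

-- Arc lists and partial cycle covers.

Unique-resp-↭ : ∀ {xs ys : List A} → xs ↭ ys → Unique xs → Unique ys
Unique-resp-↭ ↭.refl u = u
Unique-resp-↭ (↭.prep x p) (x∉ ∷ u) = All-resp-↭ p x∉ ∷ Unique-resp-↭ p u
Unique-resp-↭ (↭.swap x y p) ((x≢y ∷ x∉) ∷ y∉ ∷ u) = ((x≢y ∘ sym) ∷ All-resp-↭ p y∉) ∷ All-resp-↭ p x∉ ∷ Unique-resp-↭ p u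
Unique-resp-↭ (↭.trans p q) u = Unique-resp-↭ q (Unique-resp-↭ p u)

filterᵇ∈subs : ∀ (p : A → Bool) E → filterᵇ p E ∈ subs E
filterᵇ∈subs p []      = here refl
filterᵇ∈subs p (x ∷ E) with p x
... | true  = ∈-++⁺ʳ (subs E) (∈-map⁺ (x ∷_) (filterᵇ∈subs p E))
... | false = ∈-++⁺ˡ (filterᵇ∈subs p E)

length-filter-∑ : ∀ {P : A → Set} (P? : ∀ x → Dec (P x)) xs → length (filter P? xs) ≡ ∑ xs (𝟙 ∘ P?)
length-filter-∑ P? []       = refl
length-filter-∑ P? (x ∷ xs) with P? x
... | yes _ = cong suc (length-filter-∑ P? xs)
... | no _  = length-filter-∑ P? xs

∈-link : ∀ {x z : A} ys {a b} → (a , b) ∈ link x ys z → a ∈ x ∷ ys × b ∈ ys ++ [ z ]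
∈-link []       (here refl) = here refl , here refl
∈-link (y ∷ ys) (here refl) = here refl , here refl
∈-link (y ∷ ys) (there p) with q , r ← ∈-link ys p = there q , there r

tails-link : ∀ (x : A) ys z → map proj₁ (link x ys z) ≡ x ∷ ys
tails-link x []       z = refl
tails-link x (y ∷ ys) z = cong (x ∷_) (tails-link y ys z)

tails-cyclicPairs : ∀ (c : List A) → map proj₁ (cyclicPairs c) ≡ c
tails-cyclicPairs []       = refl
tails-cyclicPairs (x ∷ ys) = trans (cong (map proj₁) (cyclicPairs≡ x ys)) (tails-link x ys x)

tails-concat : ∀ (cs : List (List A)) → map proj₁ (concatMap cyclicPairs cs) ≡ concat cs
tails-concat []       = refl
tails-concat (c ∷ cs) = trans (map-++ proj₁ (cyclicPairs c) _) (cong₂ _++_ (tails-cyclicPairs c) (tails-concat cs))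

rotate : ∀ {a x : A} {ys} → a ∈ ys ++ [ x ] → a ∈ x ∷ ys
rotate {x = x} {ys} p with ∈-++⁻ ys p
... | inj₁ q           = there q
... | inj₂ (here refl) = here refl

∈-cyclicPairs : ∀ (c : List A) {a b} → (a , b) ∈ cyclicPairs c → a ∈ c × b ∈ c
∈-cyclicPairs (x ∷ ys) p with q , r ← ∈-link ys (subst (_ ∈_) (cyclicPairs≡ x ys) p) = q , rotate r

link-antisym : ∀ {x z : A} ys → Unique (x ∷ ys ++ [ z ]) → ∀ {a b} → (a , b) ∈ link x ys z → (b , a) ∉ link x ys z
link-antisym [] ((x≢z ∷ []) ∷ _) (here refl) (here e) = x≢z (cong proj₂ e)
link-antisym (y ∷ ys) (x∉ ∷ u) (here refl) (here e) = All.lookup x∉ (here refl) (cong proj₂ e)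
link-antisym (y ∷ ys) (x∉ ∷ u) (here refl) (there q) = All.lookup x∉ (there (proj₂ (∈-link ys q))) refl
link-antisym (y ∷ ys) (x∉ ∷ u) (there p) (here refl) = All.lookup x∉ (there (proj₂ (∈-link ys p))) refl
link-antisym (y ∷ ys) (x∉ ∷ u) (there p) (there q) = link-antisym ys u p q

cycle-antisym : ∀ {x y z : A} {ys} → Unique (x ∷ y ∷ z ∷ ys) → ∀ {a b} → (a , b) ∈ cyclicPairs (x ∷ y ∷ z ∷ ys) → (b , a) ∉ cyclicPairs (x ∷ y ∷ z ∷ ys)
cycle-antisym {x = x} {y} {z} {ys} u@((x≢y ∷ x≢z ∷ x∉) ∷ (y≢z ∷ y∉) ∷ v) {a} {b} p q =
  go (subst ((a , b) ∈_) (cyclicPairs≡ x (y ∷ z ∷ ys)) p) (subst ((b , a) ∈_) (cyclicPairs≡ x (y ∷ z ∷ ys)) q)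
  where
  tail-unique : Unique (y ∷ (z ∷ ys) ++ [ x ])
  tail-unique = unique-++⁺ {xs = y ∷ z ∷ ys} ((y≢z ∷ y∉) ∷ v) ([] ∷ []) λ { (w∈ , here refl) → All.lookup (x≢y ∷ x≢z ∷ x∉) w∈ refl }
  back : (y , x) ∉ link y (z ∷ ys) x
  back (here e)  = x≢z (cong proj₂ e)
  back (there r) = All.lookup (y≢z ∷ y∉) (proj₁ (∈-link ys r)) refl
  go : ∀ {a b} → (a , b) ∈ link x (y ∷ z ∷ ys) x → (b , a) ∉ link x (y ∷ z ∷ ys) x
  go (here refl) (here e)      = x≢y (cong proj₂ e)
  go (here refl) (there q)     = back q
  go (there p)     (here refl) = back p
  go (there p)     (there q)     = link-antisym (z ∷ ys) tail-unique p q

module CycleCovers {n : ℕ} where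
  open Degrees {n}

  -- The direction-free name of an edge: no edge is listed twice, in whatever directions, iff the
  -- names are distinct.
  norm : Arc → Arc
  norm (u , v) = if toℕ u ≤ᵇ toℕ v then (u , v) else (v , u)

  norm-flips : ∀ e → norm e ≡ e ⊎ norm e ≡ Prod.swap e
  norm-flips (u , v) with toℕ u ≤ᵇ toℕ v
  ... | true  = inj₁ refl
  ... | false = inj₂ refl

  norm-swap : ∀ u v → norm (u , v) ≡ norm (v , u)
  norm-swap u v with toℕ u ≤ᵇ toℕ v in p | toℕ v ≤ᵇ toℕ u in q
  ... | true  | true  with refl ← toℕ-injective (≤-antisym (≤ᵇ⇒≤ (toℕ u) (toℕ v) (Equivalence.from T-≡ p)) (≤ᵇ⇒≤ (toℕ v) (toℕ u) (Equivalence.from T-≡ q))) = refl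
  ... | true  | false = refl
  ... | false | true  = refl
  ... | false | false with ≤-total (toℕ u) (toℕ v)
  ...   | inj₁ le = contradiction (trans (sym p) (Equivalence.to T-≡ (≤⇒≤ᵇ le))) λ ()
  ...   | inj₂ le = contradiction (trans (sym q) (Equivalence.to T-≡ (≤⇒≤ᵇ le))) λ ()

  norm-injective : ∀ e f → norm e ≡ norm f → e ≡ f ⊎ e ≡ Prod.swap f
  norm-injective e f eq with norm-flips e | norm-flips f
  ... | inj₁ p | inj₁ q = inj₁ (trans (sym p) (trans eq q))
  ... | inj₁ p | inj₂ q = inj₂ (trans (sym p) (trans eq q))
  ... | inj₂ p | inj₁ q = inj₂ (cong Prod.swap (trans (sym p) (trans eq q)))
  ... | inj₂ p | inj₂ q = inj₁ (cong Prod.swap (trans (sym p) (trans eq q)))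

  norm-orients : ∀ C {D} → D ∈ orients C → map norm D ≡ map norm C
  norm-orients []            (here refl) = refl
  norm-orients ((u , v) ∷ C) D∈ with ∈-++⁻ (map ((u , v) ∷_) (orients C)) D∈
  ... | inj₁ p with D , q , refl ← ∈-map⁻ _ p = cong (norm (u , v) ∷_) (norm-orients C q)
  ... | inj₂ p with D , q , refl ← ∈-map⁻ _ p = cong₂ _∷_ (norm-swap v u) (norm-orients C q)

  _∈?_ : ∀ (e : Arc) D → Dec (e ∈ D)
  e ∈? D = Any.any? (×-≡-dec _≟ᶠ_ _≟ᶠ_ e) D

  record Simple (D : List Arc) : Set where
    constructor simple
    field
      uniqueEdges : Unique (map norm D)
      noLoops     : ∀ {x} → (x , x) ∉ D
  open Simple

  Simple-↭ : ∀ {D D′} → D ↭ D′ → Simple D → Simple D′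
  Simple-↭ p (simple u l) = simple (Unique-resp-↭ (↭-map⁺ norm p) u) (l ∘ ∈-resp-↭ (↭-sym p))

  private
    nb : List Arc → Fin n → List (Fin n)
    nb []            v = []
    nb ((a , c) ∷ D) v = (if does (c ≟ᶠ v) then [ a ] else []) ++ (if does (a ≟ᶠ v) then [ c ] else []) ++ nb D v

    length-nb : ∀ D v → length (nb D v) ≡ inc D v
    length-nb []            v = refl
    length-nb ((a , c) ∷ D) v = trans (length-++ (if does (c ≟ᶠ v) then [ a ] else [])) (trans
      (cong₂ _+_ (one a (c ≟ᶠ v)) (trans (length-++ (if does (a ≟ᶠ v) then [ c ] else [])) (cong₂ _+_ (one c (a ≟ᶠ v)) (length-nb D v))))
      (eq (𝟙 (c ≟ᶠ v)) (𝟙 (a ≟ᶠ v)) (inn D v) (out D v)))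
      where
      one : ∀ {P : Set} (x : Fin n) (p : Dec P) → length (if does p then [ x ] else []) ≡ 𝟙 p
      one x (yes _) = refl
      one x (no _)  = refl
      eq : ∀ c a i o → c + (a + (i + o)) ≡ (c + i) + (a + o)
      eq = solve-∀

    ∈-nb⁻ : ∀ D {v u} → u ∈ nb D v → (v , u) ∈ D ⊎ (u , v) ∈ D
    ∈-nb⁻ ((a , c) ∷ D) {v} u∈ with c ≟ᶠ v | a ≟ᶠ v
    ∈-nb⁻ ((a , c) ∷ D) (here refl)          | yes refl | _          = inj₂ (here refl)
    ∈-nb⁻ ((a , c) ∷ D) (there (here refl))  | yes refl | yes refl = inj₁ (here refl)
    ∈-nb⁻ ((a , c) ∷ D) (there (there u∈))     | yes refl | yes refl = Sum.map there there (∈-nb⁻ D u∈)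
    ∈-nb⁻ ((a , c) ∷ D) (there u∈)             | yes refl | no _       = Sum.map there there (∈-nb⁻ D u∈)
    ∈-nb⁻ ((a , c) ∷ D) (here refl)          | no _       | yes refl = inj₁ (here refl)
    ∈-nb⁻ ((a , c) ∷ D) (there u∈)             | no _       | yes refl = Sum.map there there (∈-nb⁻ D u∈)
    ∈-nb⁻ ((a , c) ∷ D) u∈                     | no _       | no _       = Sum.map there there (∈-nb⁻ D u∈)

    ∈-nb⁺ : ∀ D {v u} → (v , u) ∈ D ⊎ (u , v) ∈ D → u ∈ nb D v
    ∈-nb⁺ ((a , c) ∷ D) {v} {u} (inj₁ (here refl)) with v ≟ᶠ v
    ... | yes _ = ∈-++⁺ʳ (if does (c ≟ᶠ v) then [ a ] else []) (here refl)
    ... | no ne = contradiction refl ne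
    ∈-nb⁺ ((a , c) ∷ D) {v} {u} (inj₂ (here refl)) with v ≟ᶠ v
    ... | yes _ = here refl
    ... | no ne = contradiction refl ne
    ∈-nb⁺ ((a , c) ∷ D) {v} (inj₁ (there p)) = ∈-++⁺ʳ (if does (c ≟ᶠ v) then [ a ] else []) (∈-++⁺ʳ (if does (a ≟ᶠ v) then [ c ] else []) (∈-nb⁺ D (inj₁ p)))
    ∈-nb⁺ ((a , c) ∷ D) {v} (inj₂ (there p)) = ∈-++⁺ʳ (if does (c ≟ᶠ v) then [ a ] else []) (∈-++⁺ʳ (if does (a ≟ᶠ v) then [ c ] else []) (∈-nb⁺ D (inj₂ p)))

    ∈-nb-norm : ∀ D {v u} → u ∈ nb D v → norm (v , u) ∈ map norm D
    ∈-nb-norm D {v} {u} u∈ with ∈-nb⁻ D u∈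
    ... | inj₁ p = ∈-map⁺ norm p
    ... | inj₂ p = subst (_∈ map norm D) (norm-swap u v) (∈-map⁺ norm p)

    nb-unique : ∀ D v → Simple D → Unique (nb D v)
    nb-unique []            v s = []
    nb-unique ((a , c) ∷ D) v s@(simple (e∉ ∷ u) l) with c ≟ᶠ v | a ≟ᶠ v | nb-unique D v (simple u (l ∘ there))
    ... | yes refl | yes refl | _ = contradiction (here refl) l
    ... | yes refl | no _ | r = All.tabulate (λ u∈ → λ { refl → All.lookup e∉ (∈-nb-norm D u∈) (norm-swap a c) }) ∷ r
    ... | no _ | yes refl | r = All.tabulate (λ u∈ → λ { refl → All.lookup e∉ (∈-nb-norm D u∈) refl }) ∷ r
    ... | no _ | no _ | r = r

  record Draws (H : Graph n) (D : List Arc) : Set where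
    constructor draws
    field
      drawn  : ∀ {u v} → adj H u v ≡ true → (u , v) ∈ D ⊎ (v , u) ∈ D
      edge   : ∀ {u v} → (u , v) ∈ D ⊎ (v , u) ∈ D → adj H u v ≡ true
  open Draws

  degree≡inc : ∀ {H D} → Simple D → Draws H D → ∀ v → degree H v ≡ inc D v
  degree≡inc {H} {D} s d v = trans (↭-length (unique⇒↭ (nb-unique D v s) (filterᵇ-unique (adj H v) (allFin⁺ n))
      (λ {u} u∈ → ∈-filterᵇ⁺ (adj H v) (∈-allFin u) (edge d (∈-nb⁻ D u∈)))
      (λ {u} u∈ → ∈-nb⁺ D (drawn d (proj₂ (∈-filterᵇ⁻ (adj H v) {allFin n} u∈))))))
    (length-nb D v)

  inn-↭ : ∀ {D D′} → D ↭ D′ → ∀ v → inn D v ≡ inn D′ v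
  inn-↭ p v = ∑-↭ _ p

  out-↭ : ∀ {D D′} → D ↭ D′ → ∀ v → out D v ≡ out D′ v
  out-↭ p v = ∑-↭ _ p

  -- Following the arcs of a balanced set of arcs splits it into closed walks.
  leave : ∀ D z → out D z ≢ 0 → Σ[ c ∈ Fin n ] Σ[ D′ ∈ List Arc ] (D ↭ (z , c) ∷ D′)
  leave []            z ne = contradiction refl ne
  leave ((a , c) ∷ D) z ne with a ≟ᶠ z
  ... | yes refl = c , D , ↭-refl
  ... | no _ with d , D′ , p ← leave D z ne = d , (a , c) ∷ D′ , ↭-trans (↭-prep (a , c) p) (↭.swap (a , c) (z , d) ↭-refl)

  private
    Rest : List Arc → Fin n → Fin n → Set
    Rest D x z = ∀ v → inn D v + 𝟙 (z ≟ᶠ v) ≡ out D v + 𝟙 (x ≟ᶠ v)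

    can-leave : ∀ {D x z} → Rest D x z → z ≢ x → out D z ≢ 0
    can-leave {D} {x} {z} bal z≢x e = contradiction
      (trans (sym (cong (inn D z +_) (𝟙-yes (z ≟ᶠ z) refl))) (trans (bal z) (cong₂ _+_ e (𝟙-no (x ≟ᶠ z) (z≢x ∘ sym)))))
      (subst (_≢ 0) (+-comm 1 (inn D z)) λ ())

    rest-step : ∀ {D D′ x z c} → D ↭ (z , c) ∷ D′ → Rest D x z → Rest D′ x c
    rest-step {D} {D′} {x} {z} {c} p bal v = +-cancelˡ-≡ (𝟙 (z ≟ᶠ v)) _ _ (begin
        𝟙 (z ≟ᶠ v) + (inn D′ v + 𝟙 (c ≟ᶠ v))
      ≡⟨ eq (𝟙 (z ≟ᶠ v)) (inn D′ v) (𝟙 (c ≟ᶠ v)) ⟩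
        𝟙 (c ≟ᶠ v) + inn D′ v + 𝟙 (z ≟ᶠ v)
      ≡⟨ cong (_+ 𝟙 (z ≟ᶠ v)) (inn-↭ p v) ⟨
        inn D v + 𝟙 (z ≟ᶠ v)
      ≡⟨ bal v ⟩
        out D v + 𝟙 (x ≟ᶠ v)
      ≡⟨ cong (_+ 𝟙 (x ≟ᶠ v)) (out-↭ p v) ⟩
        𝟙 (z ≟ᶠ v) + out D′ v + 𝟙 (x ≟ᶠ v)
      ≡⟨ +-assoc (𝟙 (z ≟ᶠ v)) _ _ ⟩
        𝟙 (z ≟ᶠ v) + (out D′ v + 𝟙 (x ≟ᶠ v)) ∎)
      where
      open ≡-Reasoning
      eq : ∀ a b c → a + (b + c) ≡ c + b + a
      eq = solve-∀

  -- The arcs still ahead are balanced up to the missing way from `z` back to `x`. Hence `z` has an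
  -- outgoing arc unless it is `x`, and as every step uses up an arc the walk closes.
  walk : ∀ k D → length D ≤ k → ∀ a x z → (∀ v → inn D v + 𝟙 (z ≟ᶠ v) ≡ out D v + 𝟙 (x ≟ᶠ v)) →
         Σ[ ws ∈ List (Fin n) ] Σ[ D′ ∈ List Arc ] ((a , z) ∷ D ↭ link a ws x ++ D′ × (∀ v → inn D′ v ≡ out D′ v) × length D′ ≤ k)
  walk k D le a x z bal with z ≟ᶠ x
  ... | yes refl = [] , D , ↭-refl , (λ v → +-cancelʳ-≡ (𝟙 (z ≟ᶠ v)) (inn D v) (out D v) (bal v)) , le
  ... | no z≢x with leave D z (can-leave {D} bal z≢x)
  walk zero    D le a x z bal | no z≢x | c , D′ , p = contradiction (≤-trans (≤-reflexive (sym (↭-length p))) le) λ ()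
  walk (suc k) D le a x z bal | no z≢x | c , D′ , p
    with ws , D″ , q , b , l ← walk k D′ (s≤s⁻¹ (≤-trans (≤-reflexive (sym (↭-length p))) le)) z x c (rest-step {D} {D′} {x} p bal) =
    z ∷ ws , D″ , ↭-prep (a , z) (↭-trans p q) , b , ≤-trans l (n≤1+n k)

  decompose : ∀ k D → length D ≤ k → (∀ v → inn D v ≡ out D v) → Σ[ cs ∈ List (List (Fin n)) ] (D ↭ concatMap cyclicPairs cs × All (_≢ []) cs)
  decompose k       []            le bal = [] , ↭-refl , []
  decompose (suc k) ((x , z) ∷ D) (s≤s le) bal
    with ws , D′ , p , b , l ← walk k D le x x z (λ v → trans (+-comm (inn D v) _) (trans (bal v) (+-comm (𝟙 (x ≟ᶠ v)) _)))
    with cs , q , ne ← decompose k D′ l b =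
    (x ∷ ws) ∷ cs , ↭-trans p (subst (λ z → link x ws x ++ D′ ↭ z ++ concatMap cyclicPairs cs) (sym (cyclicPairs≡ x ws)) (++⁺ˡ (link x ws x) q)) , (λ ()) ∷ ne

  unique-occ : ∀ (xs : List (Fin n)) → (∀ v → ∑ xs (λ u → 𝟙 (u ≟ᶠ v)) ≤ 1) → Unique xs
  unique-occ []       le = []
  unique-occ (x ∷ xs) le = All.tabulate (λ {y} y∈ → λ { refl → contradiction
      (≤-trans (+-mono-≤ (≤-reflexive (sym (𝟙-yes (x ≟ᶠ x) refl))) (≤-trans (≤-reflexive (sym (𝟙-yes (x ≟ᶠ x) refl))) (∑-∈-≤ (λ u → 𝟙 (u ≟ᶠ x)) y∈))) (le x)) (<⇒≱ ≤-refl) })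
    ∷ unique-occ xs (λ v → ≤-trans (m≤n+m _ _) (le v))

  inc-orients : ∀ C {D} → D ∈ orients C → ∀ v → inc D v ≡ inc C v
  inc-orients []            (here refl) w = refl
  inc-orients ((u , v) ∷ C) D∈ w with ∈-++⁻ (map ((u , v) ∷_) (orients C)) D∈
  ... | inj₁ p with D , q , refl ← ∈-map⁻ _ p = trans (eq (𝟙 (v ≟ᶠ w)) (inn D w) (𝟙 (u ≟ᶠ w)) (out D w)) (trans (cong (𝟙 (v ≟ᶠ w) + 𝟙 (u ≟ᶠ w) +_) (inc-orients C q w)) (sym (eq (𝟙 (v ≟ᶠ w)) (inn C w) (𝟙 (u ≟ᶠ w)) (out C w))))
    where
    eq : ∀ a i b o → (a + i) + (b + o) ≡ (a + b) + (i + o)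
    eq = solve-∀
  ... | inj₂ p with D , q , refl ← ∈-map⁻ _ p = trans (eq (𝟙 (u ≟ᶠ w)) (inn D w) (𝟙 (v ≟ᶠ w)) (out D w)) (trans (cong (𝟙 (v ≟ᶠ w) + 𝟙 (u ≟ᶠ w) +_) (inc-orients C q w)) (sym (eq′ (𝟙 (v ≟ᶠ w)) (inn C w) (𝟙 (u ≟ᶠ w)) (out C w))))
    where
    eq : ∀ a i b o → (a + i) + (b + o) ≡ (b + a) + (i + o)
    eq = solve-∀
    eq′ : ∀ a i b o → (a + i) + (b + o) ≡ (a + b) + (i + o)
    eq′ = solve-∀

  Simple-++⁻ : ∀ C {D} → Simple (C ++ D) → Simple C × Simple D
  Simple-++⁻ C {D} (simple u l) with p , q , _ ← unique-++⁻ (map norm C) {map norm D} (subst Unique (map-++ norm C D) u) =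
    simple p (l ∘ ∈-++⁺ˡ) , simple q (l ∘ ∈-++⁺ʳ C)

  data Long : List (Fin n) → Set where
    long : ∀ x y z ys → Long (x ∷ y ∷ z ∷ ys)

  -- A closed walk on one vertex is a loop, and one on two vertices uses an edge twice.
  simple-long : ∀ cs → Simple (concatMap cyclicPairs cs) → All (_≢ []) cs → All Long cs
  simple-long []       s []        = []
  simple-long (c ∷ cs) s (ne ∷ nes) with p , q ← Simple-++⁻ (cyclicPairs c) s = one c ne p ∷ simple-long cs q nes
    where
    one : ∀ c → c ≢ [] → Simple (cyclicPairs c) → Long c
    one []              ne s = contradiction refl ne
    one (x ∷ [])        ne s = contradiction (here refl) (noLoops s)
    one (x ∷ y ∷ [])    ne (simple ((e ∷ []) ∷ _) _) = contradiction (norm-swap x y) e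
    one (x ∷ y ∷ z ∷ c) ne s = long x y z c

  record Lists (G : Graph n) (E : List Arc) : Set where
    field
      listed : ∀ {u v} → (u , v) ∈ E → adj G u v ≡ true
      covers : ∀ {u v} → adj G u v ≡ true → (u , v) ∈ E ⊎ (v , u) ∈ E
      once   : Unique (map norm E)
  open Lists

  drawing : ∀ D → (∀ {x} → (x , x) ∉ D) → Graph n
  drawing D noLoop = record
    { adj    = λ u v → does ((u , v) ∈? D) ∨ does ((v , u) ∈? D)
    ; sym    = λ u v → ∨-comm (does ((u , v) ∈? D)) _
    ; irrefl = λ v → none v
    }
    where
    none : ∀ v → does ((v , v) ∈? D) ∨ does ((v , v) ∈? D) ≡ false
    none v with (v , v) ∈? D
    ... | yes p = contradiction p noLoop
    ... | no _  = refl

  drawing-draws : ∀ D (l : ∀ {x} → (x , x) ∉ D) → Draws (drawing D l) D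
  drawing-draws D l = draws to from
    where
    to : ∀ {u v} → does ((u , v) ∈? D) ∨ does ((v , u) ∈? D) ≡ true → (u , v) ∈ D ⊎ (v , u) ∈ D
    to {u} {v} e with (u , v) ∈? D | (v , u) ∈? D
    ... | yes p | _     = inj₁ p
    ... | no _  | yes p = inj₂ p
    to () | no _ | no _
    from : ∀ {u v} → (u , v) ∈ D ⊎ (v , u) ∈ D → does ((u , v) ∈? D) ∨ does ((v , u) ∈? D) ≡ true
    from {u} {v} p with (u , v) ∈? D | (v , u) ∈? D
    ... | yes _ | _     = refl
    ... | no _  | yes _ = refl
    ... | no a  | no b  = contradiction p Sum.[ a , b ]

  disjoint-concat : ∀ {cs : List (List (Fin n))} → Unique (concat cs) → All Unique cs × AllPairs Disjoint cs
  disjoint-concat {[]}     u = [] , []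
  disjoint-concat {c ∷ cs} u with p , q , d ← unique-++⁻ c {concat cs} u with us , ds ← disjoint-concat {cs} q =
    p ∷ us , apart cs d ∷ ds
    where
    apart : ∀ cs → (∀ {v} → v ∈ c → v ∉ concat cs) → All (Disjoint c) cs
    apart []       d = []
    apart (e ∷ cs) d = (λ (v∈ , w∈) → d v∈ (∈-++⁺ˡ w∈)) ∷ apart cs (λ v∈ w∈ → d v∈ (∈-++⁺ʳ e w∈))

  unique-norm : ∀ L → Unique (map proj₁ L) → (∀ {a b} → (a , b) ∈ L → (b , a) ∉ L) → Unique (map norm L)
  unique-norm []      u        anti = []
  unique-norm (e ∷ L) (e∉ ∷ u) anti = All.tabulate (λ y∈ eq → let f , f∈ , q = ∈-map⁻ norm y∈ in
      Sum.[ (λ { refl → All.lookup e∉ (∈-map⁺ proj₁ f∈) refl }) , (λ { refl → anti (here refl) (there f∈) }) ] (norm-injective e f (trans eq q)))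
    ∷ unique-norm L u (λ p q → anti (there p) (there q))

  cycles-antisym : ∀ {cs} → All Long cs → Unique (concat cs) → ∀ {a b} → (a , b) ∈ concatMap cyclicPairs cs → (b , a) ∉ concatMap cyclicPairs cs
  cycles-antisym {c ∷ cs} (l ∷ ls) u {a} {b} p q with unique-++⁻ c {concat cs} u | ∈-++⁻ (cyclicPairs c) p | ∈-++⁻ (cyclicPairs c) q
  ... | v , _ , _ | inj₁ x | inj₁ y = one l v x y
    where
    one : ∀ {c} → Long c → Unique c → (a , b) ∈ cyclicPairs c → (b , a) ∉ cyclicPairs c
    one (long x y z ys) = λ u → cycle-antisym u
  ... | _ , _ , d | inj₁ x | inj₂ y = d (proj₂ (∈-cyclicPairs c x)) (subst (b ∈_) (tails-concat cs) (∈-map⁺ proj₁ y))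
  ... | _ , _ , d | inj₂ x | inj₁ y = d (proj₂ (∈-cyclicPairs c y)) (subst (a ∈_) (tails-concat cs) (∈-map⁺ proj₁ x))
  ... | _ , w , _ | inj₂ x | inj₂ y = cycles-antisym ls w x y

  length≤concat : ∀ {cs : List (List (Fin n))} → All Long cs → length cs ≤ length (concat cs)
  length≤concat [] = z≤n
  length≤concat {c ∷ cs} (long x y z ys ∷ ls) = s≤s (≤-trans (length≤concat ls) (≤-trans (m≤n+m _ (length (y ∷ z ∷ ys))) (≤-reflexive (sym (length-++ (y ∷ z ∷ ys))))))

  isolated-cong : ∀ {D D′} π → (∀ v → inc D v ≡ inc D′ v) → isolated D π ≡ isolated D′ π
  isolated-cong π e = ∑-cong π λ v _ → cong (λ z → 𝟙 (z ≟ 0)) (e v)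

  module _ {π : List (Fin n)} (unique : Unique π) (complete : ∀ v → v ∈ π) where
    open Orientations {n} {π} complete

    all-good-↭ : ∀ {D D′} → D ↭ D′ → 𝟙 (all? (good? D) π) ≡ 𝟙 (all? (good? D′) π)
    all-good-↭ {D} {D′} p = 𝟙-cong (all? (good? D) π) (all? (good? D′) π) (All.map (good-cong {inn D} {inn D′} {out D} {out D′} (inn-↭ p) (out-↭ p)))
      (All.map (good-cong {inn D′} {inn D} {out D′} {out D} (sym ∘ inn-↭ p) (sym ∘ out-↭ p)))

    -- Reversing arcs does not change which vertices are isolated, so the condition on their number
    -- depends on `C` alone and leaves the sum over orientations.
    ∑-balanced : ∀ C t → ∑ (orients C) (λ D → 𝟙 (balanced? D π t)) ≡ 𝟙 (isolated C π ≟ t) * ∑ (orients C) (λ D → 𝟙 (all? (good? D) π))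
    ∑-balanced C t = trans (∑-cong (orients C) λ D D∈ → trans (𝟙-× (all? (good? D) π) (isolated D π ≟ t))
        (trans (*-comm (𝟙 (all? (good? D) π)) _) (cong (λ z → 𝟙 (z ≟ t) * 𝟙 (all? (good? D) π)) (isolated-cong {D} {C} π (inc-orients C D∈)))))
      (sym (∑-*ˡ (𝟙 (isolated C π ≟ t)) (orients C) _))

    good⇒inn≡out : ∀ {D v} → Good D v → inn D v ≡ out D v
    good⇒inn≡out (inj₁ (a , b)) = trans a (sym b)
    good⇒inn≡out {D} {v} (inj₂ e) = trans (m+n≡0⇒m≡0 (inn D v) e) (sym (m+n≡0⇒n≡0 (inn D v) e))

    good⇒out≤1 : ∀ {D v} → Good D v → out D v ≤ 1
    good⇒out≤1 (inj₁ (_ , b)) = ≤-reflexive b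
    good⇒out≤1 {D} {v} (inj₂ e) = ≤-trans (≤-reflexive (m+n≡0⇒n≡0 (inn D v) e)) z≤n

    π↭allFin : π ↭ allFin n
    π↭allFin = unique⇒↭ (allFin⁺ n) unique (λ {v} _ → complete v) (λ {v} _ → ∈-allFin v)

    covered+isolated : ∀ {H D} → (∀ v → degree H v ≡ inc D v) → (∀ v → inc D v ≡ 0 ⊎ inc D v ≡ 2) → length (covered H) + isolated D π ≡ n
    covered+isolated {H} {D} deg two = begin
        length (covered H) + isolated D π
      ≡⟨ cong₂ _+_ (length-filter-∑ (λ v → degree H v ≟ 2) (allFin n)) (∑-↭ _ π↭allFin) ⟩
        ∑ (allFin n) (λ v → 𝟙 (degree H v ≟ 2)) + ∑ (allFin n) (λ v → 𝟙 (inc D v ≟ 0))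
      ≡⟨ ∑-+ (allFin n) _ _ ⟩
        ∑ (allFin n) (λ v → 𝟙 (degree H v ≟ 2) + 𝟙 (inc D v ≟ 0))
      ≡⟨ ∑-cong (allFin n) (λ v _ → one v (two v)) ⟩
        ∑ (allFin n) (λ _ → 1)
      ≡⟨ trans (∑-const (allFin n) 1) (trans (*-identityʳ _) (length-tabulate {n = n} id)) ⟩
        n ∎
      where
      open ≡-Reasoning
      one : ∀ v → inc D v ≡ 0 ⊎ inc D v ≡ 2 → 𝟙 (degree H v ≟ 2) + 𝟙 (inc D v ≟ 0) ≡ 1
      one v e rewrite deg v with e
      ... | inj₁ e rewrite e = refl
      ... | inj₂ e rewrite e = refl

    long⇒cycle : ∀ {c} → Long c → Cycle c
    long⇒cycle (long x y z ys) = cyc x y (z ∷ ys)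

    module _ (G : Graph n) {E : List Arc} (lists : Lists G E) {C : List Arc} (C∈ : C ∈ subs E) where

      C-simple : Simple C
      C-simple = simple (subs-unique norm E C∈ (once lists)) λ x∈ → contradiction (trans (sym (listed lists (subs⇒⊆ E C∈ x∈))) (irrefl G _)) λ ()

      -- The count is not 0, so `C` has a balanced orientation `D`, whose arcs split into closed
      -- walks. Out-degrees at most 1 make these walks vertex-disjoint simple cycles. The balanced
      -- orientations of `C` then number 2 to the number of cycles, and non-divisibility leaves at
      -- most `k` of these.
      sound : ∀ {k ℓ} → ℓ ≤ n → ¬ 2 ^ suc k ∣ ∑ (orients C) (λ D → 𝟙 (balanced? D π (n ∸ ℓ))) → PartialCycleCover G k ℓ
      sound {k} {ℓ} ℓ≤n ¬div with Any.any? (λ D → balanced? D π (n ∸ ℓ)) (orients C)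
      ... | no none = contradiction (subst (2 ^ suc k ∣_) (sym (∑-zero (orients C) λ D D∈ → 𝟙-no (balanced? D π (n ∸ ℓ)) λ b → none (lose D∈ b))) ((2 ^ suc k) ∣0)) ¬div
      ... | yes any with D , D∈ , good , iso ← find any
        with cs , p , ne ← decompose (length D) D ≤-refl (λ v → good⇒inn≡out {D} (All.lookup good (complete v))) =
        H , record { subset = λ u v e → Equivalence.from T-≡ (R⊆G (drawn drs (Equivalence.to T-≡ e))) ; degrees = λ v → Sum.map (trans (deg v)) (trans (deg v)) (two v) } ,
        (cs , record { cycles = cycles ; disjoint = proj₂ apart ; edgeSet = λ u v → mk⇔ (λ e → onCycle (drawn drs (Equivalence.to T-≡ e))) (λ a → Equivalence.from T-≡ (edge drs (offCycle a))) } , few) ,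
        cov
        where
        R : List Arc
        R = concatMap cyclicPairs cs
        D-simple : Simple D
        D-simple = simple (subst Unique (sym (norm-orients C D∈)) (uniqueEdges C-simple))
          λ {x} x∈ → contradiction (R-irr C D∈ x∈) (noLoops C-simple)
          where
          R-irr : ∀ C {D x} → D ∈ orients C → (x , x) ∈ D → (x , x) ∈ C
          R-irr [] (here refl) ()
          R-irr ((u , v) ∷ C) D∈ x∈ with ∈-++⁻ (map ((u , v) ∷_) (orients C)) D∈
          ... | inj₁ p with ∈-map⁻ _ p
          R-irr ((u , v) ∷ C) D∈ (here refl) | inj₁ p | D , q , refl = here refl
          R-irr ((u , v) ∷ C) D∈ (there x∈)    | inj₁ p | D , q , refl = there (R-irr C q x∈)
          R-irr ((u , v) ∷ C) D∈ x∈ | inj₂ p with ∈-map⁻ _ p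
          R-irr ((u , v) ∷ C) D∈ (here refl) | inj₂ p | D , q , refl = here refl
          R-irr ((u , v) ∷ C) D∈ (there x∈)    | inj₂ p | D , q , refl = there (R-irr C q x∈)
        R-simple : Simple R
        R-simple = Simple-↭ p D-simple
        H : Graph n
        H = drawing R (noLoops R-simple)
        drs : Draws H R
        drs = drawing-draws R (noLoops R-simple)
        deg : ∀ v → degree H v ≡ inc R v
        deg = degree≡inc R-simple drs
        incR : ∀ v → inc R v ≡ inc D v
        incR v = sym (cong₂ _+_ (inn-↭ p v) (out-↭ p v))
        two′ : ∀ {v} → Good D v → inc D v ≡ 0 ⊎ inc D v ≡ 2
        two′ (inj₁ (a , b)) = inj₂ (cong₂ _+_ a b)
        two′ (inj₂ e)       = inj₁ e
        two : ∀ v → inc R v ≡ 0 ⊎ inc R v ≡ 2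
        two v = Sum.map (trans (incR v)) (trans (incR v)) (two′ (All.lookup good (complete v)))
        -- A vertex occurs on the walks as often as it is the tail of an arc, so bounded out-degrees
        -- exclude repetitions both within a walk and between walks.
        tail-occ : ∀ v → ∑ (concat cs) (λ u → 𝟙 (u ≟ᶠ v)) ≡ out D v
        tail-occ v = trans (cong (λ z → ∑ z (λ u → 𝟙 (u ≟ᶠ v))) (sym (tails-concat cs))) (trans (∑-map proj₁ R _) (sym (out-↭ p v)))
        cs-unique : Unique (concat cs)
        cs-unique = unique-occ (concat cs) λ v → ≤-trans (≤-reflexive (tail-occ v)) (good⇒out≤1 {D} (All.lookup good (complete v)))
        apart : All Unique cs × AllPairs Disjoint cs
        apart = disjoint-concat cs-unique
        longs : All Long cs
        longs = simple-long cs R-simple ne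
        D⊆G : ∀ C → (∀ {u v} → (u , v) ∈ C → adj G u v ≡ true) → ∀ {D} → D ∈ orients C → ∀ {u v} → (u , v) ∈ D → adj G u v ≡ true
        D⊆G [] ed (here refl) ()
        D⊆G ((a , b) ∷ C) ed D∈ e∈ with ∈-++⁻ (map ((a , b) ∷_) (orients C)) D∈
        ... | inj₁ p with ∈-map⁻ _ p
        D⊆G ((a , b) ∷ C) ed D∈ (here refl) | inj₁ p | D , q , refl = ed (here refl)
        D⊆G ((a , b) ∷ C) ed D∈ (there e∈)    | inj₁ p | D , q , refl = D⊆G C (ed ∘ there) q e∈
        D⊆G ((a , b) ∷ C) ed D∈ e∈ | inj₂ p with ∈-map⁻ _ p
        D⊆G ((a , b) ∷ C) ed D∈ (here refl) | inj₂ p | D , q , refl = trans (adj-sym G b a) (ed (here refl))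
        D⊆G ((a , b) ∷ C) ed D∈ (there e∈)    | inj₂ p | D , q , refl = D⊆G C (ed ∘ there) q e∈
        arc⊆G : ∀ {u v} → (u , v) ∈ R → adj G u v ≡ true
        arc⊆G e∈ = D⊆G C (listed lists ∘ subs⇒⊆ E C∈) D∈ (∈-resp-↭ (↭-sym p) e∈)
        R⊆G : ∀ {u v} → (u , v) ∈ R ⊎ (v , u) ∈ R → adj G u v ≡ true
        R⊆G (inj₁ e∈) = arc⊆G e∈
        R⊆G {u} {v} (inj₂ e∈) = trans (adj-sym G u v) (arc⊆G e∈)
        cycles : All (IsSimpleCycle G) cs
        cycles = All.tabulate λ {c} c∈ → record
          { length≥3 = three (All.lookup longs c∈) ; distinct = All.lookup (proj₁ apart) c∈
          ; edges = All.tabulate λ e∈ → Equivalence.from T-≡ (arc⊆G (∈-concatMap⁺ cyclicPairs (lose c∈ e∈))) }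
          where
          three : ∀ {c} → Long c → 3 ≤ length c
          three (long x y z ys) = s≤s (s≤s (s≤s z≤n))
        onCycle : ∀ {u v} → (u , v) ∈ R ⊎ (v , u) ∈ R → Any (OnCycle u v) cs
        onCycle (inj₁ e∈) = Any.map inj₁ (∈-concatMap⁻ cyclicPairs {xs = cs} e∈)
        onCycle (inj₂ e∈) = Any.map inj₂ (∈-concatMap⁻ cyclicPairs {xs = cs} e∈)
        offCycle : ∀ {u v} → Any (OnCycle u v) cs → (u , v) ∈ R ⊎ (v , u) ∈ R
        offCycle a with c , c∈ , o ← find a with o
        ... | inj₁ e∈ = inj₁ (∈-concatMap⁺ cyclicPairs (lose c∈ e∈))
        ... | inj₂ e∈ = inj₂ (∈-concatMap⁺ cyclicPairs (lose c∈ e∈))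
        iso′ : isolated R π ≡ n ∸ ℓ
        iso′ = trans (isolated-cong {R} {D} π incR) iso
        cov : length (covered H) ≡ ℓ
        cov = +-cancelʳ-≡ (n ∸ ℓ) _ _ (trans (cong (length (covered H) +_) (sym iso′)) (trans (covered+isolated {H} {R} deg two) (sym (m+[n∸m]≡n ℓ≤n))))
        number : ∑ (orients C) (λ D → 𝟙 (all? (good? D) π)) ≡ 2 ^ length cs
        number = trans (sym (∑-orients-orients {C = C} D∈ _)) (trans (∑-orients-↭ p _ all-good-↭) (count-balanced (All.map long⇒cycle longs) cs-unique))
        few : length cs ≤ k
        few with length cs ≤? k
        ... | yes le = le
        ... | no ¬le = contradiction (∣-trans (m≤n⇒2^m∣2^n (≰⇒> ¬le)) (subst (2 ^ length cs ∣_) (sym (trans (∑-balanced C (n ∸ ℓ)) (cong (𝟙 (isolated C π ≟ n ∸ ℓ) *_) number))) (n∣m*n (𝟙 (isolated C π ≟ n ∸ ℓ))))) ¬div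
          where
          m≤n⇒2^m∣2^n : ∀ {m n} → m ≤ n → 2 ^ m ∣ 2 ^ n
          m≤n⇒2^m∣2^n {m} le with o , refl ← m≤n⇒∃[o]m+o≡n le = subst (2 ^ m ∣_) (sym (^-distribˡ-+-* 2 m o)) (m∣m*n (2 ^ o))

    -- The converse of `sound`. That `c ≤ n` is recorded as well because the program tests
    -- divisibility with min(n, k) in the place of `k`.
    covering : ∀ (G : Graph n) {E} → Lists G E → ∀ {k ℓ} → PartialCycleCover G k ℓ →
               ℓ ≤ n × Σ[ C ∈ List Arc ] (C ∈ subs E × Σ[ c ∈ ℕ ] (c ≤ k × c ≤ n × ∑ (orients C) (λ D → 𝟙 (balanced? D π (n ∸ ℓ))) ≡ 2 ^ c))
    covering G {E} lists {k} {ℓ} (H , cover , (cs , family , few) , cov) =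
        subst (ℓ ≤_) total (m≤m+n ℓ _) , C , filterᵇ∈subs (λ (u , v) → adj H u v) E , length cs , few ,
        ≤-trans (length≤concat longs) (≤-trans (⊆⇒length≤ {ys = allFin n} cs-unique (λ {v} _ → ∈-allFin v)) (≤-reflexive (length-tabulate {n = n} id))) ,
        (begin
          ∑ (orients C) (λ D → 𝟙 (balanced? D π (n ∸ ℓ)))
        ≡⟨ ∑-balanced C (n ∸ ℓ) ⟩
          𝟙 (isolated C π ≟ n ∸ ℓ) * ∑ (orients C) valid
        ≡⟨ cong (_* ∑ (orients C) valid) (𝟙-yes (isolated C π ≟ n ∸ ℓ) (trans (sym (m+n∸m≡n ℓ (isolated C π))) (cong (_∸ ℓ) total))) ⟩
          1 * ∑ (orients C) valid
        ≡⟨ +-identityʳ _ ⟩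
          ∑ (orients C) valid
        ≡⟨ ∑-orients-map norm norm-flips C valid ⟨
          ∑ (orients (map norm C)) valid
        ≡⟨ ∑-orients-↭ C↭R valid all-good-↭ ⟩
          ∑ (orients (map norm R)) valid
        ≡⟨ ∑-orients-map norm norm-flips R valid ⟩
          ∑ (orients R) valid
        ≡⟨ count-balanced (All.map long⇒cycle longs) cs-unique ⟩
          2 ^ length cs ∎)
      where
      open ≡-Reasoning
      open IsPartialCycleCover cover
      open IsCycleFamily family
      valid : List Arc → ℕ
      valid D = 𝟙 (all? (good? D) π)
      C R : List Arc
      C = filterᵇ (λ (u , v) → adj H u v) E
      R = concatMap cyclicPairs cs
      three : ∀ {c} → 3 ≤ length c → Long c
      three {x ∷ y ∷ z ∷ ys} _ = long x y z ys
      three {x ∷ y ∷ []} (s≤s (s≤s ()))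
      three {x ∷ []} (s≤s ())
      longs : All Long cs
      longs = All.map (three ∘ IsSimpleCycle.length≥3) cycles
      cs-unique : Unique (concat cs)
      cs-unique = unique-concat⁺ (All.map IsSimpleCycle.distinct cycles) disjoint
      drawsC : Draws H C
      drawsC = draws (λ {u} {v} a → Sum.map (λ e∈ → ∈-filterᵇ⁺ _ e∈ a) (λ e∈ → ∈-filterᵇ⁺ _ e∈ (trans (adj-sym H v u) a)) (covers lists (Equivalence.to T-≡ (subset u v (Equivalence.from T-≡ a)))))
        λ { (inj₁ e∈) → proj₂ (∈-filterᵇ⁻ (λ (u , v) → adj H u v) {E} e∈)
          ; {u} {v} (inj₂ e∈) → trans (adj-sym H u v) (proj₂ (∈-filterᵇ⁻ (λ (u , v) → adj H u v) {E} e∈)) }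
      drawsR : Draws H R
      drawsR = draws (λ {u} {v} a → to (Equivalence.to (edgeSet u v) (Equivalence.from T-≡ a)))
        λ { {u} {v} (inj₁ e∈) → Equivalence.to T-≡ (Equivalence.from (edgeSet u v) (Any.map inj₁ (∈-concatMap⁻ cyclicPairs {xs = cs} e∈)))
          ; {u} {v} (inj₂ e∈) → Equivalence.to T-≡ (Equivalence.from (edgeSet u v) (Any.map inj₂ (∈-concatMap⁻ cyclicPairs {xs = cs} e∈))) }
        where
        to : ∀ {u v} → Any (OnCycle u v) cs → (u , v) ∈ R ⊎ (v , u) ∈ R
        to a with c , c∈ , o ← find a with o
        ... | inj₁ e∈ = inj₁ (∈-concatMap⁺ cyclicPairs (lose c∈ e∈))
        ... | inj₂ e∈ = inj₂ (∈-concatMap⁺ cyclicPairs (lose c∈ e∈))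
      transfer : ∀ {A B} → Draws H A → Draws H B → ∀ {e} → e ∈ map norm A → e ∈ map norm B
      transfer {A} {B} dA dB e∈ with (u , v) , f∈ , refl ← ∈-map⁻ norm e∈ with drawn dB (edge dA (inj₁ f∈))
      ... | inj₁ g∈ = ∈-map⁺ norm g∈
      ... | inj₂ g∈ = subst (_∈ map norm B) (norm-swap v u) (∈-map⁺ norm g∈)
      C-unique : Unique (map norm C)
      C-unique = subs-unique norm E (filterᵇ∈subs (λ (u , v) → adj H u v) E) (once lists)
      -- `C` has the order and directions of `E`, while `R` runs along the cycles; only the
      -- normalised lists are permutations of each other.
      C↭R : map norm C ↭ map norm R
      C↭R = unique⇒↭ (unique-norm R (subst Unique (sym (tails-concat cs)) cs-unique) (cycles-antisym longs cs-unique)) C-unique (transfer drawsR drawsC) (transfer drawsC drawsR)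
      deg : ∀ v → degree H v ≡ inc C v
      deg = degree≡inc (simple C-unique λ x∈ → contradiction (trans (sym (edge drawsC (inj₁ x∈))) (irrefl H _)) λ ()) drawsC
      total : ℓ + isolated C π ≡ n
      total = trans (cong (_+ isolated C π) (sym cov)) (covered+isolated {H} {C} deg (λ v → Sum.map (trans (sym (deg v))) (trans (sym (deg v))) (degrees v)))

-- The list of edges along a vertex order.

module EdgeLists {n : ℕ} (G : Graph n) where
  open EdgeOrder (adj G)
  open CycleCovers {n}

  private
    mark : Fin n → (Fin n → Bool) → Fin n → Bool
    mark v δ u = if does (v ≟ᶠ u) then true else δ u

    new : Fin n → (Fin n → Bool) → List (Fin n)
    new v δ = filterᵇ (λ u → adj G u v ∧ δ u) (allFin n)

    mark-self : ∀ v δ → mark v δ v ≡ true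
    mark-self v δ with v ≟ᶠ v
    ... | yes _ = refl
    ... | no ne = contradiction refl ne

    mark-keep : ∀ v δ {u} → δ u ≡ true → mark v δ u ≡ true
    mark-keep v δ {u} e with v ≟ᶠ u
    ... | yes _ = refl
    ... | no _  = e

    ∈-new : ∀ v δ {u} → u ∈ new v δ → adj G u v ≡ true × δ u ≡ true
    ∈-new v δ {u} u∈ = ∧-true {adj G u v} (proj₂ (∈-filterᵇ⁻ (λ u → adj G u v ∧ δ u) {allFin n} u∈))

    new-∈ : ∀ v δ {u} → adj G u v ≡ true → δ u ≡ true → u ∈ new v δ
    new-∈ v δ {u} a d = ∈-filterᵇ⁺ (λ u → adj G u v ∧ δ u) (∈-allFin u) (cong₂ _∧_ a d)

    ∈-edges : ∀ δ π {u v} → (u , v) ∈ edgesFrom δ π → adj G u v ≡ true × v ∈ π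
    ∈-edges δ (w ∷ π) e∈ with ∈-++⁻ (map (_, w) (new w δ)) e∈
    ... | inj₁ p with u , u∈ , refl ← ∈-map⁻ (_, w) p = proj₁ (∈-new w δ u∈) , here refl
    ... | inj₂ p with a , v∈ ← ∈-edges (mark w δ) π p = a , there v∈

    late : ∀ δ π {u v} → adj G u v ≡ true → δ u ≡ true → v ∈ π → (u , v) ∈ edgesFrom δ π
    late δ (w ∷ π) a d (here refl) = ∈-++⁺ˡ (∈-map⁺ (_, w) (new-∈ w δ a d))
    late δ (w ∷ π) a d (there v∈)  = ∈-++⁺ʳ (map (_, w) (new w δ)) (late (mark w δ) π a (mark-keep w δ d) v∈)

    both : ∀ δ π {u v} → adj G u v ≡ true → u ∈ π → v ∈ π → (u , v) ∈ edgesFrom δ π ⊎ (v , u) ∈ edgesFrom δ π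
    both δ (w ∷ π) {u} {v} a (here refl) (here refl) = contradiction (trans (sym a) (irrefl G u)) λ ()
    both δ (w ∷ π) {u} {v} a (here refl) (there v∈)  = inj₁ (∈-++⁺ʳ (map (_, w) (new w δ)) (late (mark w δ) π a (mark-self w δ) v∈))
    both δ (w ∷ π) {u} {v} a (there u∈)  (here refl) = inj₂ (∈-++⁺ʳ (map (_, w) (new w δ)) (late (mark w δ) π (trans (adj-sym G v u) a) (mark-self w δ) u∈))
    both δ (w ∷ π) a (there u∈) (there v∈) = Sum.map (∈-++⁺ʳ (map (_, w) (new w δ))) (∈-++⁺ʳ (map (_, w) (new w δ))) (both (mark w δ) π a u∈ v∈)

    block-unique : ∀ w {us} → Unique us → Unique (map norm (map (_, w) us))
    block-unique w [] = []
    block-unique w {u ∷ us} (u∉ ∷ un) = All.tabulate (λ y∈ eq → clash y∈ eq) ∷ block-unique w un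
      where
      clash : ∀ {y} → y ∈ map norm (map (_, w) us) → norm (u , w) ≢ y
      clash y∈ eq with e , e∈ , refl ← ∈-map⁻ norm y∈ with u′ , u′∈ , refl ← ∈-map⁻ (_, w) e∈ with norm-injective (u , w) (u′ , w) eq
      ... | inj₁ refl = All.lookup u∉ u′∈ refl
      ... | inj₂ refl = All.lookup u∉ u′∈ refl

    edges-unique : ∀ δ {π} → Unique π → (∀ v → v ∈ π → δ v ≡ false) → Unique (map norm (edgesFrom δ π))
    edges-unique δ {[]} u fresh = []
    edges-unique δ {w ∷ π} (w∉ ∷ u) fresh = subst Unique (sym (map-++ norm (map (_, w) (new w δ)) _))
      (unique-++⁺ (block-unique w (filterᵇ-unique _ (allFin⁺ n))) (edges-unique (mark w δ) u fresh′) λ (p , q) → clash p q)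
      where
      fresh′ : ∀ v → v ∈ π → mark w δ v ≡ false
      fresh′ v v∈ with w ≟ᶠ v
      ... | yes refl = contradiction refl (All.lookup w∉ v∈)
      ... | no _ = fresh v (there v∈)
      clash : ∀ {y} → y ∈ map norm (map (_, w) (new w δ)) → y ∉ map norm (edgesFrom (mark w δ) π)
      clash p q with e , e∈ , refl ← ∈-map⁻ norm p with x , x∈ , refl ← ∈-map⁻ (_, w) e∈ with (x′ , w′) , f∈ , eq ← ∈-map⁻ norm q with norm-injective (x , w) (x′ , w′) eq
      ... | inj₁ refl = All.lookup w∉ (proj₂ (∈-edges (mark w δ) π f∈)) refl
      ... | inj₂ refl = contradiction (trans (sym (proj₂ (∈-new w δ x∈))) (fresh x (there (proj₂ (∈-edges (mark w δ) π f∈))))) λ ()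

  edges-lists : ∀ {π} → Unique π → (∀ v → v ∈ π) → Lists G (edgesFrom (λ _ → false) π)
  edges-lists {π} u complete = record
    { listed = λ e∈ → proj₁ (∈-edges (λ _ → false) π e∈)
    ; covers = λ {u} {v} a → both (λ _ → false) π a (complete u) (complete v)
    ; once   = edges-unique (λ _ → false) u (λ _ _ → refl) }

  length-edges : ∀ δ π → length (edgesFrom δ π) ≤ length π * n
  length-edges δ []      = z≤n
  length-edges δ (w ∷ π) = ≤-trans (≤-reflexive (trans (length-++ (map (_, w) (new w δ))) (cong (_+ length (edgesFrom (mark w δ) π)) (length-map (_, w) (new w δ)))))
    (+-mono-≤ (≤-trans (length-filter _ (allFin n)) (≤-reflexive (length-tabulate {n = n} id))) (length-edges (mark w δ) π))

-- Memory and states.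

read-write-≡ : ∀ m a v → read (write m a v) a ≡ v
read-write-≡ []      zero    v = refl
read-write-≡ []      (suc a) v = read-write-≡ [] a v
read-write-≡ (x ∷ m) zero    v = refl
read-write-≡ (x ∷ m) (suc a) v = read-write-≡ m a v

read-write-≢ : ∀ m {a a′} v → a ≢ a′ → read (write m a v) a′ ≡ read m a′
read-write-≢ []      {zero}  {zero}   v ne = contradiction refl ne
read-write-≢ []      {zero}  {suc a′} v ne = refl
read-write-≢ []      {suc a} {zero}   v ne = refl
read-write-≢ []      {suc a} {suc a′} v ne = read-write-≢ [] v (ne ∘ cong suc)
read-write-≢ (x ∷ m) {zero}  {zero}   v ne = contradiction refl ne
read-write-≢ (x ∷ m) {zero}  {suc a′} v ne = refl
read-write-≢ (x ∷ m) {suc a} {zero}   v ne = refl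
read-write-≢ (x ∷ m) {suc a} {suc a′} v ne = read-write-≢ m v (ne ∘ cong suc)

length-write : ∀ m a v {l} → length m ≤ l → a < l → length (write m a v) ≤ l
length-write []      zero    v p       q       = q
length-write []      (suc a) v p       (s≤s q) = s≤s (length-write [] a v z≤n q)
length-write (x ∷ m) zero    v p       q       = p
length-write (x ∷ m) (suc a) v (s≤s p) (s≤s q) = s≤s (length-write m a v p q)

All-write : ∀ {V} m a v → All (_≤ V) m → v ≤ V → All (_≤ V) (write m a v)
All-write []      zero    v ps       q = q ∷ []
All-write []      (suc a) v ps       q = z≤n ∷ All-write [] a v [] q
All-write (x ∷ m) zero    v (p ∷ ps) q = q ∷ ps
All-write (x ∷ m) (suc a) v (p ∷ ps) q = p ∷ All-write m a v ps q

memoryBits-≤ : ∀ B m → All (_≤ 2 ^ B) m → memoryBits m ≤ length m * (2 + B)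
memoryBits-≤ B []      []       = z≤n
memoryBits-≤ B (x ∷ m) (p ∷ ps) = +-mono-≤ (s≤s log≤) (memoryBits-≤ B m ps)
  where
  log≤ : ⌈log₂ suc x ⌉ ≤ suc B
  log≤ = ≤-trans
    (⌈log₂⌉-mono-≤ (≤-trans (s≤s p) (≤-trans (+-monoˡ-≤ (2 ^ B) (m^n>0 2 B)) (+-monoʳ-≤ (2 ^ B) (m≤m+n (2 ^ B) 0)))))
    (≤-reflexive (⌈log₂2^n⌉≡n (suc B)))

-- Nested pairs, accessed by projections only: an update at a literal position computes even on an
-- abstract state, so consecutive commands fit together definitionally.
Tup : Set → ℕ → Set
Tup A zero    = ⊤
Tup A (suc k) = A × Tup A k

getᵗ : ∀ {A k} → Tup A k → Fin k → A
getᵗ s zero    = proj₁ s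
getᵗ s (suc x) = getᵗ (proj₂ s) x

setᵗ : ∀ {A k} → Fin k → A → Tup A k → Tup A k
setᵗ zero    v s = v , proj₂ s
setᵗ (suc x) v s = proj₁ s , setᵗ x v (proj₂ s)

getᵗ-setᵗ-≡ : ∀ {A k} x (v : A) (s : Tup A k) → getᵗ (setᵗ x v s) x ≡ v
getᵗ-setᵗ-≡ zero    v s = refl
getᵗ-setᵗ-≡ (suc x) v s = getᵗ-setᵗ-≡ x v (proj₂ s)

getᵗ-setᵗ-≢ : ∀ {A k} {x y} (v : A) (s : Tup A k) → x ≢ y → getᵗ (setᵗ x v s) y ≡ getᵗ s y
getᵗ-setᵗ-≢ {x = zero}  {zero}  v s ne = contradiction refl ne
getᵗ-setᵗ-≢ {x = zero}  {suc y} v s ne = refl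
getᵗ-setᵗ-≢ {x = suc x} {zero}  v s ne = refl
getᵗ-setᵗ-≢ {x = suc x} {suc y} v s ne = getᵗ-setᵗ-≢ v (proj₂ s) (ne ∘ cong suc)

upd : (ℕ → ℕ) → ℕ → ℕ → ℕ → ℕ
upd f i v j = if i ≡ᵇ j then v else f j

≡ᵇ-refl : ∀ i → (i ≡ᵇ i) ≡ true
≡ᵇ-refl zero    = refl
≡ᵇ-refl (suc i) = ≡ᵇ-refl i

≡ᵇ-≢ : ∀ {i j} → i ≢ j → (i ≡ᵇ j) ≡ false
≡ᵇ-≢ {zero}  {zero}  ne = contradiction refl ne
≡ᵇ-≢ {zero}  {suc j} ne = refl
≡ᵇ-≢ {suc i} {zero}  ne = refl
≡ᵇ-≢ {suc i} {suc j} ne = ≡ᵇ-≢ (ne ∘ cong suc)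

upd-≡ : ∀ f i v → upd f i v i ≡ v
upd-≡ f i v rewrite ≡ᵇ-refl i = refl

upd-≢ : ∀ f {i j} v → i ≢ j → upd f i v j ≡ f j
upd-≢ f v ne rewrite ≡ᵇ-≢ ne = refl

Var Arr : Set
Var = Fin 18
Arr = Fin 7

State : Set
State = Tup ℕ 18 × Tup (ℕ → ℕ) 7

setv : Var → ℕ → State → State
setv x v (s , a) = setᵗ x v s , a

seta : Arr → ℕ → ℕ → State → State
seta x i v (s , a) = s , setᵗ x (upd (getᵗ a x) i v) a

-- Scalar x lives in cell 8x and entry i of array a in cell 8i + 1 + a, so that
-- all arrays are unbounded and addresses need no multiplication.
oct : ℕ → ℕ
oct i = ((i + i) + (i + i)) + ((i + i) + (i + i))

oct≡ : ∀ i → oct i ≡ i * 8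
oct≡ i = eq i
  where
  eq : ∀ i → ((i + i) + (i + i)) + ((i + i) + (i + i)) ≡ i * 8
  eq = solve-∀

oct-injective : ∀ i i′ {j j′} → j < 8 → j′ < 8 → oct i + j ≡ oct i′ + j′ → i ≡ i′ × j ≡ j′
oct-injective i i′ {j} {j′} j<8 j′<8 eq = *-cancelʳ-≡ i i′ 8 (+-cancelʳ-≡ j (i * 8) (i′ * 8) eq′) , j≡
  where
  eq″ : j + i * 8 ≡ j′ + i′ * 8
  eq″ = trans (+-comm j (i * 8)) (trans (cong (_+ j) (sym (oct≡ i))) (trans eq (trans (cong (_+ j′) (oct≡ i′)) (+-comm (i′ * 8) j′))))
  j≡ : j ≡ j′
  j≡ = trans (sym (m<n⇒m%n≡m j<8)) (trans (sym ([m+kn]%n≡m%n j i 8)) (trans (cong (_% 8) eq″) (trans ([m+kn]%n≡m%n j′ i′ 8) (m<n⇒m%n≡m j′<8))))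
  eq′ : i * 8 + j ≡ i′ * 8 + j
  eq′ = trans (+-comm (i * 8) j) (trans eq″ (trans (cong (_+ i′ * 8) (sym j≡)) (+-comm j (i′ * 8))))

-- A command language, its compilation, and bounds on time and space.

infixl 6 _⊞_ _⊟_
data AExpr : Set where
  ‵     : ℕ → AExpr
  input : AExpr → AExpr
  $     : Var → AExpr
  _!_   : Arr → AExpr → AExpr
  _⊞_ _⊟_ : AExpr → AExpr → AExpr

times8 : Expr → Expr
times8 e = ((e ⊕ e) ⊕ (e ⊕ e)) ⊕ ((e ⊕ e) ⊕ (e ⊕ e))

cell : Arr → Expr → Expr
cell a e = times8 e ⊕ lit (suc (toℕ a))

⌜_⌝ : AExpr → Expr
⌜ ‵ x ⌝ = lit x
⌜ input e ⌝ = inp ⌜ e ⌝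
⌜ $ x ⌝ = mem (lit (oct (toℕ x)))
⌜ a ! e ⌝ = mem (cell a ⌜ e ⌝)
⌜ e ⊞ f ⌝ = ⌜ e ⌝ ⊕ ⌜ f ⌝
⌜ e ⊟ f ⌝ = ⌜ e ⌝ ⊖ ⌜ f ⌝

infix  5 _:=_ _[_]:=_
infixr 4 _⨟_
data Cmd : Set where
  nop     : Cmd
  _:=_    : Var → AExpr → Cmd
  _[_]:=_ : Arr → AExpr → AExpr → Cmd
  toss    : Var → Cmd
  _⨟_     : Cmd → Cmd → Cmd
  If      : AExpr → Cmd → Cmd → Cmd
  While   : AExpr → Cmd → Cmd

compile : Cmd → Program
compile nop = skip
compile (x := e) = lit (oct (toℕ x)) ≔ ⌜ e ⌝
compile (a [ i ]:= e) = cell a ⌜ i ⌝ ≔ ⌜ e ⌝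
compile (toss x) = flip (lit (oct (toℕ x)))
compile (c ⨟ d) = compile c ⨾ compile d
compile (If e c d) = cond ⌜ e ⌝ (compile c) (compile d)
compile (While e c) = while ⌜ e ⌝ (compile c)

κ : AExpr → ℕ
κ e = cost ⌜ e ⌝

-- An upper bound for the running time when no loop is iterated more than N times.
tm : ℕ → Cmd → ℕ
tm N nop           = 1
tm N (x := e)      = 2 + κ e
tm N (a [ i ]:= e) = suc (cost (cell a ⌜ i ⌝) + κ e)
tm N (toss x)      = 2
tm N (c ⨟ d)       = tm N c + tm N d
tm N (If e c d)    = suc (κ e + (tm N c + tm N d))
tm N (While e c)   = N * suc (κ e + tm N c) + suc (κ e)

n<2^n : ∀ m → m < 2 ^ m
n<2^n zero    = s≤s z≤n
n<2^n (suc m) = ≤-trans (s≤s (n<2^n m)) (subst (suc (2 ^ m) ≤_) (cong (2 ^ m +_) (sym (+-identityʳ _))) (+-monoˡ-≤ (2 ^ m) (m^n>0 2 m)))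

bit≤1 : ∀ b → bit b ≤ 1
bit≤1 true  = s≤s z≤n
bit≤1 false = z≤n

module Machine (inputs : List ℕ) (I B N : ℕ) (17≤I : 17 ≤ I) where
  open Semantics inputs

  -- Stored values are kept at most `2 ^ B` and written array indices at most `I`. These two
  -- invariants alone give the space bound `SB`; `17≤I` makes room for the 18 scalars.
  V : ℕ
  V = 2 ^ B

  V≥ : ∀ {x} → x ≤ B → x ≤ V
  V≥ p = ≤-trans p (<⇒≤ (n<2^n B))

  ev : AExpr → State → ℕ
  ev (‵ x) st = x
  ev (input e) st = read inputs (ev e st)
  ev ($ x) st = getᵗ (proj₁ st) x
  ev (a ! e) st = getᵗ (proj₂ st) a (ev e st)
  ev (e ⊞ f) st = ev e st + ev f st
  ev (e ⊟ f) st = ev e st ∸ ev f st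

  infix 4 _≈_
  -- Arrays are functions: after an entry has been overwritten and restored, the old array is
  -- recovered only pointwise.
  _≈_ : State → State → Set
  (s , a) ≈ (s′ , a′) = s ≡ s′ × (∀ x i → getᵗ a x i ≡ getᵗ a′ x i)

  record Rep (m : Memory) (st : State) : Set where
    constructor rep
    field
      scalar : ∀ x → read m (oct (toℕ x)) ≡ getᵗ (proj₁ st) x
      array  : ∀ a i → read m (oct i + suc (toℕ a)) ≡ getᵗ (proj₂ st) a i
      short  : length m ≤ oct I + 8
      small  : All (_≤ V) m
  open Rep

  Rep-≈ : ∀ {m st st′} → st ≈ st′ → Rep m st → Rep m st′
  Rep-≈ (refl , eq) r = rep (scalar r) (λ a i → trans (array r a i) (eq a i)) (short r) (small r)

  eval-⌜⌝ : ∀ {m st} → Rep m st → ∀ e → eval m ⌜ e ⌝ ≡ ev e st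
  eval-⌜⌝ r (‵ x) = refl
  eval-⌜⌝ r (input e) = cong (read inputs) (eval-⌜⌝ r e)
  eval-⌜⌝ r ($ x) = scalar r x
  eval-⌜⌝ {m} r (a ! e) = trans (cong (λ z → read m (oct z + suc (toℕ a))) (eval-⌜⌝ r e)) (array r a _)
  eval-⌜⌝ r (e ⊞ f) = cong₂ _+_ (eval-⌜⌝ r e) (eval-⌜⌝ r f)
  eval-⌜⌝ r (e ⊟ f) = cong₂ _∸_ (eval-⌜⌝ r e) (eval-⌜⌝ r f)

  oct-mono : ∀ {i j} → i ≤ j → oct i ≤ oct j
  oct-mono {i} {j} p = subst₂ _≤_ (sym (oct≡ i)) (sym (oct≡ j)) (*-monoˡ-≤ 8 p)

  Rep-setv : ∀ {m st} x v → Rep m st → v ≤ V → Rep (write m (oct (toℕ x)) v) (setv x v st)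
  Rep-setv {m} {s , a} x v r p = rep sc arr
    (length-write m _ v (short r) (≤-<-trans (oct-mono (≤-trans (s≤s⁻¹ (toℕ<n x)) 17≤I)) (m<m+n (oct I) (s≤s z≤n))))
    (All-write m _ v (small r) p)
    where
    oct-≢ : ∀ {y} → x ≢ y → oct (toℕ x) ≢ oct (toℕ y)
    oct-≢ {y} ne eq = ne (toℕ-injective (proj₁ (oct-injective (toℕ x) (toℕ y) {0} {0} (s≤s z≤n) (s≤s z≤n)
      (trans (+-identityʳ _) (trans eq (sym (+-identityʳ _)))))))
    sc : ∀ y → read (write m (oct (toℕ x)) v) (oct (toℕ y)) ≡ getᵗ (setᵗ x v s) y
    sc y with x ≟ᶠ y
    ... | yes refl = trans (read-write-≡ m _ v) (sym (getᵗ-setᵗ-≡ x v s))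
    ... | no ne = trans (read-write-≢ m v (oct-≢ ne)) (trans (scalar r y) (sym (getᵗ-setᵗ-≢ v s ne)))
    arr : ∀ b i → read (write m (oct (toℕ x)) v) (oct i + suc (toℕ b)) ≡ getᵗ a b i
    arr b i = trans (read-write-≢ m v λ eq → contradiction
      (proj₂ (oct-injective (toℕ x) i {0} (s≤s z≤n) (s≤s (toℕ<n b)) (trans (+-identityʳ _) eq))) λ ()) (array r b i)

  Rep-seta : ∀ {m st} x i v → Rep m st → i ≤ I → v ≤ V → Rep (write m (oct i + suc (toℕ x)) v) (seta x i v st)
  Rep-seta {m} {s , a} x i v r i≤I p = rep sc arr
    (length-write m _ v (short r) (+-mono-≤-< (oct-mono i≤I) (s≤s (toℕ<n x))))
    (All-write m _ v (small r) p)
    where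
    sc : ∀ y → read (write m (oct i + suc (toℕ x)) v) (oct (toℕ y)) ≡ getᵗ s y
    sc y = trans (read-write-≢ m v λ eq → contradiction
      (proj₂ (oct-injective i (toℕ y) {_} {0} (s≤s (toℕ<n x)) (s≤s z≤n) (trans eq (sym (+-identityʳ _))))) λ ()) (scalar r y)
    arr : ∀ b j → read (write m (oct i + suc (toℕ x)) v) (oct j + suc (toℕ b)) ≡ getᵗ (setᵗ x (upd (getᵗ a x) i v) a) b j
    arr b j with x ≟ᶠ b
    ... | no ne = trans (read-write-≢ m v λ eq → ne (toℕ-injective (suc-injective
                    (proj₂ (oct-injective i j (s≤s (toℕ<n x)) (s≤s (toℕ<n b)) eq)))))
                  (trans (array r b j) (cong (λ f → f j) (sym (getᵗ-setᵗ-≢ {y = b} (upd (getᵗ a x) i v) a ne))))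
    ... | yes refl with i ≟ j
    ...   | yes refl = trans (read-write-≡ m _ v) (sym (trans (cong (λ f → f i) (getᵗ-setᵗ-≡ x (upd (getᵗ a x) i v) a)) (upd-≡ (getᵗ a x) i v)))
    ...   | no ne = trans (read-write-≢ m v λ eq → ne
                    (proj₁ (oct-injective i j (s≤s (toℕ<n x)) (s≤s (toℕ<n x)) eq)))
                  (trans (array r x j) (sym (trans (cong (λ f → f j) (getᵗ-setᵗ-≡ x (upd (getᵗ a x) i v) a)) (upd-≢ (getᵗ a x) v ne))))

  SB : ℕ
  SB = (oct I + 8) * (2 + B)

  bits≤ : ∀ {m st} → Rep m st → memoryBits m ≤ SB
  bits≤ {m} r = ≤-trans (memoryBits-≤ B m (small r)) (*-monoˡ-≤ (2 + B) (short r))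

  record Ex (c : Cmd) (st : State) (ρ : List Bool) (st′ : State) (ρ′ : List Bool) (t : ℕ) : Set where
    constructor ex
    field
      run : ∀ {m} → Rep m st → Σ[ m′ ∈ Memory ] Σ[ t′ ∈ ℕ ] Σ[ s ∈ ℕ ]
            (Exec (compile c) m ρ m′ ρ′ t′ s × t′ ≤ t × s ≤ SB × Rep m′ st′)
  open Ex public

  -- `tm N` is meant for loops of polynomially many rounds. The traversal, whose number of rounds
  -- grows with 4 to the depth, is treated by `Ex` with a time bound of its own.
  Do : Cmd → State → List Bool → State → List Bool → Set
  Do c st ρ st′ ρ′ = Ex c st ρ st′ ρ′ (tm N c)

  within : ∀ {c st st′ ρ ρ′ t t′} → t ≤ t′ → Ex c st ρ st′ ρ′ t → Ex c st ρ st′ ρ′ t′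
  within p f .run r with m , t , s , x , tx , y ← run f r = m , t , s , x , ≤-trans tx p , y

  seqE : ∀ {c d st st′ st″ ρ ρ′ ρ″ t t′} → Ex c st ρ st′ ρ′ t → Ex d st′ ρ′ st″ ρ″ t′ → Ex (c ⨟ d) st ρ st″ ρ″ (t + t′)
  seqE f g .run r with _ , _ , _ , x , tx , sx , r′ ← run f r with _ , _ , _ , y , ty , sy , r″ ← run g r′ =
    _ , _ , _ , seq x y , +-mono-≤ tx ty , ⊔-lub sx sy , r″

  nopE : ∀ {st ρ} → Do nop st ρ st ρ
  nopE .run r = _ , _ , _ , skip , ≤-refl , bits≤ r , r

  asg : ∀ {x e st ρ} → ev e st ≤ V → Do (x := e) st ρ (setv x (ev e st) st) ρ
  asg {x} {e} {st} p .run {m} r =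
    write m (oct (toℕ x)) (eval m ⌜ e ⌝) , suc (1 + κ e) , memoryBits m ⊔ memoryBits (write m (oct (toℕ x)) (eval m ⌜ e ⌝)) ,
    assign , ≤-refl , ⊔-lub (bits≤ r) (bits≤ q) , q
    where
    q : Rep (write m (oct (toℕ x)) (eval m ⌜ e ⌝)) (setv x (ev e st) st)
    q rewrite eval-⌜⌝ r e = Rep-setv x (ev e st) r p

  asa : ∀ {x i e st ρ} → ev i st ≤ I → ev e st ≤ V →
        Do (x [ i ]:= e) st ρ (seta x (ev i st) (ev e st) st) ρ
  asa {x} {i} {e} {st} pi p .run {m} r =
    m′ , suc (cost (cell x ⌜ i ⌝) + κ e) , memoryBits m ⊔ memoryBits m′ ,
    assign , ≤-refl , ⊔-lub (bits≤ r) (bits≤ q) , q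
    where
    m′ : Memory
    m′ = write m (oct (eval m ⌜ i ⌝) + suc (toℕ x)) (eval m ⌜ e ⌝)
    q : Rep m′ (seta x (ev i st) (ev e st) st)
    q rewrite eval-⌜⌝ r i | eval-⌜⌝ r e = Rep-seta x (ev i st) (ev e st) r pi p

  tossE : ∀ {x st b ρ} → Do (toss x) st (b ∷ ρ) (setv x (bit b) st) ρ
  tossE {x} {st} {b} .run {m} r =
    write m (oct (toℕ x)) (bit b) , 2 , memoryBits m ⊔ memoryBits (write m (oct (toℕ x)) (bit b)) ,
    flip , ≤-refl , ⊔-lub (bits≤ r) (bits≤ q) , q
    where
    q : Rep (write m (oct (toℕ x)) (bit b)) (setv x (bit b) st)
    q = Rep-setv x (bit b) r (≤-trans (bit≤1 b) (m^n>0 2 B))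

  infixr 4 _▸_
  _▸_ : ∀ {c d st st′ st″ ρ ρ′ ρ″} → Do c st ρ st′ ρ′ → Do d st′ ρ′ st″ ρ″ → Do (c ⨟ d) st ρ st″ ρ″
  f ▸ g = seqE f g

  ifT : ∀ {e c d st st′ ρ ρ′} → ev e st ≢ 0 → Do c st ρ st′ ρ′ → Do (If e c d) st ρ st′ ρ′
  ifT {e} {c} {d} ne f .run r with _ , _ , _ , x , tx , sx , r′ ← run f r =
    _ , _ , _ , then (ne ∘ trans (sym (eval-⌜⌝ r e))) x , s≤s (+-monoʳ-≤ (κ e) (≤-trans tx (m≤m+n (tm N c) (tm N d)))) , sx , r′

  ifF : ∀ {e c d st st′ ρ ρ′} → ev e st ≡ 0 → Do d st ρ st′ ρ′ → Do (If e c d) st ρ st′ ρ′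
  ifF {e} {c} {d} eq f .run r with _ , _ , _ , x , tx , sx , r′ ← run f r =
    _ , _ , _ , else (trans (eval-⌜⌝ r e) eq) x , s≤s (+-monoʳ-≤ (κ e) (≤-trans tx (m≤n+m (tm N d) (tm N c)))) , sx , r′

  loopE : ∀ {e c st st′ st″ ρ ρ′ ρ″ t t′} → ev e st ≢ 0 → Ex c st ρ st′ ρ′ t →
          Ex (While e c) st′ ρ′ st″ ρ″ t′ → Ex (While e c) st ρ st″ ρ″ (suc (κ e + t + t′))
  loopE {e} ne f g .run r with _ , _ , _ , x , tx , sx , r′ ← run f r with _ , _ , _ , y , ty , sy , r″ ← run g r′ =
    _ , _ , _ , loop (ne ∘ trans (sym (eval-⌜⌝ r e))) x y , s≤s (+-mono-≤ (+-monoʳ-≤ (κ e) tx) ty) , ⊔-lub sx sy , r″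

  doneE : ∀ {e c st ρ} → ev e st ≡ 0 → Ex (While e c) st ρ st ρ (suc (κ e))
  doneE {e} eq .run r = _ , _ , _ , done (trans (eval-⌜⌝ r e) eq) , ≤-refl , bits≤ r , r

  Loop : ℕ → AExpr → Cmd → State → List Bool → State → List Bool → Set
  Loop k e c st ρ st′ ρ′ = Ex (While e c) st ρ st′ ρ′ (k * suc (κ e + tm N c) + suc (κ e))

  stop : ∀ k {e c st ρ} → ev e st ≡ 0 → Loop k e c st ρ st ρ
  stop k {e} {c} eq = within (m≤n+m (suc (κ e)) (k * suc (κ e + tm N c))) (doneE eq)

  again : ∀ k {e c st st′ st″ ρ ρ′ ρ″} → ev e st ≢ 0 → Do c st ρ st′ ρ′ → Loop k e c st′ ρ′ st″ ρ″ → Loop (suc k) e c st ρ st″ ρ″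
  again k {e} {c} ne f g = within (≤-reflexive (sym (+-assoc (suc (κ e + tm N c)) _ _))) (loopE ne f g)

  loops : ∀ {k e c st st′ ρ ρ′} → k ≤ N → Loop k e c st ρ st′ ρ′ → Do (While e c) st ρ st′ ρ′
  loops {e = e} {c} le = within (+-monoˡ-≤ (suc (κ e)) (*-monoˡ-≤ (suc (κ e + tm N c)) le))

  post : ∀ {c st st′ st″ ρ ρ′ t} → st′ ≈ st″ → Ex c st ρ st′ ρ′ t → Ex c st ρ st″ ρ′ t
  post p f .run r with m , t , s , x , tx , sx , r′ ← run f r = m , t , s , x , tx , sx , Rep-≈ p r′

  pre : ∀ {c st st′ st″ ρ ρ′ t} → st ≈ st″ → Ex c st″ ρ st′ ρ′ t → Ex c st ρ st′ ρ′ t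
  pre p f .run r = run f (Rep-≈ p r)

  post≡ : ∀ {c st st′ st″ ρ ρ′ t} → st′ ≡ st″ → Ex c st ρ st′ ρ′ t → Ex c st ρ st″ ρ′ t
  post≡ refl f = f

  pre≡ : ∀ {c st st′ st″ ρ ρ′ t} → st ≡ st″ → Ex c st″ ρ st′ ρ′ t → Ex c st ρ st′ ρ′ t
  pre≡ refl f = f

  elseE : ∀ {e c d st st′ ρ ρ′ t} → ev e st ≡ 0 → Ex d st ρ st′ ρ′ t → Ex (If e c d) st ρ st′ ρ′ (suc (κ e + t))
  elseE {e} eq f .run r with _ , _ , _ , x , tx , sx , r′ ← run f r =
    _ , _ , _ , else (trans (eval-⌜⌝ r e) eq) x , s≤s (+-monoʳ-≤ (κ e) tx) , sx , r′

-- The traversal of the forest as a single loop.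

vAns vN vNN vb vq vQ vL vBase vCnt vCur vTmp vSh vP vC vW vR vU vF : Var
vAns = # 0
vN = # 1
vNN = # 2
vb = # 3
vq = # 4
vQ = # 5
vL = # 6
vBase = # 7
vCnt = # 8
vCur = # 9
vTmp = # 10
vSh = # 11
vP = # 12
vC = # 13
vW = # 14
vR = # 15
vU = # 16
vF = # 17

aRow aW aX aY aA aT aBit : Arr
aRow = # 0
aW = # 1
aX = # 2
aY = # 3
aA = # 4
aT = # 5
aBit = # 6

-- vP is the node being processed (1 + v for the vertex v, 0 above all roots),
-- vC the next candidate for a child of it, and vCur the accumulated product.
-- aX and aY hold the slots of the vertices on the current path and 0 elsewhere,
-- so LOCAL may simply run over all vertices.
SHIFT MINUS LOOP ADD EDGE LOCAL NEXT LEAVE SCAN FINISH STEP TRAVERSE : Cmd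
SHIFT = vTmp := $ vCur ⨟ While ($ vSh) (vTmp := $ vTmp ⊞ $ vTmp ⨟ vSh := $ vSh ⊟ ‵ 1)
MINUS = vSh := $ vQ ⨟ SHIFT ⨟ vCur := $ vTmp ⊟ $ vCur ⨟ vTmp := ‵ 0
LOOP = vSh := $ vL ⨟ SHIFT ⨟ vCur := $ vCur ⊞ $ vTmp ⨟ vTmp := ‵ 0
ADD = vCur := $ vCur ⊞ $ vTmp
EDGE = vSh := $ vQ ⊞ aW ! (aRow ! $ vU ⊞ ($ vP ⊟ ‵ 1)) ⊞ aW ! (aRow ! ($ vP ⊟ ‵ 1) ⊞ $ vU) ⨟ SHIFT ⨟
  If (aY ! ($ vU ⊞ ‵ 1)) (If (aX ! $ vP) ADD nop) nop ⨟
  If (aY ! $ vP) (If (aX ! ($ vU ⊞ ‵ 1)) ADD nop) nop ⨟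
  vTmp := ‵ 0
LOCAL = If (aX ! $ vP) nop MINUS ⨟ If (aY ! $ vP) nop MINUS ⨟
  If (aX ! $ vP) (If (aY ! $ vP) LOOP nop) nop ⨟
  While ($ vN ⊟ $ vU) (If (input (‵ 3 ⊞ aRow ! $ vU ⊞ ($ vP ⊟ ‵ 1))) EDGE nop ⨟ vU := $ vU ⊞ ‵ 1) ⨟
  vU := ‵ 0
NEXT = vCur := aA ! $ vP ⨟ LOCAL ⨟ vC := ‵ 1
-- The scan of the parent's children resumes right after the vertex that is being left, so no return
-- address has to be stored. The cells of this vertex are reset for its next visit.
LEAVE = vCur := aT ! $ vP ⨟ aT [ $ vP ]:= ‵ 0 ⨟ aA [ $ vP ]:= ‵ 0 ⨟
  vC := $ vP ⊞ ‵ 1 ⨟ vP := input (‵ 3 ⊞ $ vNN ⊞ ($ vP ⊟ ‵ 1))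
-- The condition is the absolute difference between the code of the candidate's parent and the
-- current node: it vanishes iff the candidate is a child.
SCAN = If (input (‵ 3 ⊞ $ vNN ⊞ ($ vC ⊟ ‵ 1)) ⊟ $ vP ⊞ ($ vP ⊟ input (‵ 3 ⊞ $ vNN ⊞ ($ vC ⊟ ‵ 1))))
  (vC := $ vC ⊞ ‵ 1)
  (vP := $ vC ⨟ aA [ $ vP ]:= $ vCur ⨟ NEXT)
-- The states are run through like a two-bit counter with `aX` as the low bit, which is the order of
-- `slots`.
FINISH = aT [ $ vP ]:= aT ! $ vP ⊞ $ vCur ⨟
  If (aX ! $ vP)
    (aX [ $ vP ]:= ‵ 0 ⨟ If (aY ! $ vP) (aY [ $ vP ]:= ‵ 0 ⨟ LEAVE) (aY [ $ vP ]:= ‵ 1 ⨟ NEXT))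
    (aX [ $ vP ]:= ‵ 1 ⨟ NEXT)
STEP = If ($ vN ⊞ ‵ 1 ⊟ $ vC) SCAN FINISH
-- The loop ends above all roots (`vP` is 0) with every candidate scanned (`vC` is n + 1).
TRAVERSE = While ($ vP ⊞ ($ vN ⊞ ‵ 1 ⊟ $ vC)) STEP

guard : AExpr
guard = $ vP ⊞ ($ vN ⊞ ‵ 1 ⊟ $ vC)

stepTime : ℕ → ℕ
stepTime N = suc (κ guard + tm N STEP)

-- us lists the elements i, i + 1, …, n − 1 of Fin n.
data Asc {n : ℕ} : ℕ → List (Fin n) → Set where
  []  : Asc n []
  _∷_ : ∀ {u i us} → toℕ u ≡ i → Asc (suc i) us → Asc i (u ∷ us)

asc-allFin : ∀ n → Asc 0 (allFin n)
asc-allFin n = go n id 0 (λ j → sym (+-identityʳ (toℕ j))) (+-identityʳ n)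
  where
  go : ∀ k (f : Fin k → Fin n) i → (∀ j → toℕ (f j) ≡ toℕ j + i) → k + i ≡ n → Asc i (tabulate f)
  go zero    f i e refl = []
  go (suc k) f i e s    = e zero ∷ go k (f ∘ suc) (suc i) (λ j → trans (e (suc j)) (sym (+-suc (toℕ j) i))) (trans (+-suc k i) s)

code : ∀ {n} → Maybe (Fin n) → ℕ
code = maybe (λ u → suc (toℕ u)) 0

code-injective : ∀ {n} (p p′ : Maybe (Fin n)) → code p ≡ code p′ → p ≡ p′
code-injective (just _) (just _) e = cong just (toℕ-injective (suc-injective e))
code-injective nothing  nothing  e = refl

upd-upd : ∀ f i v w j → upd (upd f i v) i w j ≡ upd f i w j
upd-upd f i v w j with i ≡ᵇ j
... | true  = refl
... | false = refl

upd-self : ∀ f i j → upd f i (f i) j ≡ f j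
upd-self f i j with i ≟ j
... | yes refl = upd-≡ f i (f i)
... | no ne    = upd-≢ f (f i) ne

m∸n+[n∸m]≢0 : ∀ {m n} → m ≢ n → m ∸ n + (n ∸ m) ≢ 0
m∸n+[n∸m]≢0 {m} {n} ne e = ne (≤-antisym (m∸n≡0⇒m≤n (m+n≡0⇒m≡0 (m ∸ n) e)) (m∸n≡0⇒m≤n (m+n≡0⇒n≡0 (m ∸ n) e)))

module Traverse (inputs : List ℕ) (I B N : ℕ) (17≤I : 17 ≤ I) {n : ℕ}
  (adj : Fin n → Fin n → Bool) (par : Fin n → Maybe (Fin n)) (wt : Fin n → Fin n → ℕ)
  (b q cQ cL base : ℕ) (Row W Bit : ℕ → ℕ)
  (Row≡ : ∀ (u : Fin n) → Row (toℕ u) ≡ toℕ u * n) (W≡ : ∀ u v → W (toℕ u * n + toℕ v) ≡ wt u v)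
  (adj≡ : ∀ u v → read inputs (3 + toℕ u * n + toℕ v) ≡ bit (adj u v))
  (par≡ : ∀ v → read inputs (3 + n * n + toℕ v) ≡ code (par v))
  (h : ℕ) (cQ≤h : cQ ≤ h) (cL<h : cL < h) (shift<h : ∀ u v → 2 + (cQ + wt u v + wt v u) ≤ h)
  (h≤B : h ≤ B) (h≤N : h ≤ N) (n<B : suc n < B) (n≤I : n ≤ I) (n≤N : n ≤ N) where

  open Machine inputs I B N 17≤I
  open Weights adj cQ cL wt slots
  open Tree par

  st : (cur tmp sh p c u : ℕ) (X Y A T : ℕ → ℕ) → State
  st cur tmp sh p c u X Y A T =
    (0 , n , n * n , b , q , cQ , cL , base , 0 , cur , tmp , sh , p , c , 0 , 0 , u , 0 , tt) , (Row , W , X , Y , A , T , Bit , tt)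

  module _ {p c u : ℕ} {X Y A T : ℕ → ℕ} {ρ : List Bool} where

    private
      s : ℕ → ℕ → ℕ → State
      s cur tmp sh = st cur tmp sh p c u X Y A T

    shift-loop : ∀ a {cur} t → a ≤ B → t * 2 ^ a ≤ V →
                 Loop a ($ vSh) (vTmp := $ vTmp ⊞ $ vTmp ⨟ vSh := $ vSh ⊟ ‵ 1) (s cur t a) ρ (s cur (t * 2 ^ a) 0) ρ
    shift-loop zero    {cur} t a≤ t≤ = post≡ (cong (λ z → s cur z 0) (sym (*-identityʳ t))) (stop 0 refl)
    shift-loop (suc a) {cur} t a≤ t≤ = again a (λ ()) (asg tt≤ ▸ asg (V≥ (<⇒≤ a≤)))
      (post≡ (cong (λ z → s cur z 0) (sym eq)) (shift-loop a (t + t) (<⇒≤ a≤) (≤-trans (≤-reflexive (sym eq)) t≤)))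
      where
      eq : t * 2 ^ suc a ≡ (t + t) * 2 ^ a
      eq = solve′ t (2 ^ a)
        where
        solve′ : ∀ t p → t * (2 * p) ≡ (t + t) * p
        solve′ = solve-∀
      tt≤ : t + t ≤ V
      tt≤ = ≤-trans (m≤m*n (t + t) (2 ^ a) {{m^n≢0 2 a}}) (≤-trans (≤-reflexive (sym eq)) t≤)

    shiftE : ∀ a {cur} → a ≤ h → cur * 2 ^ a ≤ V → Do SHIFT (s cur 0 a) ρ (s cur (cur * 2 ^ a) 0) ρ
    shiftE a {cur} a≤ le = asg (≤-trans (m≤m*n cur (2 ^ a) {{m^n≢0 2 a}}) le) ▸ loops (≤-trans a≤ h≤N) (shift-loop a cur (≤-trans a≤ h≤B) le)

    minusE : ∀ {cur} → cur * 2 ^ cQ ≤ V → Do MINUS (s cur 0 0) ρ (s (cur * minusOne) 0 0) ρ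
    minusE {cur} le = asg (V≥ (≤-trans cQ≤h h≤B)) ▸ shiftE cQ cQ≤h le ▸ asg (≤-trans (m∸n≤m (cur * 2 ^ cQ) cur) le) ▸
      post≡ (cong (λ z → s z 0 0) (sym (trans (*-distribˡ-∸ cur (2 ^ cQ) 1) (cong (cur * 2 ^ cQ ∸_) (*-identityʳ cur))))) (asg z≤n)

    loopAdd : ∀ {cur} → cur * (1 + 2 ^ cL) ≤ V → Do LOOP (s cur 0 0) ρ (s (cur * (1 + 2 ^ cL)) 0 0) ρ
    loopAdd {cur} le = asg (V≥ (≤-trans (<⇒≤ cL<h) h≤B)) ▸ shiftE cL (<⇒≤ cL<h) (≤-trans (m≤n+m _ cur) le′) ▸ asg le′ ▸
      post≡ (cong (λ z → s z 0 0) (sym (*-suc cur (2 ^ cL)))) (asg z≤n)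
      where
      le′ : cur + cur * 2 ^ cL ≤ V
      le′ = ≤-trans (≤-reflexive (sym (*-suc cur (2 ^ cL)))) le

    guardedAdd : ∀ {e f cur tmp} x y → ev e (s cur tmp 0) ≡ bit x → ev f (s cur tmp 0) ≡ bit y → cur + bit (x ∧ y) * tmp ≤ V →
                 Do (If e (If f ADD nop) nop) (s cur tmp 0) ρ (s (cur + bit (x ∧ y) * tmp) tmp 0) ρ
    guardedAdd {cur = cur} {tmp} true true p q le = ifT (λ e → contradiction (trans (sym p) e) λ ()) (ifT (λ e → contradiction (trans (sym q) e) λ ())
      (post≡ (cong (λ z → s (cur + z) tmp 0) (sym (+-identityʳ tmp))) (asg (subst (λ z → cur + z ≤ V) (+-identityʳ tmp) le))))
    guardedAdd {cur = cur} {tmp} true false p q le = ifT (λ e → contradiction (trans (sym p) e) λ ()) (ifF q (post≡ (cong (λ z → s z tmp 0) (sym (+-identityʳ cur))) nopE))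
    guardedAdd {cur = cur} {tmp} false y p q le = ifF p (post≡ (cong (λ z → s z tmp 0) (sym (+-identityʳ cur))) nopE)

  M : ℕ
  M = 2 ^ h

  module _ (v : Fin n) where

    slotFactor : Bool → ℕ
    slotFactor x = if x then 1 else minusOne

    slotFactor≤ : ∀ x → slotFactor x ≤ M
    slotFactor≤ true  = m^n>0 2 h
    slotFactor≤ false = ≤-trans (m∸n≤m (2 ^ cQ) 1) (^-monoʳ-≤ 2 cQ≤h)

    loopFactor : Bool → Bool → ℕ
    loopFactor x y = if x ∧ y then 1 + 2 ^ cL else 1

    loop≤ : 1 + 2 ^ cL ≤ M
    loop≤ = ≤-trans (+-mono-≤ (m^n>0 2 cL) (≤-reflexive (sym (+-identityʳ (2 ^ cL))))) (^-monoʳ-≤ 2 cL<h)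

    loopFactor≤ : ∀ x y → loopFactor x y ≤ M
    loopFactor≤ x y with x ∧ y
    ... | true  = loop≤
    ... | false = m^n>0 2 h

    edgeFactor≤ : ∀ u s t → edgeFactor u v s t ≤ 2 ^ h
    edgeFactor≤ u s t = begin
        1 + arcs s t * 2 ^ shift u v
      ≤⟨ +-mono-≤ (m^n>0 2 (shift u v)) (*-monoˡ-≤ (2 ^ shift u v) (+-mono-≤ (bit≤1 (proj₂ s ∧ proj₁ t)) (bit≤1 (proj₂ t ∧ proj₁ s)))) ⟩
        2 ^ shift u v + 2 * 2 ^ shift u v
      ≤⟨ +-monoʳ-≤ (2 ^ shift u v) (m≤n+m _ (2 ^ shift u v)) ⟩
        2 ^ shift u v + (2 ^ shift u v + 2 * 2 ^ shift u v)
      ≡⟨ eq (2 ^ shift u v) ⟩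
        2 ^ (2 + shift u v)
      ≤⟨ ^-monoʳ-≤ 2 (shift<h u v) ⟩
        2 ^ h ∎
      where
      open ≤-Reasoning
      eq : ∀ x → x + (x + 2 * x) ≡ 2 * (2 * x)
      eq = solve-∀

    pairFactor≤ : ∀ u s t → pairFactor u v s t ≤ 2 ^ h
    pairFactor≤ u s t with adj u v
    ... | true  = edgeFactor≤ u s t
    ... | false = m^n>0 2 h

    local-bound : ∀ (σ : Fin n → Slots) acc us → foldl (λ a u → a * pairFactor u v (σ u) (σ v)) acc us ≤ acc * (2 ^ h) ^ length us
    local-bound σ acc []       = ≤-reflexive (sym (*-identityʳ acc))
    local-bound σ acc (u ∷ us) = ≤-trans (local-bound σ _ us) (≤-trans (*-monoˡ-≤ _ (*-monoʳ-≤ acc (pairFactor≤ u (σ u) (σ v)))) (≤-reflexive (*-assoc acc (2 ^ h) _)))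

    vertexFactor≤ : ∀ s → vertexFactor s ≤ M ^ 3
    vertexFactor≤ (x , y) = ≤-trans (*-mono-≤ (*-mono-≤ (slotFactor≤ x) (slotFactor≤ y)) (loopFactor≤ x y)) (≤-reflexive (eq M))
      where
      eq : ∀ m → m * m * m ≡ m * (m * (m * 1))
      eq = solve-∀

    localAcc≤ : ∀ σ acc → localAcc v σ acc ≤ acc * M ^ (3 + n)
    localAcc≤ σ acc = ≤-trans (local-bound σ _ (allFin n)) (≤-trans (*-monoˡ-≤ (M ^ length (allFin n)) (*-monoʳ-≤ acc (vertexFactor≤ (σ v))))
      (≤-reflexive (trans (*-assoc acc (M ^ 3) _) (cong (acc *_) (trans (cong (λ k → M ^ 3 * M ^ k) (length-tabulate {n = n} id)) (sym (^-distribˡ-+-* M 3 n)))))))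

  record Reflects (σ : Fin n → Slots) (X Y : ℕ → ℕ) : Set where
    constructor reflects
    field
      onX : ∀ u → X (suc (toℕ u)) ≡ bit (proj₁ (σ u))
      onY : ∀ u → Y (suc (toℕ u)) ≡ bit (proj₂ (σ u))
  open Reflects

  module _ {c : ℕ} {X Y A T : ℕ → ℕ} {ρ : List Bool} (σ : Fin n → Slots) (ref : Reflects σ X Y) (v : Fin n) where

    private
      s : ℕ → ℕ → State
      s cur u = st cur 0 0 (suc (toℕ v)) c u X Y A T

    edgeE : ∀ u {cur} → cur * 2 ^ h ≤ V → Do EDGE (s cur (toℕ u)) ρ (s (cur * edgeFactor u v (σ u) (σ v)) (toℕ u)) ρ
    edgeE u {cur} le = asg {x = vSh} {e = $ vQ ⊞ aW ! (aRow ! $ vU ⊞ ($ vP ⊟ ‵ 1)) ⊞ aW ! (aRow ! ($ vP ⊟ ‵ 1) ⊞ $ vU)} (V≥ (subst (_≤ B) (sym sh≡) (≤-trans sh≤h h≤B))) ▸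
        pre≡ (cong (λ z → st cur 0 z (suc (toℕ v)) c (toℕ u) X Y A T) sh≡) (shiftE (shift u v) {cur} sh≤h (≤-trans (*-monoʳ-≤ cur (^-monoʳ-≤ 2 sh≤h)) le)) ▸
        guardedAdd (proj₂ (σ u)) (proj₁ (σ v)) (trans (cong Y (+-comm (toℕ u) 1)) (onY ref u)) (onX ref v)
          (≤-trans (m≤m+n _ _) (≤-trans (≤-reflexive eq) fits)) ▸
        guardedAdd (proj₂ (σ v)) (proj₁ (σ u)) (onY ref v) (trans (cong X (+-comm (toℕ u) 1)) (onX ref u))
          (≤-trans (≤-reflexive eq) fits) ▸
        post≡ (cong (λ z → s z (toℕ u)) eq) (asg z≤n)
      where
      sh≡ : cQ + W (Row (toℕ u) + toℕ v) + W (Row (toℕ v) + toℕ u) ≡ shift u v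
      sh≡ = cong₂ (λ x y → cQ + x + y) (trans (cong (λ z → W (z + toℕ v)) (Row≡ u)) (W≡ u v)) (trans (cong (λ z → W (z + toℕ u)) (Row≡ v)) (W≡ v u))
      sh≤h : shift u v ≤ h
      sh≤h = ≤-trans (m≤n+m (shift u v) 2) (shift<h u v)
      x y : ℕ
      x = bit (proj₂ (σ u) ∧ proj₁ (σ v))
      y = bit (proj₂ (σ v) ∧ proj₁ (σ u))
      eq : cur + x * (cur * 2 ^ shift u v) + y * (cur * 2 ^ shift u v) ≡ cur * edgeFactor u v (σ u) (σ v)
      eq = solve′ cur x y (2 ^ shift u v)
        where
        solve′ : ∀ c x y p → c + x * (c * p) + y * (c * p) ≡ c * (1 + (x + y) * p)
        solve′ = solve-∀
      fits : cur * edgeFactor u v (σ u) (σ v) ≤ V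
      fits = ≤-trans (*-monoʳ-≤ cur (edgeFactor≤ v u (σ u) (σ v))) le

    pairE : ∀ u {cur} → cur * 2 ^ h ≤ V →
            Do (If (input (‵ 3 ⊞ aRow ! $ vU ⊞ ($ vP ⊟ ‵ 1))) EDGE nop) (s cur (toℕ u)) ρ (s (cur * pairFactor u v (σ u) (σ v)) (toℕ u)) ρ
    pairE u {cur} le with adj u v in a
    ... | true  = ifT (λ e → contradiction (trans (sym adj1) e) λ ()) (edgeE u le)
      where
      adj1 : read inputs (3 + Row (toℕ u) + toℕ v) ≡ 1
      adj1 = trans (cong (λ z → read inputs (3 + z + toℕ v)) (Row≡ u)) (trans (adj≡ u v) (cong bit a))
    ... | false = ifF (trans (cong (λ z → read inputs (3 + z + toℕ v)) (Row≡ u)) (trans (adj≡ u v) (cong bit a)))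
                    (post≡ (cong (λ z → s z (toℕ u)) (sym (*-identityʳ cur))) nopE)

    pairs-loop : ∀ {i us} → Asc i us → ∀ {cur} → cur * (2 ^ h) ^ length us ≤ V →
                 Loop (length us) ($ vN ⊟ $ vU) (If (input (‵ 3 ⊞ aRow ! $ vU ⊞ ($ vP ⊟ ‵ 1))) EDGE nop ⨟ vU := $ vU ⊞ ‵ 1)
                   (s cur i) ρ (s (foldl (λ a u → a * pairFactor u v (σ u) (σ v)) cur us) n) ρ
    pairs-loop [] le = stop 0 (n∸n≡0 n)
    pairs-loop (_∷_ {u} {us = us} refl a) {cur} le = again (length us) (m>n⇒m∸n≢0 (toℕ<n u))
      (pairE u (≤-trans (*-monoʳ-≤ cur (m≤m*n (2 ^ h) ((2 ^ h) ^ length us) {{m^n≢0 (2 ^ h) (length us) {{m^n≢0 2 h}}}})) le) ▸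
       post≡ (cong (s _) (+-comm (toℕ u) 1)) (asg (V≥ (≤-trans (≤-reflexive (+-comm (toℕ u) 1)) (≤-trans (toℕ<n u) (≤-trans (n≤1+n n) (<⇒≤ n<B)))))))
      (pairs-loop a (≤-trans (*-monoˡ-≤ _ (*-monoʳ-≤ cur (pairFactor≤ v u (σ u) (σ v)))) (≤-trans (≤-reflexive (*-assoc cur (2 ^ h) _)) le)))

    private
      cap : ∀ {x} → x ≤ M → ∀ cur k → cur * M ^ suc k ≤ V → cur * x * M ^ k ≤ V
      cap x≤ cur k le = ≤-trans (*-monoˡ-≤ (M ^ k) (*-monoʳ-≤ cur x≤)) (≤-trans (≤-reflexive (*-assoc cur M (M ^ k))) le)

      head : ∀ cur k → cur * M ^ suc k ≤ V → cur * M ≤ V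
      head cur k = ≤-trans (*-monoʳ-≤ cur (m≤m*n M (M ^ k) {{m^n≢0 M k {{m^n≢0 2 h}}}}))

      slotE : ∀ {e cur} x → ev e (s cur 0) ≡ bit x → cur * M ≤ V → Do (If e nop MINUS) (s cur 0) ρ (s (cur * slotFactor v x) 0) ρ
      slotE {cur = cur} true  p le = ifT (λ e → contradiction (trans (sym p) e) λ ()) (post≡ (cong (λ z → s z 0) (sym (*-identityʳ cur))) nopE)
      slotE {cur = cur} false p le = ifF p (minusE (≤-trans (*-monoʳ-≤ cur (^-monoʳ-≤ 2 cQ≤h)) le))

      loopE′ : ∀ {cur} x y → X (suc (toℕ v)) ≡ bit x → Y (suc (toℕ v)) ≡ bit y → cur * M ≤ V →
               Do (If (aX ! $ vP) (If (aY ! $ vP) LOOP nop) nop) (s cur 0) ρ (s (cur * loopFactor v x y) 0) ρ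
      loopE′ {cur} true true  p q le = ifT (λ e → contradiction (trans (sym p) e) λ ()) (ifT (λ e → contradiction (trans (sym q) e) λ ())
        (loopAdd (≤-trans (*-monoʳ-≤ cur (loop≤ v)) le)))
      loopE′ {cur} true false p q le = ifT (λ e → contradiction (trans (sym p) e) λ ()) (ifF q (post≡ (cong (λ z → s z 0) (sym (*-identityʳ cur))) nopE))
      loopE′ {cur} false y    p q le = ifF p (post≡ (cong (λ z → s z 0) (sym (*-identityʳ cur))) nopE)

    localE : ∀ {acc} → acc * M ^ (3 + n) ≤ V → Do LOCAL (s acc 0) ρ (s (localAcc v σ acc) 0) ρ
    localE {acc} le = slotE x (onX ref v) (head acc (2 + n) le) ▸ slotE y (onY ref v) (head (acc * slotFactor v x) (1 + n) le₁) ▸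
        loopE′ x y (onX ref v) (onY ref v) (head (acc * slotFactor v x * slotFactor v y) n le₂) ▸
        loops (≤-trans (≤-reflexive (length-tabulate {n = n} id)) n≤N) (pre≡ (cong (λ z → s z 0) eq)
          (pairs-loop (asc-allFin n) (subst₂ (λ z k → z * M ^ k ≤ V) eq (sym (length-tabulate {n = n} id)) le₃))) ▸
        asg z≤n
      where
      x y : Bool
      x = proj₁ (σ v)
      y = proj₂ (σ v)
      le₁ : acc * slotFactor v x * M ^ (2 + n) ≤ V
      le₁ = cap (slotFactor≤ v x) acc (2 + n) le
      le₂ : acc * slotFactor v x * slotFactor v y * M ^ (1 + n) ≤ V
      le₂ = cap (slotFactor≤ v y) (acc * slotFactor v x) (1 + n) le₁
      le₃ : acc * slotFactor v x * slotFactor v y * loopFactor v x y * M ^ n ≤ V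
      le₃ = cap (loopFactor≤ v x y) (acc * slotFactor v x * slotFactor v y) n le₂
      eq : acc * slotFactor v x * slotFactor v y * loopFactor v x y ≡ acc * vertexFactor (σ v)
      eq = solve′ acc (slotFactor v x) (slotFactor v y) (loopFactor v x y)
        where
        solve′ : ∀ a x y l → a * x * y * l ≡ a * (x * y * l)
        solve′ = solve-∀

  -- Four states, each multiplying by at most (2 ^ h) ^ (3 + n).
  Φ : ℕ
  Φ = 4 * (2 ^ h) ^ (3 + n)

  mutual
    treeAcc≤ : ∀ f v σ acc → treeAcc f v σ acc ≤ acc * Φ ^ length (sub f v)
    treeAcc≤ zero    v σ acc = ≤-reflexive (sym (*-identityʳ acc))
    treeAcc≤ (suc f) v σ acc = ≤-trans (∑-mono slots λ s _ →
        ≤-trans (forestAcc≤ f (just v) (σ [ v ↦ s ]) (localAcc v (σ [ v ↦ s ]) acc) (allFin n)) (*-monoˡ-≤ (Φ ^ l) (localAcc≤ v (σ [ v ↦ s ]) acc)))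
      (≤-reflexive (trans (∑-const slots (acc * M ^ (3 + n) * Φ ^ l)) (eq acc ((2 ^ h) ^ (3 + n)) (Φ ^ l))))
      where
      l : ℕ
      l = length (forest f (just v) (allFin n))
      eq : ∀ a m p → 4 * (a * m * p) ≡ a * (4 * m * p)
      eq = solve-∀

    forestAcc≤ : ∀ f p σ acc cs → forestAcc f p σ acc cs ≤ acc * Φ ^ length (forest f p cs)
    forestAcc≤ f p σ acc []       = ≤-reflexive (sym (*-identityʳ acc))
    forestAcc≤ f p σ acc (c ∷ cs) with isChild p c
    ... | false = forestAcc≤ f p σ acc cs
    ... | true  = ≤-trans (forestAcc≤ f p σ _ cs) (≤-trans (*-monoˡ-≤ _ (treeAcc≤ f c σ acc))
      (≤-reflexive (trans (*-assoc acc _ _) (cong (acc *_) (trans (sym (^-distribˡ-+-* Φ (length (sub f c)) _)) (cong (Φ ^_) (sym (length-++ (sub f c)))))))))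

  arr≈ : ∀ {cur tmp sh p c u X X′ Y Y′ A A′ T T′} → (∀ i → X i ≡ X′ i) → (∀ i → Y i ≡ Y′ i) → (∀ i → A i ≡ A′ i) → (∀ i → T i ≡ T′ i) →
         st cur tmp sh p c u X Y A T ≈ st cur tmp sh p c u X′ Y′ A′ T′
  arr≈ {X = X} {X′} {Y} {Y′} {A} {A′} {T} {T′} eX eY eA eT = refl , go
    where
    go : ∀ a i → getᵗ {k = 7} (Row , W , X , Y , A , T , Bit , tt) a i ≡ getᵗ {k = 7} (Row , W , X′ , Y′ , A′ , T′ , Bit , tt) a i
    go zero i = refl
    go (suc zero) i = refl
    go (suc (suc zero)) = eX
    go (suc (suc (suc zero))) = eY
    go (suc (suc (suc (suc zero)))) = eA
    go (suc (suc (suc (suc (suc zero))))) = eT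
    go (suc (suc (suc (suc (suc (suc zero)))))) i = refl

  private
    same : ∀ {f : ℕ → ℕ} i → f i ≡ f i
    same i = refl

  cf : (cur p c : ℕ) (X Y A T : ℕ → ℕ) → State
  cf cur p c X Y A T = st cur 0 0 p c 0 X Y A T

  K : ℕ
  K = stepTime N

  mutual
    -- One round enters the vertex; then each of the four states takes the scan of all candidates
    -- for children and one round that finishes the state.
    steps : ℕ → Fin n → ℕ
    steps zero    v = 0
    steps (suc f) v = suc (4 * suc (stepsF f (just v) (allFin n)))

    stepsF : ℕ → Maybe (Fin n) → List (Fin n) → ℕ
    stepsF f p []       = 0
    stepsF f p (c ∷ cs) = (if isChild p c then steps f c else 1) + stepsF f p cs

  mutual
    steps≤ : ∀ f v → steps f v ≤ (n + 2) * 4 ^ f * length (sub f v)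
    steps≤ zero    v = z≤n
    steps≤ (suc f) v = begin
        suc (4 * suc (stepsF f (just v) (allFin n)))
      ≤⟨ s≤s (*-monoʳ-≤ 4 (s≤s (stepsF≤ f (just v) (allFin n)))) ⟩
        suc (4 * suc (length (allFin n) + r * l))
      ≡⟨ cong (λ k → suc (4 * suc (k + r * l))) (length-tabulate {n = n} id) ⟩
        suc (4 * suc (n + r * l))
      -- Adding 3 rounds `1 + 4 * (1 + n)` up to `4 * (n + 2)`; this is the origin of the factor
      -- `n + 2`.
      ≤⟨ m≤m+n _ 3 ⟩
        suc (4 * suc (n + r * l)) + 3
      ≡⟨ eq₁ n (r * l) ⟩
        4 * ((n + 2) * 1) + 4 * (r * l)
      ≤⟨ +-monoˡ-≤ (4 * (r * l)) (*-monoʳ-≤ 4 (*-monoʳ-≤ (n + 2) (m^n>0 4 f))) ⟩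
        4 * r + 4 * (r * l)
      ≡⟨ eq₂ (n + 2) (4 ^ f) l ⟩
        (n + 2) * 4 ^ suc f * suc l ∎
      where
      open ≤-Reasoning
      r l : ℕ
      r = (n + 2) * 4 ^ f
      l = length (forest f (just v) (allFin n))
      eq₁ : ∀ n x → 1 + 4 * (1 + (n + x)) + 3 ≡ 4 * ((n + 2) * 1) + 4 * x
      eq₁ = solve-∀
      eq₂ : ∀ m p l → 4 * (m * p) + 4 * (m * p * l) ≡ m * (4 * p) * (1 + l)
      eq₂ = solve-∀

    stepsF≤ : ∀ f p cs → stepsF f p cs ≤ length cs + (n + 2) * 4 ^ f * length (forest f p cs)
    stepsF≤ f p []       = z≤n
    stepsF≤ f p (c ∷ cs) with isChild p c
    ... | false = s≤s (stepsF≤ f p cs)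
    ... | true  = ≤-trans (+-mono-≤ (steps≤ f c) (stepsF≤ f p cs)) (≤-trans (≤-reflexive (eq ((n + 2) * 4 ^ f) (length (sub f c)) (length cs) (length (forest f p cs))))
        (≤-trans (n≤1+n _) (≤-reflexive (cong (λ k → suc (length cs + (n + 2) * 4 ^ f * k)) (sym (length-++ (sub f c)))))))
      where
      eq : ∀ r a c b → r * a + (c + r * b) ≡ c + r * (a + b)
      eq = solve-∀

  scanned : ∀ {c} → c ≡ suc n → n + 1 ∸ c ≡ 0
  scanned refl = trans (cong (_∸ suc n) (+-comm n 1)) (n∸n≡0 n)

  unscanned : ∀ (u : Fin n) → n + 1 ∸ suc (toℕ u) ≢ 0
  unscanned u e = m>n⇒m∸n≢0 (toℕ<n u) (trans (cong (_∸ suc (toℕ u)) (+-comm 1 n)) e)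

  code≤ : ∀ (p : Maybe (Fin n)) → code p ≤ n
  code≤ nothing  = z≤n
  code≤ (just u) = toℕ<n u

  n+1≤V : ∀ {x} → x ≤ suc n → x ≤ V
  n+1≤V p = V≥ (≤-trans p (<⇒≤ n<B))

  module Visit (X Y A T : ℕ → ℕ) (σ : Fin n → Slots) (ref : Reflects σ X Y) (v : Fin n) (acc : ℕ)
    (acc≤ : acc * M ^ (3 + n) ≤ V) (ρ : List Bool) where

    private
      p : ℕ
      p = suc (toℕ v)
      p≤I : p ≤ I
      p≤I = ≤-trans (toℕ<n v) n≤I
      acc≤V : acc ≤ V
      acc≤V = ≤-trans (m≤m*n acc (M ^ (3 + n)) {{m^n≢0 M (3 + n) {{m^n≢0 2 h}}}}) acc≤

    Xₛ Yₛ : Slots → ℕ → ℕ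
    Xₛ s = upd X p (bit (proj₁ s))
    Yₛ s = upd Y p (bit (proj₂ s))

    -- Inside v, which is in state s and has accumulated tot so far.
    inside : (cur c : ℕ) → Slots → (tot : ℕ) → State
    inside cur c s tot = cf cur p c (Xₛ s) (Yₛ s) (upd A p acc) (upd T p tot)

    refₛ : ∀ s → Reflects (σ [ v ↦ s ]) (Xₛ s) (Yₛ s)
    refₛ s = reflects (λ u → go proj₁ X (onX ref) u) (λ u → go proj₂ Y (onY ref) u)
      where
      go : ∀ (f : Slots → Bool) Z → (∀ u → Z (suc (toℕ u)) ≡ bit (f (σ u))) → ∀ u → upd Z p (bit (f s)) (suc (toℕ u)) ≡ bit (f ((σ [ v ↦ s ]) u))
      go f Z on u with v ≟ᶠ u
      ... | yes refl = upd-≡ Z p (bit (f s))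
      ... | no ne    = trans (upd-≢ Z (bit (f s)) (λ e → ne (toℕ-injective (suc-injective e)))) (on u)

    nextE : ∀ {cur c} s tot → Do NEXT (inside cur c s tot) ρ (inside (localAcc v (σ [ v ↦ s ]) acc) 1 s tot) ρ
    nextE {cur} {c} s tot = post≡ (cong (λ z → inside z c s tot) (upd-≡ A p acc)) (asg (≤-trans (≤-reflexive (upd-≡ A p acc)) acc≤V)) ▸
        localE (σ [ v ↦ s ]) (refₛ s) v acc≤ ▸ asg (m^n>0 2 B)

    -- Cells equal to 0 already encode the state `∅` and the total 0, so entering a vertex stores
    -- nothing but the accumulator.
    enterE : X p ≡ 0 → Y p ≡ 0 → T p ≡ 0 →
             Do STEP (cf acc (code (par v)) p X Y A T) ρ (inside (localAcc v (σ [ v ↦ ∅ ]) acc) 1 ∅ 0) ρ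
    enterE x0 y0 t0 = ifT (unscanned v) (ifF matched (asg (n+1≤V (m≤n⇒m≤1+n (toℕ<n v))) ▸ asa p≤I acc≤V ▸
        pre (arr≈ (clear X x0) (clear Y y0) (same {upd A p acc}) (clear T t0)) (nextE ∅ 0)))
      where
      matched : read inputs (3 + n * n + toℕ v) ∸ code (par v) + (code (par v) ∸ read inputs (3 + n * n + toℕ v)) ≡ 0
      matched = trans (cong (λ z → z ∸ code (par v) + (code (par v) ∸ z)) (par≡ v)) (cong₂ _+_ (n∸n≡0 (code (par v))) (n∸n≡0 (code (par v))))
      clear : ∀ Z → Z p ≡ 0 → ∀ i → Z i ≡ upd Z p 0 i
      clear Z e i = sym (trans (cong (λ z → upd Z p z i) (sym e)) (upd-self Z p i))

    private
      T≤ : ∀ {tot r} → tot + r ≤ V → upd T p tot p + r ≤ V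
      T≤ {tot} {r} = subst (λ z → z + r ≤ V) (sym (upd-≡ T p tot))

      T≈ : ∀ {tot r} i → upd (upd T p tot) p (upd T p tot p + r) i ≡ upd T p (tot + r) i
      T≈ {tot} {r} i = trans (upd-upd T p tot _ i) (cong (λ z → upd T p (z + r) i) (upd-≡ T p tot))

    nextˣE : ∀ {r y tot} → tot + r ≤ V →
             Do STEP (inside r (suc n) (false , y) tot) ρ (inside (localAcc v (σ [ v ↦ (true , y) ]) acc) 1 (true , y) (tot + r)) ρ
    nextˣE {r} {y} {tot} le = ifF (scanned refl) (asa p≤I (T≤ {tot} {r} le) ▸ ifF (upd-≡ X p 0) (asa p≤I (m^n>0 2 B) ▸
      pre (arr≈ (upd-upd X p 0 1) (same {Yₛ (true , y)}) (same {upd A p acc}) (T≈ {tot} {r})) (nextE (true , y) (tot + r))))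

    nextʸE : ∀ {r tot} → tot + r ≤ V →
             Do STEP (inside r (suc n) (true , false) tot) ρ (inside (localAcc v (σ [ v ↦ (false , true) ]) acc) 1 (false , true) (tot + r)) ρ
    nextʸE {r} {tot} le = ifF (scanned refl) (asa p≤I (T≤ {tot} {r} le) ▸ ifT (λ e → contradiction (trans (sym (upd-≡ X p 1)) e) λ ())
      (asa p≤I z≤n ▸ ifF (upd-≡ Y p 0) (asa p≤I (m^n>0 2 B) ▸
      pre (arr≈ (upd-upd X p 1 0) (upd-upd Y p 0 1) (same {upd A p acc}) (T≈ {tot} {r})) (nextE (false , true) (tot + r)))))

    leaveE : X p ≡ 0 → Y p ≡ 0 → A p ≡ 0 → T p ≡ 0 → ∀ {r tot} → tot + r ≤ V →
             Do STEP (inside r (suc n) (true , true) tot) ρ (cf (tot + r) (code (par v)) (suc p) X Y A T) ρ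
    leaveE x0 y0 a0 t0 {r} {tot} le = ifF (scanned refl) (asa p≤I (T≤ {tot} {r} le) ▸ ifT (λ e → contradiction (trans (sym (upd-≡ X p 1)) e) λ ())
      (asa p≤I z≤n ▸ ifT (λ e → contradiction (trans (sym (upd-≡ Y p 1)) e) λ ()) (asa p≤I z≤n ▸
      pre {st″ = cf r p (suc n) X Y (upd A p acc) (upd T p (tot + r))} (arr≈ (restore X x0) (restore Y y0) (same {upd A p acc}) (T≈ {tot} {r}))
      (post≡ (cong (λ z → cf z p (suc n) X Y (upd A p acc) (upd T p (tot + r))) (upd-≡ T p (tot + r))) (asg (subst (_≤ V) (sym (upd-≡ T p (tot + r))) le)) ▸
       asa p≤I z≤n ▸ asa p≤I z≤n ▸
       asg (n+1≤V (≤-trans (≤-reflexive (+-comm p 1)) (s≤s (toℕ<n v)))) ▸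
       post (arr≈ (same {X}) (same {Y}) (restore A a0) (restore T t0))
         (post≡ (cong₂ (λ a b → cf (tot + r) a b X Y (upd (upd A p acc) p 0) (upd (upd T p (tot + r)) p 0)) (par≡ v) (+-comm p 1))
           (asg (subst (_≤ V) (sym (par≡ v)) (n+1≤V (m≤n⇒m≤1+n (code≤ (par v)))))))))))
      where
      restore : ∀ Z → Z p ≡ 0 → ∀ {x} i → upd (upd Z p x) p 0 i ≡ Z i
      restore Z e {x} i = trans (upd-upd Z p x 0 i) (trans (cong (λ z → upd Z p z i) (sym e)) (upd-self Z p i))

  skipE : ∀ {cur q X Y A T ρ} (v : Fin n) → code (par v) ≢ q → Do STEP (cf cur q (suc (toℕ v)) X Y A T) ρ (cf cur q (suc (suc (toℕ v))) X Y A T) ρ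
  skipE {cur} {q} {X} {Y} {A} {T} v ne = ifT (unscanned v) (ifT (λ e → m∸n+[n∸m]≢0 ne (trans (cong (λ z → z ∸ q + (q ∸ z)) (sym (par≡ v))) e))
    (post≡ (cong (λ z → cf cur q z X Y A T) (+-comm (suc (toℕ v)) 1)) (asg (n+1≤V (≤-trans (≤-reflexive (+-comm (suc (toℕ v)) 1)) (s≤s (toℕ<n v)))))))

  -- It is applied to all vertices from a certain level on: only vertices on the current root path
  -- may have nonzero cells.
  record Clear (P : Fin n → Set) (X Y A T : ℕ → ℕ) : Set where
    constructor clear
    field
      clear! : ∀ w → P w → X (suc (toℕ w)) ≡ 0 × Y (suc (toℕ w)) ≡ 0 × A (suc (toℕ w)) ≡ 0 × T (suc (toℕ w)) ≡ 0
  open Clear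

  plevel : (Fin n → ℕ) → Maybe (Fin n) → ℕ
  plevel level = maybe level 0

  module Levels (level : Fin n → ℕ) (τ : ℕ) (level≡ : ∀ v → level v ≡ suc (plevel level (par v))) (level≤ : ∀ v → level v ≤ τ)
    {fin : State} {ρ ρ′ : List Bool} where

    -- The traversal is one flat loop, not a recursive program. Processing a subtree is therefore
    -- expressed by continuations: a run from the state after it extends to a run from the state
    -- before it.
    From : State → ℕ → Set
    From st t = Ex TRAVERSE st ρ fin ρ′ t

    stepW : ∀ {st st′ t} → ev guard st ≢ 0 → Do STEP st ρ st′ ρ → From st′ t → From st (K + t)
    stepW = loopE

    mutual
      visit : ∀ f v σ acc {X Y A T} → level v + f ≡ suc τ → Reflects σ X Y → Clear (λ w → level v ≤ level w) X Y A T →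
              acc * Φ ^ length (sub f v) ≤ V → ∀ {t} →
              From (cf (treeAcc f v σ acc) (code (par v)) (2 + toℕ v) X Y A T) t →
              From (cf acc (code (par v)) (1 + toℕ v) X Y A T) (steps f v * K + t)
      -- Without fuel, `v` would lie on level `suc τ`.
      visit zero v σ acc lv ref cl le = contradiction (subst (_≤ τ) (trans (sym (+-identityʳ _)) lv) (level≤ v)) (<⇒≱ ≤-refl)
      visit (suc f) v σ acc {X} {Y} {A} {T} lv ref cl le {t} k =
        within (≤-reflexive (eq K R t))
        (stepW (λ e → unscanned v (m+n≡0⇒n≡0 (code (par v)) e)) (enterE x0 y0 t0)
        (scan-in ∅ 0 (stepW (λ ()) (nextˣE le₁)
        (scan-in (true , false) (r ∅) (stepW (λ ()) (nextʸE le₂)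
        (scan-in (false , true) (r ∅ + r (true , false)) (stepW (λ ()) (nextˣE le₃)
        (scan-in (true , true) (r ∅ + r (true , false) + r (false , true)) (stepW (λ ()) (leaveE x0 y0 a0 t0 le₄)
        (subst (λ z → From (cf z (code (par v)) (2 + toℕ v) X Y A T) t) total k))))))))))
        where
        l : ℕ
        l = length (forest f (just v) (allFin n))
        m : ℕ
        m = M ^ (3 + n)
        le4 : 4 * (acc * m * Φ ^ l) ≤ V
        le4 = ≤-trans (≤-reflexive (solve′ acc m (Φ ^ l))) le
          where
          solve′ : ∀ a m p → 4 * (a * m * p) ≡ a * (4 * m * p)
          solve′ = solve-∀
        one : acc * m * Φ ^ l ≤ V
        one = ≤-trans (m≤n*m _ 4) le4
        Φ>0 : NonZero (Φ ^ l)
        Φ>0 = m^n≢0 Φ l {{m*n≢0 4 m {{_}} {{m^n≢0 M (3 + n) {{m^n≢0 2 h}}}}}}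
        acc≤ : acc * M ^ (3 + n) ≤ V
        acc≤ = ≤-trans (m≤m*n (acc * m) (Φ ^ l) {{Φ>0}}) one
        open Visit X Y A T σ ref v acc acc≤ ρ
        c0 : X (suc (toℕ v)) ≡ 0 × Y (suc (toℕ v)) ≡ 0 × A (suc (toℕ v)) ≡ 0 × T (suc (toℕ v)) ≡ 0
        c0 = clear! cl v ≤-refl
        x0 : X (suc (toℕ v)) ≡ 0
        x0 = proj₁ c0
        y0 : Y (suc (toℕ v)) ≡ 0
        y0 = proj₁ (proj₂ c0)
        a0 : A (suc (toℕ v)) ≡ 0
        a0 = proj₁ (proj₂ (proj₂ c0))
        t0 : T (suc (toℕ v)) ≡ 0
        t0 = proj₂ (proj₂ (proj₂ c0))
        r : Slots → ℕ
        r s = forestAcc f (just v) (σ [ v ↦ s ]) (localAcc v (σ [ v ↦ s ]) acc) (allFin n)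
        r≤ : ∀ s → r s ≤ acc * m * Φ ^ l
        r≤ s = ≤-trans (forestAcc≤ f (just v) (σ [ v ↦ s ]) (localAcc v (σ [ v ↦ s ]) acc) (allFin n)) (*-monoˡ-≤ (Φ ^ l) (localAcc≤ v (σ [ v ↦ s ]) acc))
        u = acc * m * Φ ^ l
        le₄ : r ∅ + r (true , false) + r (false , true) + r (true , true) ≤ V
        le₄ = ≤-trans (+-mono-≤ (+-mono-≤ (+-mono-≤ (r≤ ∅) (r≤ (true , false))) (r≤ (false , true))) (r≤ (true , true))) (≤-trans (≤-reflexive (solve′ u)) le4)
          where
          solve′ : ∀ u → u + u + u + u ≡ 4 * u
          solve′ = solve-∀
        le₃ : r ∅ + r (true , false) + r (false , true) ≤ V
        le₃ = ≤-trans (m≤m+n _ _) le₄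
        le₂ : r ∅ + r (true , false) ≤ V
        le₂ = ≤-trans (m≤m+n _ _) le₃
        le₁ : r ∅ ≤ V
        le₁ = ≤-trans (m≤m+n _ _) le₂
        total : treeAcc (suc f) v σ acc ≡ r ∅ + r (true , false) + r (false , true) + r (true , true)
        total = solve′ (r ∅) (r (true , false)) (r (false , true)) (r (true , true))
          where
          solve′ : ∀ a b c d → a + (b + (c + (d + 0))) ≡ a + b + c + d
          solve′ = solve-∀
        R : ℕ
        R = stepsF f (just v) (allFin n)
        eq : ∀ K R t → K + (R * K + (K + (R * K + (K + (R * K + (K + (R * K + (K + t)))))))) ≡ (1 + 4 * (1 + R)) * K + t
        eq = solve-∀
        scan-in : ∀ s tot {t} → From (inside (r s) (suc n) s tot) t → From (inside (localAcc v (σ [ v ↦ s ]) acc) 1 s tot) (R * K + t)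
        scan-in s tot = scan f (just v) (σ [ v ↦ s ]) (localAcc v (σ [ v ↦ s ]) acc) (suc-injective (trans (sym (+-suc (level v) f)) lv)) (refₛ s)
          (clear λ w lw → let x , y , a , z = clear! cl w (<⇒≤ lw) in
             trans (upd-≢ X _ (off w lw)) x , trans (upd-≢ Y _ (off w lw)) y , trans (upd-≢ A _ (off w lw)) a , trans (upd-≢ T _ (off w lw)) z)
          (asc-allFin n)
          (≤-trans (*-monoˡ-≤ (Φ ^ l) (localAcc≤ v (σ [ v ↦ s ]) acc)) one)
          where
          off : ∀ w → level v < level w → suc (toℕ v) ≢ suc (toℕ w)
          off w lw e with refl ← toℕ-injective (suc-injective e) = <-irrefl refl lw

      scan : ∀ f p σ acc {X Y A T} → plevel level p + f ≡ τ → Reflects σ X Y → Clear (λ w → plevel level p < level w) X Y A T →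
             ∀ {i cs} → Asc i cs → acc * Φ ^ length (forest f p cs) ≤ V → ∀ {t} →
             From (cf (forestAcc f p σ acc cs) (code p) (suc n) X Y A T) t →
             From (cf acc (code p) (suc i) X Y A T) (stepsF f p cs * K + t)
      scan f p σ acc lv ref cl [] le k = k
      scan f p σ acc {X} {Y} {A} {T} lv ref cl (_∷_ {c} {us = cs} refl a) le {t} k with Maybe-≡-dec _≟ᶠ_ (par c) p
      ... | no ne = within (≤-reflexive (sym (+-assoc K _ t))) (stepW (λ e → unscanned c (m+n≡0⇒n≡0 (code p) e)) (skipE c (ne ∘ code-injective (par c) p))
              (scan f p σ acc lv ref cl a le k))
      ... | yes refl = within (≤-reflexive (sym (trans (cong (_+ t) (*-distribʳ-+ K (steps f c) (stepsF f p cs))) (+-assoc (steps f c * K) _ t))))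
              (visit f c σ acc (trans (cong (_+ f) (level≡ c)) (cong suc lv)) ref (clear λ w lw → clear! cl w (≤-trans (≤-reflexive (sym (level≡ c))) lw))
                (≤-trans (*-monoʳ-≤ acc (^-monoʳ-≤ Φ {{Φ≢0}} (≤-trans (m≤m+n (length (sub f c)) (length (forest f p cs))) (≤-reflexive (sym (length-++ (sub f c))))))) le)
              (scan f p σ (treeAcc f c σ acc) lv ref cl a
                (≤-trans (*-monoˡ-≤ _ (treeAcc≤ f c σ acc)) (≤-trans (≤-reflexive (trans (*-assoc acc _ _) (cong (acc *_) (trans (sym (^-distribˡ-+-* Φ (length (sub f c)) _)) (cong (Φ ^_) (sym (length-++ (sub f c)))))))) le)) k))
        where
        Φ≢0 : NonZero Φ
        Φ≢0 = m*n≢0 4 (M ^ (3 + n)) {{_}} {{m^n≢0 M (3 + n) {{m^n≢0 2 h}}}}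

-- The whole program and its phases.

MUL : AExpr → AExpr → Cmd
MUL e f = vR := ‵ 0 ⨟ vCnt := f ⨟ While ($ vCnt) (vR := $ vR ⊞ e ⨟ vCnt := $ vCnt ⊟ ‵ 1)

ROWS CONSTANTS FLIP WEIGHTS START POWERS BITS WINDOW WINDOWS MAIN : Cmd
ROWS = While ($ vN ⊟ $ vU) (aRow [ $ vU ]:= $ vNN ⨟ vNN := $ vNN ⊞ $ vN ⨟ vU := $ vU ⊞ ‵ 1) ⨟ vU := ‵ 0
CONSTANTS = vb := $ vNN ⊞ $ vNN ⊞ $ vN ⊞ ‵ 1 ⨟
  MUL ($ vNN ⊞ $ vNN) ($ vNN ⊞ $ vNN ⊞ $ vNN ⊞ $ vNN ⊞ ‵ 1) ⨟ vq := $ vR ⊞ ‵ 1 ⨟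
  MUL ($ vN ⊞ ‵ 1) ($ vq) ⨟ vTmp := $ vR ⨟
  MUL ($ vTmp) ($ vb) ⨟ vQ := $ vR ⨟ vTmp := ‵ 0 ⨟
  MUL ($ vq) ($ vb) ⨟ vW := $ vR ⨟ vL := $ vQ ⊞ $ vW ⨟
  MUL ($ vN) ($ vQ) ⨟ vBase := $ vR ⨟
  MUL ($ vN ⊟ input (‵ 2)) ($ vW) ⨟ vBase := $ vBase ⊞ $ vR
-- Adding `vb` instead of 1 produces the weight already multiplied by `b`, ready to be a shift. `vR`
-- doubles along until it reaches 2 n², which fixes the number of flips without computing a
-- logarithm.
FLIP = toss vF ⨟ vW := $ vW ⊞ $ vW ⨟ If ($ vF) (vW := $ vW ⊞ $ vb) nop ⨟ vF := ‵ 0 ⨟ vR := $ vR ⊞ $ vR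
WEIGHTS = vW := ‵ 0 ⨟ vR := ‵ 0 ⨟ vCnt := $ vNN ⨟
  While ($ vCnt) (vCnt := $ vCnt ⊟ ‵ 1 ⨟ vR := ‵ 1 ⨟ While ($ vNN ⊞ $ vNN ⊟ $ vR) FLIP ⨟ aW [ $ vCnt ]:= $ vW ⨟ vW := ‵ 0 ⨟ vR := ‵ 0)
START = vCur := ‵ 1 ⨟ vC := ‵ 1
POWERS = aBit [ ‵ 0 ]:= ‵ 1 ⨟
  While ($ vCur ⊞ ‵ 1 ⊟ aBit ! $ vU) (aBit [ $ vU ⊞ ‵ 1 ]:= aBit ! $ vU ⊞ aBit ! $ vU ⨟ vU := $ vU ⊞ ‵ 1)
BITS = vCnt := $ vU ⊞ ‵ 1 ⨟
  While ($ vCnt) (vCnt := $ vCnt ⊟ ‵ 1 ⨟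
    If ($ vCur ⊞ ‵ 1 ⊟ aBit ! $ vCnt) (vCur := $ vCur ⊟ aBit ! $ vCnt ⨟ aBit [ $ vCnt ]:= ‵ 1) (aBit [ $ vCnt ]:= ‵ 0))
WINDOW = If (aBit ! $ vU) (vAns := ‵ 1) nop ⨟ vU := $ vU ⊞ ‵ 1 ⨟ vSh := $ vSh ⊟ ‵ 1
WINDOWS = vCnt := $ vq ⨟
  -- The window length is 1 + min(n, k). No cover has more than n cycles, and the cap keeps the
  -- window inside the `b` bits of one coefficient for arbitrarily large `k`.
  While ($ vCnt) (vU := $ vBase ⨟ vSh := ‵ 1 ⊞ ($ vN ⊟ ($ vN ⊟ input (‵ 1))) ⨟ While ($ vSh) WINDOW ⨟
    vBase := $ vBase ⊞ $ vb ⨟ vCnt := $ vCnt ⊟ ‵ 1)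
MAIN = vN := input (‵ 0) ⨟
  -- More than n vertices cannot be covered. Rejecting this case keeps the truncated subtraction of
  -- ℓ from n exact.
  If (input (‵ 2) ⊟ $ vN) nop (ROWS ⨟ CONSTANTS ⨟ WEIGHTS ⨟ START ⨟ TRAVERSE ⨟ POWERS ⨟ BITS ⨟ WINDOWS)

rows : ℕ → ℕ → (ℕ → ℕ) → ℕ → ℕ
rows n zero    f = f
rows n (suc i) f = upd (rows n i f) i (i * n)

rows≡ : ∀ n k f i → i < k → rows n k f i ≡ i * n
rows≡ n (suc k) f i i<k with k ≟ i
... | yes refl = upd-≡ (rows n k f) k (k * n)
... | no ne    = trans (upd-≢ (rows n k f) (k * n) ne) (rows≡ n k f i (≤∧≢⇒< (s≤s⁻¹ i<k) (ne ∘ sym)))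

value : ∀ {k} → ℕ → Vec Bool k → ℕ
value x []       = x
value x (c ∷ cs) = value (x + x + bit c) cs

table : ∀ lg m → Vec Bool (m * lg) → (ℕ → ℕ) → ℕ → ℕ
table lg zero    ρ f = f
table lg (suc m) ρ f = table lg m (Vec.drop lg ρ) (upd f m (value 0 (Vec.take lg ρ)))

scaled : ∀ b lg m → Vec Bool (m * lg) → (ℕ → ℕ) → ℕ → ℕ
scaled b lg zero    ρ f = f
scaled b lg (suc m) ρ f = scaled b lg m (Vec.drop lg ρ) (upd f m (b * value 0 (Vec.take lg ρ)))

upd-cong : ∀ {f g} k i v w → f i ≡ g i → v ≡ w → upd f k v i ≡ upd g k w i
upd-cong k i v w e refl with k ≡ᵇ i
... | true  = refl
... | false = e

upd-∘ : ∀ (g : ℕ → ℕ) f k v i → upd (g ∘ f) k (g v) i ≡ g (upd f k v i)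
upd-∘ g f k v i with k ≡ᵇ i
... | true  = refl
... | false = refl

scaled≡ : ∀ b lg m ρ f g → (∀ i → f i ≡ b * g i) → ∀ i → scaled b lg m ρ f i ≡ b * table lg m ρ g i
scaled≡ b lg zero    ρ f g e i = e i
scaled≡ b lg (suc m) ρ f g e i = scaled≡ b lg m _ _ _ (λ j → trans (upd-cong {f} {λ j → b * g j} m j _ _ (e j) refl) (upd-∘ (b *_) g m _ j)) i

value< : ∀ {k} x (cs : Vec Bool k) → value x cs < suc x * 2 ^ k
value< x []           = s≤s (≤-reflexive (sym (*-identityʳ x)))
value< {suc k} x (c ∷ cs) = ≤-trans (value< (x + x + bit c) cs) (≤-trans (*-monoˡ-≤ (2 ^ k) (s≤s (+-monoʳ-≤ (x + x) (bit≤1 c)))) (≤-reflexive (eq x (2 ^ k))))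
  where
  eq : ∀ x p → (1 + (x + x + 1)) * p ≡ (1 + x) * (2 * p)
  eq = solve-∀

pow : ℕ → ℕ → ℕ
pow j i = if i ≤ᵇ j then 2 ^ i else 0

≤ᵇ-true : ∀ {i j} → i ≤ j → (i ≤ᵇ j) ≡ true
≤ᵇ-true {i} {j} p with i ≤ᵇ j | ≤⇒≤ᵇ p
... | true | _ = refl

≤ᵇ-false : ∀ {i j} → j < i → (i ≤ᵇ j) ≡ false
≤ᵇ-false {i} {j} p with i ≤ᵇ j in eq
... | false = refl
... | true  = contradiction (≤ᵇ⇒≤ i j (subst T (sym eq) tt)) (<⇒≱ p)

pow-≤ : ∀ {i j} → i ≤ j → pow j i ≡ 2 ^ i
pow-≤ p rewrite ≤ᵇ-true p = refl

pow-> : ∀ {i j} → j < i → pow j i ≡ 0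
pow-> p rewrite ≤ᵇ-false p = refl

pow-suc : ∀ j i → upd (pow j) (suc j) (2 ^ j + 2 ^ j) i ≡ pow (suc j) i
pow-suc j i with suc j ≟ i
... | yes refl = trans (upd-≡ (pow j) (suc j) _) (sym (trans (pow-≤ {suc j} ≤-refl) (cong (2 ^ j +_) (+-identityʳ _))))
... | no ne with i ≤? j
...   | yes p = trans (upd-≢ (pow j) _ ne) (trans (pow-≤ p) (sym (pow-≤ (m≤n⇒m≤1+n p))))
...   | no ¬p = trans (upd-≢ (pow j) _ ne) (trans (pow-> (≰⇒> ¬p)) (sym (pow-> (≤∧≢⇒< (≰⇒> ¬p) ne))))

-- Entries below i still hold powers of two, the others already hold bits of y.
mixed : ℕ → ℕ → ℕ → ℕ
mixed y i k = if suc k ≤ᵇ i then 2 ^ k else bitAt y k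

mixed-< : ∀ y {i k} → k < i → mixed y i k ≡ 2 ^ k
mixed-< y p rewrite ≤ᵇ-true p = refl

mixed-≥ : ∀ y {i k} → i ≤ k → mixed y i k ≡ bitAt y k
mixed-≥ y p rewrite ≤ᵇ-false (s≤s p) = refl

mixed-step : ∀ y i v → v ≡ bitAt y i → ∀ k → upd (mixed y (suc i)) i v k ≡ mixed y i k
mixed-step y i v refl k with i ≟ k
... | yes refl = trans (upd-≡ (mixed y (suc i)) i _) (sym (mixed-≥ y {i} {i} ≤-refl))
... | no ne with k <? i
...   | yes p = trans (upd-≢ (mixed y (suc i)) _ ne) (trans (mixed-< y (m<n⇒m<1+n p)) (sym (mixed-< y p)))
...   | no ¬p = trans (upd-≢ (mixed y (suc i)) _ ne) (trans (mixed-≥ y (≤∧≢⇒< (≮⇒≥ ¬p) ne)) (sym (mixed-≥ y (≮⇒≥ ¬p))))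

_mod2^_ : ℕ → ℕ → ℕ
y mod2^ i = _%_ y (2 ^ i) {{m^n≢0 2 i}}

mod2^-suc : ∀ y i → y mod2^ suc i ≡ y mod2^ i + bitAt y i * 2 ^ i
mod2^-suc y i = begin
    y mod2^ suc i
  ≡⟨ cong (_mod2^ suc i) y≡ ⟩
    (r + c * 2 ^ i + w / 2 * 2 ^ suc i) mod2^ suc i
  ≡⟨ [m+kn]%n≡m%n (r + c * 2 ^ i) (w / 2) (2 ^ suc i) {{m^n≢0 2 (suc i)}} ⟩
    (r + c * 2 ^ i) mod2^ suc i
  ≡⟨ m<n⇒m%n≡m {{m^n≢0 2 (suc i)}} (≤-trans (+-mono-<-≤ (m%n<n y (2 ^ i) {{m^n≢0 2 i}}) (*-monoˡ-≤ (2 ^ i) (s≤s⁻¹ (m%n<n w 2)))) ≤-refl) ⟩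
    r + c * 2 ^ i ∎
  where
  open ≡-Reasoning
  r w c : ℕ
  r = y mod2^ i
  w = _/_ y (2 ^ i) {{m^n≢0 2 i}}
  c = w % 2
  y≡ : y ≡ r + c * 2 ^ i + w / 2 * 2 ^ suc i
  y≡ = trans (m≡m%n+[m/n]*n y (2 ^ i) {{m^n≢0 2 i}}) (trans (cong (λ z → r + z * 2 ^ i) (m≡m%n+[m/n]*n w 2)) (eq r c (w / 2) (2 ^ i)))
    where
    eq : ∀ r c d p → r + (c + d * 2) * p ≡ r + c * p + d * (2 * p)
    eq = solve-∀

hit : ℕ → ℕ → ℕ
hit zero    a = a
hit (suc _) a = 1

window : (ℕ → ℕ) → ℕ → ℕ → ℕ → ℕ
window f u zero    a = a
window f u (suc k) a = window f (suc u) k (hit (f u) a)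

windows : (ℕ → ℕ) → ℕ → ℕ → ℕ → ℕ → ℕ → ℕ
windows f b k u zero    a = a
windows f b k u (suc c) a = windows f b k (u + b) c (window f u k a)

module Phases (inputs : List ℕ) (I B N : ℕ) (17≤I : 17 ≤ I) (n : ℕ) (B≤I : B ≤ I) (B≤N : B ≤ N) where

  open Machine inputs I B N 17≤I

  st : (ans n NN b q cQ cL base cnt cur tmp sh p c w r u fl : ℕ) (Row W X Y A T Bit : ℕ → ℕ) → State
  st ans n NN b q cQ cL base cnt cur tmp sh p c w r u fl Row W X Y A T Bit =
    (ans , n , NN , b , q , cQ , cL , base , cnt , cur , tmp , sh , p , c , w , r , u , fl , tt) , (Row , W , X , Y , A , T , Bit , tt)

  module _ {ρ : List Bool} {s : State} {e : AExpr} {x : ℕ} (e≡ : ∀ a c → ev e (setv vR a (setv vCnt c s)) ≡ x) where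

    mul-loop : ∀ y a → y ≤ B → a + y * x ≤ B →
               Loop y ($ vCnt) (vR := $ vR ⊞ e ⨟ vCnt := $ vCnt ⊟ ‵ 1) (setv vR a (setv vCnt y s)) ρ (setv vR (a + y * x) (setv vCnt 0 s)) ρ
    mul-loop zero    a y≤ le = post≡ (cong (λ z → setv vR z (setv vCnt 0 s)) (sym (+-identityʳ a))) (stop 0 refl)
    mul-loop (suc y) a y≤ le = again y (λ ())
      (post≡ (cong (λ z → setv vR (a + z) (setv vCnt (suc y) s)) (e≡ a (suc y))) (asg (V≥ (subst (λ z → a + z ≤ B) (sym (e≡ a (suc y))) (≤-trans (m≤m+n _ (y * x)) le′)))) ▸
       asg (V≥ (<⇒≤ y≤)))
      (post≡ (cong (λ z → setv vR z (setv vCnt 0 s)) (+-assoc a x (y * x))) (mul-loop y (a + x) (<⇒≤ y≤) le′))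
      where
      le′ : a + x + y * x ≤ B
      le′ = ≤-trans (≤-reflexive (+-assoc a x (y * x))) le

    mulE : ∀ {f y z} → ev f (setv vR 0 s) ≡ y → y * x ≡ z → y ≤ B → z ≤ B → Do (MUL e f) s ρ (setv vR z (setv vCnt 0 s)) ρ
    mulE refl refl y≤ le = asg z≤n ▸ asg (V≥ y≤) ▸ loops (≤-trans y≤ B≤N) (mul-loop _ 0 y≤ le)

  asg≡ : ∀ {x e s ρ v} → ev e s ≡ v → v ≤ V → Do (x := e) s ρ (setv x v s) ρ
  asg≡ refl = asg

  module Setup (Z₀ : ℕ → ℕ) (n≤ : n ≤ B) (nn≤ : n * n ≤ B) {ρ : List Bool} where

    private
      s : (NN u : ℕ) (Row : ℕ → ℕ) → State
      s NN u Row = st 0 n NN 0 0 0 0 0 0 0 0 0 0 0 0 0 u 0 Row Z₀ Z₀ Z₀ Z₀ Z₀ Z₀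

    rows-loop : ∀ k i f → k + i ≡ n →
                Loop k ($ vN ⊟ $ vU) (aRow [ $ vU ]:= $ vNN ⨟ vNN := $ vNN ⊞ $ vN ⨟ vU := $ vU ⊞ ‵ 1)
                  (s (i * n) i (rows n i f)) ρ (s (n * n) n (rows n n f)) ρ
    rows-loop zero    i f refl = stop 0 (n∸n≡0 i)
    rows-loop (suc k) i f e = again k (m>n⇒m∸n≢0 i<n)
      (asa (≤-trans (<⇒≤ i<n) (≤-trans n≤ B≤I)) (V≥ (≤-trans (*-monoˡ-≤ n (<⇒≤ i<n)) nn≤)) ▸
       asg (V≥ (≤-trans (≤-reflexive (+-comm (i * n) n)) (≤-trans (*-monoˡ-≤ n i<n) nn≤))) ▸
       post≡ (cong₂ (λ x y → s x y (rows n (suc i) f)) (+-comm (i * n) n) (+-comm i 1)) (asg (V≥ (≤-trans (≤-reflexive (+-comm i 1)) (≤-trans i<n n≤)))))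
      (rows-loop k (suc i) f (trans (+-suc k i) e))
      where
      i<n : i < n
      i<n = subst (suc i ≤_) e (s≤s (m≤n+m i k))

    rowsE : Do ROWS (s 0 0 Z₀) ρ (s (n * n) 0 (rows n n Z₀)) ρ
    rowsE = loops (≤-trans n≤ B≤N) (rows-loop n 0 Z₀ (+-identityʳ n)) ▸ asg z≤n

  module ConstantsE (ℓ NN b four q Q cQ bq cL base₁ base₂ base : ℕ) (ℓ≡ : read inputs 2 ≡ ℓ)
    (b≡ : NN + NN + n + 1 ≡ b) (four≡ : NN + NN + NN + NN + 1 ≡ four) (q≡ : four * (NN + NN) + 1 ≡ q) (Q≡ : q * (n + 1) ≡ Q)
    (cQ≡ : b * Q ≡ cQ) (bq≡ : b * q ≡ bq) (cL≡ : cQ + bq ≡ cL) (base₁≡ : cQ * n ≡ base₁) (base₂≡ : bq * (n ∸ ℓ) ≡ base₂) (base≡ : base₁ + base₂ ≡ base)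
    (b≤ : b ≤ B) (q≤ : q ≤ B) (four≤ : four ≤ B) (Q≤ : Q ≤ B) (cQ≤ : cQ ≤ B) (bq≤ : bq ≤ B) (cL≤ : cL ≤ B) (base≤ : base ≤ B)
    {Row W X Y A T Bit : ℕ → ℕ} {ρ : List Bool} where

    constantsE : Do CONSTANTS (st 0 n NN 0 0 0 0 0 0 0 0 0 0 0 0 0 0 0 Row W X Y A T Bit) ρ
                   (st 0 n NN b q cQ cL base 0 0 0 0 0 0 bq base₂ 0 0 Row W X Y A T Bit) ρ
    constantsE = asg≡ b≡ (V≥ b≤) ▸
      mulE (λ _ _ → refl) four≡ refl four≤ (≤-trans (m≤m+n _ 1) (≤-trans (≤-reflexive q≡) q≤)) ▸ asg≡ q≡ (V≥ q≤) ▸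
      mulE (λ _ _ → refl) refl Q≡ q≤ Q≤ ▸ asg (V≥ Q≤) ▸
      mulE (λ _ _ → refl) refl cQ≡ b≤ cQ≤ ▸ asg (V≥ cQ≤) ▸ asg z≤n ▸
      mulE (λ _ _ → refl) refl bq≡ b≤ bq≤ ▸ asg (V≥ bq≤) ▸ asg≡ cL≡ (V≥ cL≤) ▸
      mulE (λ _ _ → refl) refl base₁≡ cQ≤ (≤-trans (m≤m+n _ _) base′) ▸ asg (V≥ (≤-trans (m≤m+n _ _) base′)) ▸
      mulE (λ _ _ → cong (n ∸_) ℓ≡) refl base₂≡ bq≤ (≤-trans (m≤n+m _ _) base′) ▸
      asg≡ base≡ (V≥ base≤)
      where
      base′ : base₁ + base₂ ≤ B
      base′ = ≤-trans (≤-reflexive base≡) base≤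

  module WeightsE (NN b q cQ cL base lg : ℕ) (lg≥ : NN + NN ≤ 2 ^ lg) (lg< : ∀ j → j < lg → 2 ^ j < NN + NN)
    (NN≤ : NN ≤ B) (lg≤ : lg ≤ B) (2^lg≤ : 2 ^ lg ≤ B) (b2^lg≤ : b * 2 ^ lg ≤ B) {Row X Y A T Bit : ℕ → ℕ} where

    private
      s : (cnt w r fl : ℕ) → (ℕ → ℕ) → State
      s cnt w r fl W = st 0 n NN b q cQ cL base cnt 0 0 0 0 0 w r 0 fl Row W X Y A T Bit

    flip-loop : ∀ {k cnt W ρ} (cs : Vec Bool k) j x → k + j ≡ lg → x < 2 ^ j →
                Loop k ($ vNN ⊞ $ vNN ⊟ $ vR) FLIP (s cnt (b * x) (2 ^ j) 0 W) (toList cs ++ ρ) (s cnt (b * value x cs) (2 ^ lg) 0 W) ρ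
    flip-loop {cnt = cnt} {W} [] j x refl x< = stop 0 (m≤n⇒m∸n≡0 lg≥)
    flip-loop {suc k} {cnt} {W} {ρ} (c ∷ cs) j x e x< = again k (m>n⇒m∸n≢0 (lg< j j<lg))
      (tossE ▸ asg≡ (sym (*-distribˡ-+ b x x)) (V≥ (≤-trans (*-monoʳ-≤ b (≤-trans (m≤m+n _ (bit c)) (<⇒≤ x<′))) b2^≤)) ▸ add c refl ▸ asg z≤n ▸
       asg≡ (cong (2 ^ j +_) (sym (+-identityʳ _))) (V≥ (≤-trans (^-monoʳ-≤ 2 j<lg) 2^lg≤)))
      (flip-loop cs (suc j) (x + x + bit c) (trans (+-suc k j) e) x<′)
      where
      j<lg : suc j ≤ lg
      j<lg = subst (suc j ≤_) e (s≤s (m≤n+m j k))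
      x<′ : x + x + bit c < 2 ^ suc j
      x<′ = ≤-trans (s≤s (+-monoʳ-≤ (x + x) (bit≤1 c))) (≤-trans (≤-reflexive (eq x)) (≤-trans (*-monoʳ-≤ 2 x<) ≤-refl))
        where
        eq : ∀ x → 1 + (x + x + 1) ≡ 2 * (1 + x)
        eq = solve-∀
      b2^≤ : b * 2 ^ suc j ≤ B
      b2^≤ = ≤-trans (*-monoʳ-≤ b (^-monoʳ-≤ 2 j<lg)) b2^lg≤
      add : ∀ c′ → c ≡ c′ → Do (If ($ vF) (vW := $ vW ⊞ $ vb) nop) (s cnt (b * (x + x)) (2 ^ j) (bit c′) W) (toList cs ++ ρ) (s cnt (b * (x + x + bit c′)) (2 ^ j) (bit c′) W) (toList cs ++ ρ)
      add true  refl = ifT (λ ()) (asg≡ (sym (trans (*-distribˡ-+ b (x + x) 1) (cong (b * (x + x) +_) (*-identityʳ b)))) (V≥ (≤-trans (*-monoʳ-≤ b (<⇒≤ x<′)) b2^≤)))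
      add false refl = ifF refl (post≡ (cong (λ z → s cnt (b * z) (2 ^ j) 0 W) (sym (+-identityʳ (x + x)))) nopE)

    toList-split : ∀ k {m} (ρ : Vec Bool (k + m)) → toList ρ ≡ toList (Vec.take k ρ) ++ toList (Vec.drop k ρ)
    toList-split zero    ρ       = refl
    toList-split (suc k) (x ∷ ρ) = cong (x ∷_) (toList-split k ρ)

    weights-loop : ∀ m (ρ : Vec Bool (m * lg)) W → m ≤ NN →
      Loop m ($ vCnt) (vCnt := $ vCnt ⊟ ‵ 1 ⨟ vR := ‵ 1 ⨟ While ($ vNN ⊞ $ vNN ⊟ $ vR) FLIP ⨟ aW [ $ vCnt ]:= $ vW ⨟ vW := ‵ 0 ⨟ vR := ‵ 0)
        (s m 0 0 0 W) (toList ρ) (s 0 0 0 0 (scaled b lg m ρ W)) []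
    weights-loop zero    [] W m≤ = stop 0 refl
    weights-loop (suc m) ρ  W m≤ rewrite toList-split lg ρ = again m (λ ())
      (asg (V≥ m≤B) ▸ asg (V≥ (≤-trans (m^n>0 2 lg) 2^lg≤)) ▸
       loops (≤-trans lg≤ B≤N) (pre≡ (cong (λ z → s m z 1 0 W) (sym (*-zeroʳ b))) (flip-loop (Vec.take lg ρ) 0 0 (+-identityʳ lg) (s≤s z≤n))) ▸
       asa (≤-trans m≤B B≤I) (V≥ (≤-trans (*-monoʳ-≤ b (<⇒≤ (≤-trans (value< 0 (Vec.take lg ρ)) (≤-reflexive (+-identityʳ _))))) b2^lg≤)) ▸ asg z≤n ▸ asg z≤n)
      (weights-loop m (Vec.drop lg ρ) _ (<⇒≤ m≤))
      where
      m≤B : m ≤ B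
      m≤B = ≤-trans (<⇒≤ m≤) NN≤

    weightsE : ∀ {w r W} (ρ : Vec Bool (NN * lg)) → Do WEIGHTS (s 0 w r 0 W) (toList ρ) (s 0 0 0 0 (scaled b lg NN ρ W)) []
    weightsE {W = W} ρ = asg z≤n ▸ asg z≤n ▸ asg (V≥ NN≤) ▸ loops (≤-trans NN≤ B≤N) (weights-loop NN ρ W ≤-refl)

  module ReadOut (k NN b q cQ cL : ℕ) (k≡ : read inputs 1 ≡ k) {p c : ℕ} {Row W X Y A T : ℕ → ℕ} {ρ : List Bool} where

    private
      s : (ans base cnt cur sh u : ℕ) (Bit : ℕ → ℕ) → State
      s ans base cnt cur sh u Bit = st ans n NN b q cQ cL base cnt cur 0 sh p c 0 0 u 0 Row W X Y A T Bit

      bit≈ : ∀ {ans base cnt cur sh u Bit Bit′} → (∀ i → Bit i ≡ Bit′ i) → s ans base cnt cur sh u Bit ≈ s ans base cnt cur sh u Bit′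
      bit≈ {Bit = Bit} {Bit′} e = refl , go
        where
        go : ∀ a i → getᵗ {k = 7} (Row , W , X , Y , A , T , Bit , tt) a i ≡ getᵗ {k = 7} (Row , W , X , Y , A , T , Bit′ , tt) a i
        go zero i = refl
        go (suc zero) i = refl
        go (suc (suc zero)) i = refl
        go (suc (suc (suc zero))) i = refl
        go (suc (suc (suc (suc zero)))) i = refl
        go (suc (suc (suc (suc (suc zero))))) i = refl
        go (suc (suc (suc (suc (suc (suc zero)))))) = e

    module _ {base : ℕ} (y B′ : ℕ) (B′< : B′ < B) (2y≤ : 2 * y ≤ 2 ^ B′) where

      private
        2y≤V : 2 * y ≤ V
        2y≤V = ≤-trans 2y≤ (^-monoʳ-≤ 2 (<⇒≤ B′<))

      -- The number of rounds depends on `y`, so the final index is only asserted to exist;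
      -- `2 * y ≤ 2 ^ B′` guarantees that a power exceeding `y` turns up in time.
      powers-loop : ∀ k j → k + j ≡ B′ → Σ[ J ∈ ℕ ] (J ≤ B′ × y < 2 ^ J ×
        Loop k ($ vCur ⊞ ‵ 1 ⊟ aBit ! $ vU) (aBit [ $ vU ⊞ ‵ 1 ]:= aBit ! $ vU ⊞ aBit ! $ vU ⨟ vU := $ vU ⊞ ‵ 1)
          (s 0 base 0 y 0 j (pow j)) ρ (s 0 base 0 y 0 J (pow J)) ρ)
      powers-loop k j e with 2 ^ j ≤? y
      ... | no ¬p = j , subst (j ≤_) e (m≤n+m j k) , ≰⇒> ¬p , stop k (trans (cong₂ _∸_ (+-comm y 1) (pow-≤ {j} ≤-refl)) (m≤n⇒m∸n≡0 (≰⇒> ¬p)))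
      powers-loop zero    j refl | yes p = contradiction (≤-trans (*-monoʳ-≤ 2 p) 2y≤) (<⇒≱ (^-monoʳ-< 2 ≤-refl {j} {suc j} ≤-refl))
      powers-loop (suc k) j e    | yes p with J , J≤ , y< , l ← powers-loop k (suc j) (trans (+-suc k j) e) = J , J≤ , y< ,
        again k {st = s 0 base 0 y 0 j (pow j)} (λ z → m>n⇒m∸n≢0 {1 + y} {2 ^ j} (s≤s p) (trans (cong₂ _∸_ (+-comm 1 y) (sym (pow-≤ {j} ≤-refl))) z))
          (asa {st = s 0 base 0 y 0 j (pow j)} (≤-trans (≤-reflexive (+-comm j 1)) (≤-trans j≤ B≤I)) (≤-trans (≤-reflexive pp) (≤-trans (+-mono-≤ p p) (≤-trans (≤-reflexive (cong (y +_) (sym (+-identityʳ y)))) 2y≤V))) ▸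
           post (bit≈ {Bit = upd (pow j) (j + 1) (pow j j + pow j j)} (λ i → trans (cong₂ (λ a v → upd (pow j) a v i) (+-comm j 1) pp) (pow-suc j i)))
             (asg≡ (+-comm j 1) (V≥ j≤)))
          l
        where
        j≤ : suc j ≤ B
        j≤ = ≤-trans (subst (suc j ≤_) e (s≤s (m≤n+m j k))) (<⇒≤ B′<)
        pp : pow j j + pow j j ≡ 2 ^ j + 2 ^ j
        pp = cong₂ _+_ (pow-≤ {j} ≤-refl) (pow-≤ {j} ≤-refl)

      powersE : ∀ {Bit} → (∀ i → Bit i ≡ 0) → Σ[ J ∈ ℕ ] (J < B × y < 2 ^ J × Do POWERS (s 0 base 0 y 0 0 Bit) ρ (s 0 base 0 y 0 J (pow J)) ρ)
      powersE {Bit} z with J , J≤ , y< , l ← powers-loop B′ 0 (+-identityʳ B′) = J , ≤-trans (s≤s J≤) B′< , y< ,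
        (asa z≤n (m^n>0 2 B) ▸ loops (≤-trans (<⇒≤ B′<) B≤N) (pre (bit≈ {Bit = upd Bit 0 1} λ { zero → refl ; (suc i) → z (suc i) }) l))

      bits-loop : ∀ i {J} → i ≤ B →
        Loop i ($ vCnt) (vCnt := $ vCnt ⊟ ‵ 1 ⨟
          If ($ vCur ⊞ ‵ 1 ⊟ aBit ! $ vCnt) (vCur := $ vCur ⊟ aBit ! $ vCnt ⨟ aBit [ $ vCnt ]:= ‵ 1) (aBit [ $ vCnt ]:= ‵ 0))
          (s 0 base i (y mod2^ i) 0 J (mixed y i)) ρ (s 0 base 0 (y mod2^ 0) 0 J (mixed y 0)) ρ
      bits-loop zero    i≤ = stop 0 refl
      bits-loop (suc i) {J} i≤ = again i (λ ()) (asg (V≥ (<⇒≤ i≤)) ▸ step (bitAt y i) refl) (bits-loop i (<⇒≤ i≤))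
        where
        here≡ : mixed y (suc i) i ≡ 2 ^ i
        here≡ = mixed-< y {suc i} {i} ≤-refl
        r< : y mod2^ i < 2 ^ i
        r< = m%n<n y (2 ^ i) {{m^n≢0 2 i}}
        y≤V : y ≤ V
        y≤V = ≤-trans (m≤m+n y _) 2y≤V
        step : ∀ c → bitAt y i ≡ c →
          Do (If ($ vCur ⊞ ‵ 1 ⊟ aBit ! $ vCnt) (vCur := $ vCur ⊟ aBit ! $ vCnt ⨟ aBit [ $ vCnt ]:= ‵ 1) (aBit [ $ vCnt ]:= ‵ 0))
            (s 0 base i (y mod2^ suc i) 0 J (mixed y (suc i))) ρ (s 0 base i (y mod2^ i) 0 J (mixed y i)) ρ
        step zero e = ifF (trans (cong₂ _∸_ (trans (+-comm _ 1) (cong suc m≡)) here≡) (m≤n⇒m∸n≡0 r<))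
            (post≡ (cong (λ z → s 0 base i z 0 J (mixed y i)) m≡) (post (bit≈ (mixed-step y i 0 (sym e))) (asa (≤-trans (<⇒≤ i≤) B≤I) z≤n)))
          where
          m≡ : y mod2^ suc i ≡ y mod2^ i
          m≡ = trans (mod2^-suc y i) (trans (cong (λ c → y mod2^ i + c * 2 ^ i) e) (+-identityʳ _))
        step (suc zero) e = ifT (λ z → m>n⇒m∸n≢0 {1 + y mod2^ suc i} {2 ^ i} (s≤s (≤-trans (m≤n+m _ _) (≤-reflexive (sym m≡)))) (trans (cong₂ _∸_ (+-comm 1 _) (sym here≡)) z))
            (asg≡ (trans (cong₂ _∸_ m≡ here≡) (m+n∸n≡m (y mod2^ i) (2 ^ i))) (≤-trans (m%n≤m y (2 ^ i) {{m^n≢0 2 i}}) y≤V) ▸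
             post (bit≈ (mixed-step y i 1 (sym e))) (asa (≤-trans (<⇒≤ i≤) B≤I) (m^n>0 2 B)))
          where
          m≡ : y mod2^ suc i ≡ y mod2^ i + 2 ^ i
          m≡ = trans (mod2^-suc y i) (cong (y mod2^ i +_) (trans (cong (_* 2 ^ i) e) (+-identityʳ _)))
        step (suc (suc c)) e = contradiction (subst (_< 2) e (m%n<n (_/_ y (2 ^ i) {{m^n≢0 2 i}}) 2)) λ { (s≤s (s≤s ())) }

      bitsE : ∀ {J} → J < B → y < 2 ^ J → Do BITS (s 0 base 0 y 0 J (pow J)) ρ (s 0 base 0 (y mod2^ 0) 0 J (bitAt y)) ρ
      bitsE {J} J≤ y< = asg≡ (+-comm J 1) (V≥ J≤) ▸ loops (≤-trans J≤ B≤N)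
        (pre≡ (cong (λ z → s 0 base (suc J) z 0 J (pow J)) (sym (m<n⇒m%n≡m {{m^n≢0 2 (suc J)}} (≤-trans y< (m≤m+n _ _)))))
         (pre (bit≈ start) (post (bit≈ (λ i → mixed-≥ y {0} {i} z≤n)) (bits-loop (suc J) J≤))))
        where
        start : ∀ i → pow J i ≡ mixed y (suc J) i
        start i with i ≤? J
        ... | yes p = trans (pow-≤ p) (sym (mixed-< y (s≤s p)))
        ... | no ¬p = trans (pow-> (≰⇒> ¬p)) (sym (trans (mixed-≥ y (≰⇒> ¬p)) (cong (_% 2) (m<n⇒m/n≡0 {{m^n≢0 2 i}} (≤-trans y< (^-monoʳ-≤ 2 (<⇒≤ (≰⇒> ¬p))))))))

    module _ (Bit : ℕ → ℕ) {cur : ℕ} where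

      window-loop : ∀ sh {ans base cnt} u → sh + u ≤ B →
        Loop sh ($ vSh) WINDOW (s ans base cnt cur sh u Bit) ρ (s (window Bit u sh ans) base cnt cur 0 (sh + u) Bit) ρ
      window-loop zero     u le = stop 0 refl
      window-loop (suc sh) {ans} {base} {cnt} u le = again sh (λ ())
        (test (Bit u) refl ▸ asg≡ (+-comm u 1) (V≥ (≤-trans (s≤s (m≤n+m u sh)) le)) ▸ asg (V≥ (≤-trans (m≤m+n sh u) (<⇒≤ le))))
        (post≡ (cong (λ z → s (window Bit u (suc sh) ans) base cnt cur 0 z Bit) (+-suc sh u)) (window-loop sh (suc u) (≤-trans (≤-reflexive (+-suc sh u)) le)))
        where
        test : ∀ c → Bit u ≡ c → Do (If (aBit ! $ vU) (vAns := ‵ 1) nop) (s ans base cnt cur (suc sh) u Bit) ρ (s (hit (Bit u) ans) base cnt cur (suc sh) u Bit) ρ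
        test zero    e = ifF e (post≡ (cong (λ z → s (hit z ans) base cnt cur (suc sh) u Bit) (sym e)) nopE)
        test (suc c) e = ifT (λ z → contradiction (trans (sym e) z) λ ()) (post≡ (cong (λ z → s (hit z ans) base cnt cur (suc sh) u Bit) (sym e)) (asg (m^n>0 2 B)))

      k′ : ℕ
      k′ = suc (n ∸ (n ∸ k))

      private
        eq : ∀ c b x → c * b + (x + b) ≡ b + c * b + x
        eq = solve-∀

      windows-loop : ∀ c {ans u} base → c * b + base + k′ ≤ B → c ≤ B → Σ[ u′ ∈ ℕ ]
        Loop c ($ vCnt) (vU := $ vBase ⨟ vSh := ‵ 1 ⊞ ($ vN ⊟ ($ vN ⊟ input (‵ 1))) ⨟ While ($ vSh) WINDOW ⨟ vBase := $ vBase ⊞ $ vb ⨟ vCnt := $ vCnt ⊟ ‵ 1)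
          (s ans base c cur 0 u Bit) ρ (s (windows Bit b k′ base c ans) (c * b + base) 0 cur 0 u′ Bit) ρ
      windows-loop zero    {ans} {u} base le c≤ = u , stop 0 refl
      windows-loop (suc c) {ans} {u} base le c≤ with u′ , l ← windows-loop c {window Bit base k′ ans} {k′ + base} (base + b) (≤-trans (≤-reflexive (cong (_+ k′) (eq c b base))) le) (<⇒≤ c≤) = u′ ,
        again c (λ ()) (asg (V≥ (≤-trans (≤-trans (m≤n+m base (suc c * b)) (m≤m+n _ k′)) le)) ▸ asg≡ (cong (λ z → suc (n ∸ (n ∸ z))) k≡) (V≥ (≤-trans (m≤n+m k′ _) le)) ▸
          loops (≤-trans (≤-trans (m≤n+m k′ _) le) B≤N) (window-loop k′ base (≤-trans (≤-trans (≤-reflexive (+-comm k′ base)) (+-monoˡ-≤ k′ (m≤n+m base (suc c * b)))) le)) ▸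
          asg (V≥ (≤-trans (≤-trans (m≤n+m (base + b) (c * b)) (≤-trans (≤-reflexive (eq c b base)) (m≤m+n _ k′))) le)) ▸ asg (V≥ (<⇒≤ c≤)))
          (post≡ (cong (λ z → s (windows Bit b k′ base (suc c) ans) z 0 cur 0 u′ Bit) (eq c b base)) l)

      windowsE : ∀ {base u} → q * b + base + k′ ≤ B → q ≤ B → Σ[ u′ ∈ ℕ ]
        Do WINDOWS (s 0 base 0 cur 0 u Bit) ρ (s (windows Bit b k′ base q 0) (q * b + base) 0 cur 0 u′ Bit) ρ
      windowsE {base} le q≤ with u′ , l ← windows-loop q base le q≤ = u′ , (asg (V≥ q≤) ▸ loops (≤-trans q≤ B≤N) l)

-- Coins and the isolation lemma.

sumV : ∀ r → (Vec Bool r → ℕ) → ℕ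
sumV zero    F = F []
sumV (suc r) F = sumV r (F ∘ (true ∷_)) + sumV r (F ∘ (false ∷_))

count≡sumV : ∀ r (B : Vec Bool r → Bool) → count r B ≡ sumV r (bit ∘ B)
count≡sumV zero    B = refl
count≡sumV (suc r) B = cong₂ _+_ (count≡sumV r _) (count≡sumV r _)

sumV-mono : ∀ r {F G : Vec Bool r → ℕ} → (∀ ρ → F ρ ≤ G ρ) → sumV r F ≤ sumV r G
sumV-mono zero    e = e []
sumV-mono (suc r) e = +-mono-≤ (sumV-mono r λ ρ → e _) (sumV-mono r λ ρ → e _)

sumV-∑ : ∀ r (xs : List A) (F : A → Vec Bool r → ℕ) → sumV r (λ ρ → ∑ xs (λ x → F x ρ)) ≡ ∑ xs (λ x → sumV r (F x))
sumV-∑ zero    xs F = refl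
sumV-∑ (suc r) xs F = trans (cong₂ _+_ (sumV-∑ r xs _) (sumV-∑ r xs _)) (∑-+ xs _ _)

-- The numbers obtained from `k` coins after the prefix `x`, in the order of `sumV`. They are
-- pairwise distinct, so a weight is uniformly distributed.
values : ℕ → ℕ → List ℕ
values zero    x = x ∷ []
values (suc k) x = values k (x + x + 1) ++ values k (x + x + 0)

length-values : ∀ k x → length (values k x) ≡ 2 ^ k
length-values zero    x = refl
length-values (suc k) x = trans (length-++ (values k (x + x + 1))) (cong₂ _+_ (length-values k _) (trans (length-values k _) (sym (+-identityʳ _))))

values-range : ∀ k x {y} → y ∈ values k x → x * 2 ^ k ≤ y × y < suc x * 2 ^ k
values-range zero    x (here refl) = ≤-reflexive (*-identityʳ x) , s≤s (≤-reflexive (sym (*-identityʳ x)))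
values-range (suc k) x y∈ with ∈-++⁻ (values k (x + x + 1)) y∈
... | inj₁ p with l , u ← values-range k (x + x + 1) p = ≤-trans (≤-trans (≤-reflexive (eq x (2 ^ k))) (*-monoˡ-≤ (2 ^ k) (m≤m+n (x + x) 1))) l , ≤-trans u (≤-reflexive (eq′ x (2 ^ k)))
  where
  eq : ∀ x p → x * (2 * p) ≡ (x + x) * p
  eq = solve-∀
  eq′ : ∀ x p → (1 + (x + x + 1)) * p ≡ (1 + x) * (2 * p)
  eq′ = solve-∀
... | inj₂ p with l , u ← values-range k (x + x + 0) p = ≤-trans (≤-reflexive (eq x (2 ^ k))) l , ≤-trans u (≤-trans (*-monoˡ-≤ (2 ^ k) (n≤1+n (1 + (x + x + 0)))) (≤-reflexive (eq′ x (2 ^ k))))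
  where
  eq : ∀ x p → x * (2 * p) ≡ (x + x + 0) * p
  eq = solve-∀
  eq′ : ∀ x p → (1 + (1 + (x + x + 0))) * p ≡ (1 + x) * (2 * p)
  eq′ = solve-∀

values-unique : ∀ k x → Unique (values k x)
values-unique zero    x = [] ∷ []
values-unique (suc k) x = unique-++⁺ (values-unique k _) (values-unique k _) λ (p , q) →
  contradiction (≤-trans (proj₂ (values-range k (x + x + 0) q)) (≤-trans (≤-reflexive (eq x (2 ^ k))) (proj₁ (values-range k (x + x + 1) p)))) (<⇒≱ ≤-refl)
  where
  eq : ∀ x p → (1 + (x + x + 0)) * p ≡ (x + x + 1) * p
  eq = solve-∀

sumV-values : ∀ k {r} x (G : ℕ → Vec Bool r → ℕ) →
              sumV (k + r) (λ ρ → G (value x (Vec.take k ρ)) (Vec.drop k ρ)) ≡ ∑ (values k x) (λ v → sumV r (G v))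
sumV-values zero    x G = sym (+-identityʳ _)
sumV-values (suc k) {r} x G = trans (cong₂ _+_ (sumV-values k (x + x + 1) G) (sumV-values k (x + x + 0) G)) (sym (∑-++ (values k (x + x + 1)) _ _))

module _ (lg : ℕ) where
  open Assignments {ℕ} {ℕ} _≟_ (values lg 0)

  -- Each entry consumes `lg` coins of its own. Counting coin sequences thus becomes a sum over
  -- independent weights, to which `Σ*-lines` applies.
  sumV-table : ∀ m σ F → sumV (m * lg) (λ ρ → F (table lg m ρ σ)) ≡ Σ* (downFrom m) σ F
  sumV-table zero    σ F = refl
  sumV-table (suc m) σ F = trans (sumV-values lg 0 (λ v ρ → F (table lg m ρ (upd σ m v)))) (∑-cong (values lg 0) λ v _ → sumV-table m (σ [ m ↦ v ]) F)

at-most-one : ∀ {P : A → Set} (P? : ∀ x → Dec (P x)) {xs} → Unique xs → (∀ {x y} → P x → P y → x ≡ y) → ∑ xs (𝟙 ∘ P?) ≤ 1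
at-most-one P? {[]} u same = z≤n
at-most-one P? {x ∷ xs} (x∉ ∷ u) same with P? x
... | no _  = at-most-one P? u same
... | yes p = s≤s (≤-reflexive (∑-zero xs λ y y∈ → 𝟙-no (P? y) λ q → All.lookup x∉ y∈ (same p q)))

subs-Unique : ∀ {E : List A} → Unique E → Unique (subs E)
subs-Unique {E = []} u = [] ∷ []
subs-Unique {E = e ∷ E} (e∉ ∷ u) = unique-++⁺ (subs-Unique u) (unique-map⁺ (λ { refl → refl }) (subs-Unique u)) λ (p , q) →
    let C , _ , eq = ∈-map⁻ (e ∷_) q in All.lookup e∉ (subs⇒⊆ E p (subst (e ∈_) (sym eq) (here refl))) refl

argmin : ∀ (W : A → ℕ) {xs x} → x ∈ xs → Σ[ y ∈ A ] (y ∈ xs × ∀ z → z ∈ xs → W y ≤ W z)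
argmin W {x ∷ []}      p = x , here refl , λ { z (here refl) → ≤-refl }
argmin W {x ∷ x′ ∷ xs} p with y , y∈ , least ← argmin W {x′ ∷ xs} (here refl) with ≤-total (W x) (W y)
... | inj₁ le = x , here refl , λ { z (here refl) → ≤-refl ; z (there z∈) → ≤-trans le (least z z∈) }
... | inj₂ le = y , there y∈ , λ { z (here refl) → le ; z (there z∈) → least z z∈ }

∣-except : ∀ {d} (f : A → ℕ) {xs x} → Unique xs → x ∈ xs → (∀ y → y ∈ xs → y ≢ x → d ∣ f y) → d ∣ ∑ xs f → d ∣ f x
∣-except {d = d} f {x ∷ xs} (x∉ ∷ u) (here refl) others div =
  ∣m+n∣m⇒∣n (subst (d ∣_) (+-comm (f x) _) div) (∣-∑ xs λ y y∈ → others y (there y∈) λ { refl → All.lookup x∉ y∈ refl })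
  where
  ∣-∑ : ∀ xs → (∀ y → y ∈ xs → d ∣ f y) → d ∣ ∑ xs f
  ∣-∑ []       h = d ∣0
  ∣-∑ (x ∷ xs) h = ∣m∣n⇒∣m+n (h x (here refl)) (∣-∑ xs (λ y → h y ∘ there))
∣-except f {z ∷ xs} (z∉ ∷ u) (there x∈) others div =
  ∣-except f u x∈ (λ y → others y ∘ there) (∣m+n∣m⇒∣n div (others z (here refl) λ { refl → All.lookup z∉ x∈ refl }))

module _ (lg : ℕ) where
  open Assignments {ℕ} {ℕ} _≟_ (values lg 0)

  module Isolation (_≟ᴬ_ : DecidableEquality A) {E : List A} (E-unique : Unique E)
    (idx : A → ℕ) (w : A → (ℕ → ℕ) → ℕ) (w-ext : ∀ e {f g} → (∀ i → f i ≡ g i) → w e f ≡ w e g)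
    (w-other : ∀ {e e′} → e ∈ E → e′ ∈ E → e ≢ e′ → ∀ f t t′ → w e′ (f [ idx e ↦ t ]) ≡ w e′ (f [ idx e ↦ t′ ]))
    (w-self : ∀ {e} → e ∈ E → ∀ f t → w e (f [ idx e ↦ t ]) ≡ t + w e (f [ idx e ↦ 0 ]))
    (family : List (List A)) (family⊆ : ∀ {C} → C ∈ family → C ∈ subs E) where

    _∈?_ : ∀ e C → Dec (e ∈ C)
    e ∈? C = Any.any? (e ≟ᴬ_) C

    W : List A → (ℕ → ℕ) → ℕ
    W C f = ∑ C (λ e → w e f)

    Least : (ℕ → ℕ) → List A → Set
    Least f C = All (λ C′ → W C f ≤ W C′ f) family

    -- If the lightest member is not unique, some element lies in one lightest member but not in
    -- another (`two-lightest⇒bad`); it remains to bound these events separately.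
    Bad : A → (ℕ → ℕ) → Set
    Bad e f = Any (λ C → (e ∈ C × Least f C) × Any (λ C′ → e ∉ C′ × Least f C′) family) family

    bad? : ∀ e f → Dec (Bad e f)
    bad? e f = Any.any? (λ C → ((e ∈? C) ×-dec least? C) ×-dec Any.any? (λ C′ → ¬? (e ∈? C′) ×-dec least? C′) family) family
      where
      least? : ∀ C → Dec (Least f C)
      least? C = all? (λ C′ → W C f ≤? W C′ f) family

    W-ext : ∀ C {f g} → (∀ i → f i ≡ g i) → W C f ≡ W C g
    W-ext C e = ∑-cong C λ x _ → w-ext x e

    Bad-ext : ∀ e {f g} → (∀ i → f i ≡ g i) → Bad e f → Bad e g
    Bad-ext e {f} {g} eq = Any.map λ { {C} ((p , l) , a) → (p , conv C l) , Any.map (λ { {C′} (q , l) → q , conv C′ l }) a }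
      where
      conv : ∀ C → Least f C → Least g C
      conv C = All.map λ {C′} le → subst₂ _≤_ (W-ext C eq) (W-ext C′ eq) le

    private
      sub-unique : ∀ {C} → C ∈ subs E → Unique C
      sub-unique {C} C∈ = subst Unique (map-id C) (subs-unique id E C∈ (subst Unique (sym (map-id E)) E-unique))

    W-without : ∀ {e} → e ∈ E → ∀ C → (∀ {x} → x ∈ C → x ∈ E) → e ∉ C → ∀ f t → W C (f [ idx e ↦ t ]) ≡ W C (f [ idx e ↦ 0 ])
    W-without {e} e∈ C C⊆ e∉ f t = ∑-cong C λ x x∈ → w-other e∈ (C⊆ x∈) (λ { refl → e∉ x∈ }) f t 0

    W-with : ∀ {e} → e ∈ E → ∀ C → (∀ {x} → x ∈ C → x ∈ E) → Unique C → e ∈ C → ∀ f t → W C (f [ idx e ↦ t ]) ≡ t + W C (f [ idx e ↦ 0 ])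
    W-with e∈ (x ∷ C) C⊆ (x∉ ∷ u) (here refl) f t = trans (cong₂ _+_ (w-self e∈ f t) (W-without e∈ C (C⊆ ∘ there) (λ p → All.lookup x∉ p refl) f t)) (+-assoc t _ _)
    W-with {e} e∈ (x ∷ C) C⊆ (x∉ ∷ u) (there p) f t = trans (cong₂ _+_ (w-other e∈ (C⊆ (here refl)) (λ { refl → All.lookup x∉ p refl }) f t 0) (W-with e∈ C (C⊆ ∘ there) u p f t))
      (eq (w x (f [ idx e ↦ 0 ])) t (W C (f [ idx e ↦ 0 ])))
      where
      eq : ∀ a t b → a + (t + b) ≡ t + (a + b)
      eq = solve-∀

    private
      unpack : ∀ {e f} → Bad e f → Σ[ C ∈ List A ] Σ[ C′ ∈ List A ] (C ∈ family × C′ ∈ family × e ∈ C × e ∉ C′ × Least f C × Least f C′)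
      unpack b with C , C∈ , (p , l) , a ← find b with C′ , C′∈ , q , l′ ← find a = C , C′ , C∈ , C′∈ , p , q , l , l′

      -- The lightest weights with and without e, not counting e itself, do not
      -- depend on t, and t must be their difference.
      difference : ∀ {e} → e ∈ E → ∀ f {t t′} → Bad e (f [ idx e ↦ t ]) → Bad e (f [ idx e ↦ t′ ]) → t ≤ t′
      difference {e} e∈ f {t} {t′} b b′ with C , D , C∈ , D∈ , e∈C , e∉D , lC , lD ← unpack b
        with C′ , D′ , C′∈ , D′∈ , e∈C′ , e∉D′ , lC′ , lD′ ← unpack b′ = +-cancelʳ-≤ (W₀ C′) t t′ (begin
            t + W₀ C′
          ≡⟨ in≡ C′∈ e∈C′ t ⟨
            W C′ (f [ idx e ↦ t ])
          ≤⟨ shift-in ⟩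
            W D (f [ idx e ↦ t ])
          ≡⟨ out≡ D∈ e∉D t ⟩
            W₀ D
          ≤⟨ subst₂ _≤_ (out≡ D∈ e∉D t) (out≡ D′∈ e∉D′ t) (All.lookup lD D′∈) ⟩
            W₀ D′
          ≡⟨ out≡ D′∈ e∉D′ t′ ⟨
            W D′ (f [ idx e ↦ t′ ])
          ≤⟨ All.lookup lD′ C′∈ ⟩
            W C′ (f [ idx e ↦ t′ ])
          ≡⟨ in≡ C′∈ e∈C′ t′ ⟩
            t′ + W₀ C′ ∎)
        where
        open ≤-Reasoning
        W₀ : List A → ℕ
        W₀ C = W C (f [ idx e ↦ 0 ])
        in≡ : ∀ {C} → C ∈ family → e ∈ C → ∀ t → W C (f [ idx e ↦ t ]) ≡ t + W₀ C
        in≡ {C} C∈ p t = W-with e∈ C (subs⇒⊆ E (family⊆ C∈)) (sub-unique (family⊆ C∈)) p f t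
        out≡ : ∀ {C} → C ∈ family → e ∉ C → ∀ t → W C (f [ idx e ↦ t ]) ≡ W₀ C
        out≡ {C} C∈ p t = W-without e∈ C (subs⇒⊆ E (family⊆ C∈)) p f t
        W₀C′≤ : W₀ C′ ≤ W₀ C
        W₀C′≤ = +-cancelˡ-≤ t′ _ _ (subst₂ _≤_ (in≡ C′∈ e∈C′ t′) (in≡ C∈ e∈C t′) (All.lookup lC′ C∈))
        shift-in : W C′ (f [ idx e ↦ t ]) ≤ W D (f [ idx e ↦ t ])
        shift-in = ≤-trans (≤-reflexive (in≡ C′∈ e∈C′ t)) (≤-trans (+-monoʳ-≤ t W₀C′≤) (≤-trans (≤-reflexive (sym (in≡ C∈ e∈C t))) (All.lookup lC D∈)))

    bad-line : ∀ {e} → e ∈ E → ∀ f → ∑ (values lg 0) (λ t → 𝟙 (bad? e (f [ idx e ↦ t ]))) ≤ 1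
    bad-line {e} e∈ f = at-most-one (λ t → bad? e (f [ idx e ↦ t ])) (values-unique lg 0) λ b b′ → ≤-antisym (difference e∈ f b b′) (difference e∈ f b′ b)

    -- With all other weights fixed, at most one of the `2 ^ lg` values of the weight of `e` makes
    -- it bad. This is the bound 1 / 2 ^ lg on a probability, with denominators cleared.
    bad-count : ∀ m {e} → e ∈ E → idx e ∈ downFrom m → 2 ^ lg * sumV (m * lg) (λ ρ → 𝟙 (bad? e (table lg m ρ (λ _ → 0)))) ≤ (2 ^ lg) ^ m
    bad-count m {e} e∈ i∈ = subst₂ _≤_ (cong₂ _*_ (length-values lg 0) (sym (sumV-table lg m (λ _ → 0) _))) (cong₂ _^_ (length-values lg 0) (length-downFrom m))
      (Σ*-lines (unique-downFrom⁺ m) i∈ (λ {σ} {τ} eq → 𝟙-cong (bad? e σ) (bad? e τ) (Bad-ext e eq) (Bad-ext e (sym ∘ eq))) (bad-line e∈) (λ _ → 0))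

    private
      differ : ∀ E {C C′} → Unique E → C ∈ subs E → C′ ∈ subs E → C ≢ C′ → Σ[ e ∈ A ] (e ∈ E × (e ∈ C × e ∉ C′ ⊎ e ∉ C × e ∈ C′))
      differ [] u (here refl) (here refl) ne = contradiction refl ne
      differ (x ∷ E) {C} {C′} (x∉ ∷ u) p q ne with ∈-++⁻ (subs E) p | ∈-++⁻ (subs E) q
      ... | inj₁ p | inj₁ q with e , e∈ , r ← differ E u p q ne = e , there e∈ , r
      ... | inj₁ p | inj₂ q with D , r , refl ← ∈-map⁻ (x ∷_) q = x , here refl , inj₂ ((λ x∈ → All.lookup x∉ (subs⇒⊆ E p x∈) refl) , here refl)
      ... | inj₂ p | inj₁ q with D , r , refl ← ∈-map⁻ (x ∷_) p = x , here refl , inj₁ (here refl , λ x∈ → All.lookup x∉ (subs⇒⊆ E q x∈) refl)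
      ... | inj₂ p | inj₂ q with D , r , refl ← ∈-map⁻ (x ∷_) p with D′ , r′ , refl ← ∈-map⁻ (x ∷_) q
        with e , e∈ , s ← differ E u r r′ (ne ∘ cong (x ∷_)) = e , there e∈ , [ (λ (a , b) → inj₁ (there a , λ { (here refl) → All.lookup x∉ e∈ refl ; (there c) → b c })) , (λ (a , b) → inj₂ ((λ { (here refl) → All.lookup x∉ e∈ refl ; (there c) → a c }) , there b)) ]′ s

    two-lightest⇒bad : ∀ {f C C′} → C ∈ family → C′ ∈ family → C ≢ C′ → Least f C → Least f C′ → Σ[ e ∈ A ] (e ∈ E × Bad e f)
    two-lightest⇒bad C∈ C′∈ ne l l′ with differ E E-unique (family⊆ C∈) (family⊆ C′∈) ne
    ... | e , e∈ , inj₁ (p , q) = e , e∈ , lose C∈ ((p , l) , lose C′∈ (q , l′))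
    ... | e , e∈ , inj₂ (p , q) = e , e∈ , lose C′∈ ((q , l′) , lose C∈ (p , l))

-- From the bits of the sum to the answer.

window-zero : ∀ f u k → (∀ j → j < k → f (u + j) ≡ 0) → ∀ a → window f u k a ≡ a
window-zero f u zero    z a = refl
window-zero f u (suc k) z a rewrite trans (cong f (sym (+-identityʳ u))) (z 0 (s≤s z≤n)) =
  window-zero f (suc u) k (λ j j<k → trans (cong f (sym (+-suc u j))) (z (suc j) (s≤s j<k))) a

windows-zero : ∀ f b k u c → (∀ w j → w < c → j < k → f (u + w * b + j) ≡ 0) → ∀ a → windows f b k u c a ≡ a
windows-zero f b k u zero    z a = refl
windows-zero f b k u (suc c) z a = trans (cong (windows f b k (u + b) c) (window-zero f u k (λ j j<k → trans (cong (λ x → f (x + j)) (sym (+-identityʳ u))) (z 0 j (s≤s z≤n) j<k)) a))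
  (windows-zero f b k (u + b) c (λ w j w<c j<k → trans (cong (λ x → f (x + j)) (+-assoc u b (w * b))) (z (suc w) j (s≤s w<c) j<k)) a)

window-≡0 : ∀ f u k a → window f u k a ≡ 0 → a ≡ 0 × (∀ j → j < k → f (u + j) ≡ 0)
window-≡0 f u zero    a e = e , λ _ ()
window-≡0 f u (suc k) a e with f u in fu | window-≡0 f (suc u) k _ e
... | zero  | a0 , z = a0 , λ { zero _ → trans (cong f (+-identityʳ u)) fu ; (suc j) (s≤s j<k) → trans (cong f (+-suc u j)) (z j j<k) }
... | suc _ | () , _

windows-≡0 : ∀ f b k u c a → windows f b k u c a ≡ 0 → a ≡ 0 × (∀ w j → w < c → j < k → f (u + w * b + j) ≡ 0)
windows-≡0 f b k u zero    a e = e , λ _ _ ()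
windows-≡0 f b k u (suc c) a e with wz , z ← windows-≡0 f b k (u + b) c _ e with a0 , z₀ ← window-≡0 f u k a wz = a0 ,
  λ { zero j _ j<k → trans (cong (λ x → f (x + j)) (+-identityʳ u)) (z₀ j j<k)
    ; (suc w) j (s≤s w<c) j<k → trans (cong (λ x → f (x + j)) (sym (+-assoc u b (w * b)))) (z w j w<c j<k) }

unique-map⁻ : ∀ (g : A → A′) {xs} → Unique (map g xs) → Unique xs
unique-map⁻ g {[]} u = []
unique-map⁻ g {x ∷ xs} (x∉ ∷ u) = All.tabulate (λ y∈ → λ { refl → All.lookup x∉ (∈-map⁺ g y∈) refl }) ∷ unique-map⁻ g u

unique-map-injective : ∀ (g : A → A′) {xs} → Unique (map g xs) → ∀ {x y} → x ∈ xs → y ∈ xs → g x ≡ g y → x ≡ y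
unique-map-injective g (x∉ ∷ u) (here refl) (here refl) e = refl
unique-map-injective g (x∉ ∷ u) (here refl) (there y∈)  e = contradiction e (All.lookup x∉ (∈-map⁺ g y∈))
unique-map-injective g (x∉ ∷ u) (there x∈)  (here refl) e = contradiction (sym e) (All.lookup x∉ (∈-map⁺ g x∈))
unique-map-injective g (x∉ ∷ u) (there x∈)  (there y∈)  e = unique-map-injective g u x∈ y∈ e

∑-≤ : ∀ (xs : List A) {f c} → (∀ x → f x ≤ c) → ∑ xs f ≤ length xs * c
∑-≤ xs {f} {c} le = ≤-trans (∑-mono xs (λ x _ → le x)) (≤-reflexive (∑-const xs c))

∣-𝟙 : ∀ {P : Set} {d y} (p : Dec P) → (P → d ∣ y) → d ∣ 𝟙 p * y
∣-𝟙 {d = d} (yes p) div = subst (d ∣_) (sym (+-identityʳ _)) (div p)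
∣-𝟙 {d = d} (no _)  div = d ∣0

subs-length : ∀ (E : List A) {C} → C ∈ subs E → length C ≤ length E
subs-length []      (here refl) = z≤n
subs-length (e ∷ E) C∈ with ∈-++⁻ (subs E) C∈
... | inj₁ p = m≤n⇒m≤1+n (subs-length E p)
... | inj₂ p with C , r , refl ← ∈-map⁻ (e ∷_) p = s≤s (subs-length E r)

module Answer {n : ℕ} (G : Graph n) {π : List (Fin n)} (π-unique : Unique π) (π-complete : ∀ v → v ∈ π) (π-length : length π ≡ n)
  (b q Q lg four k′ : ℕ) (Q≡ : Q ≡ q * suc n) (b> : 2 * (n * n) + n < b) (q> : n * n * (four + four) < q)
  (k′≤b : k′ ≤ b) {ℓ : ℕ} (ℓ≤n : ℓ ≤ n) where

  open Degrees {n}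
  open CycleCovers {n}
  open EdgeOrder (adj G)
  open EdgeLists G

  E : List Arc
  E = edgesFrom (λ _ → false) π

  E-lists : Lists G E
  E-lists = edges-lists π-unique π-complete
  open Lists E-lists

  E-length : length E ≤ n * n
  E-length = ≤-trans (length-edges (λ _ → false) π) (≤-reflexive (cong (_* n) π-length))

  idx : Arc → ℕ
  idx (u , v) = toℕ u * n + toℕ v

  ω : (ℕ → ℕ) → Fin n → Fin n → ℕ
  ω f u v = f (idx (u , v))

  covers# : List Arc → ℕ
  covers# C = ∑ (orients C) (λ D → 𝟙 (balanced? D π (n ∸ ℓ)))

  module Value (f : ℕ → ℕ) where
    open Weights (adj G) (b * Q) (b * (Q + q)) (λ u v → b * ω f u v) slots
    open Expansion (adj G) b Q q (ω f) {π} π-unique π-complete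

    Z : ℕ
    Z = naive π (λ _ → ∅)

    Z≡ : Z ≡ ∑ (exponents E) ((2 ^ b) ^_)
    Z≡ = trans (naive-expand (irrefl G) (λ _ → false) π-unique (λ _ _ → refl) (λ _ → ∅) (λ _ _ → refl)) (expansion E)

    answer# : ℕ
    answer# = windows (bitAt Z) b k′ (b * Q * n + b * q * (n ∸ ℓ)) q 0

    coefficient# : ℕ → ℕ
    coefficient# w = ∑ (subs E) (λ C → 𝟙 (weight C ≟ w) * covers# C)

    module _ (bounded : ∀ i → f i ≤ four) where

      light : ∀ C → C ∈ subs E → weight C < q
      light C C∈ = ≤-<-trans (≤-trans (∑-≤ C (λ _ → +-mono-≤ (bounded _) (bounded _))) (*-monoˡ-≤ (four + four) (≤-trans (subs-length E C∈) E-length))) q>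

      short : length (exponents E) < 2 ^ b
      -- `3 ^ length E` is rounded up to `4 ^ (n * n)`, giving `2 ^ (2 * (n * n) + n)` altogether.
      short = ≤-<-trans (≤-trans (≤-reflexive (length-exponents E)) (≤-trans (*-mono-≤ (≤-trans (^-monoˡ-≤ (length E) (n≤1+n 3)) (^-monoʳ-≤ 4 E-length)) (≤-reflexive (cong (2 ^_) π-length)))
          (≤-reflexive (trans (cong (_* 2 ^ n) (^-*-assoc 2 2 (n * n))) (sym (^-distribˡ-+-* 2 (2 * (n * n)) n))))))
        (^-monoʳ-< 2 ≤-refl b>)

      private
        position : ∀ w j → b * Q * n + b * q * (n ∸ ℓ) + w * b + j ≡ b * target (n ∸ ℓ) w + j
        position w j = cong (_+ j) (trans (eq b Q q n (n ∸ ℓ) w) (cong (λ l → b * (Q * l + (q * (n ∸ ℓ) + w))) (sym π-length)))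
          where
          eq : ∀ b Q q n t w → b * Q * n + b * q * t + w * b ≡ b * (Q * n + (q * t + w))
          eq = solve-∀

        parts : ∀ w → w < q → Σ[ lo ∈ ℕ ] Σ[ hi ∈ ℕ ] (Z ≡ lo + (coefficient# w + 2 ^ b * hi) * 2 ^ (b * target (n ∸ ℓ) w) × lo < 2 ^ (b * target (n ∸ ℓ) w))
        parts w w<q with lo , hi , e , l ← coefficient (2 ^ b) (exponents E) (target (n ∸ ℓ) w) short = lo , hi ,
          trans Z≡ (trans e (cong₂ (λ c p → lo + (c + 2 ^ b * hi) * p) (count-exponents (trans Q≡ (cong (λ l → q * suc l) (sym π-length))) E light (≤-trans (m∸n≤m n ℓ) (≤-reflexive (sym π-length))) w<q)
            (^-*-assoc 2 b (target (n ∸ ℓ) w)))) ,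
          subst (lo <_) (^-*-assoc 2 b (target (n ∸ ℓ) w)) l

        bits : ∀ {w} → w < q → Σ[ hi ∈ ℕ ] (∀ j → bitAt Z (b * Q * n + b * q * (n ∸ ℓ) + w * b + j) ≡ bitAt (coefficient# w + 2 ^ b * hi) j)
        bits {w} w<q with lo , hi , e , l ← parts w w<q = hi , λ j →
          trans (cong₂ bitAt e (position w j)) (bitAt-shift lo (coefficient# w + 2 ^ b * hi) (b * target (n ∸ ℓ) w) j l)

        -- What lies above a coefficient is a multiple of `2 ^ b`, so it cannot disturb the `k′` low
        -- bits that are inspected.
        2^k′∣2^b* : ∀ y → 2 ^ k′ ∣ 2 ^ b * y
        2^k′∣2^b* y with o , refl ← m≤n⇒∃[o]m+o≡n k′≤b = ∣-trans (subst (2 ^ k′ ∣_) (sym (^-distribˡ-+-* 2 k′ o)) (m∣m*n (2 ^ o))) (m∣m*n y)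

      no⇒divisible : answer# ≡ 0 → ∀ w → w < q → 2 ^ k′ ∣ coefficient# w
      no⇒divisible e w w<q = let hi , bit≡ = bits w<q in ∣m+n∣m⇒∣n (subst (2 ^ k′ ∣_) (+-comm (coefficient# w) (2 ^ b * hi)) (bits-zero⇒∣ (coefficient# w + 2 ^ b * hi) k′ λ j j<k →
          trans (sym (bit≡ j)) (proj₂ (windows-≡0 (bitAt Z) b k′ _ q 0 e) w j w<q j<k))) (2^k′∣2^b* hi)

      divisible⇒no : (∀ w → w < q → 2 ^ k′ ∣ coefficient# w) → answer# ≡ 0
      divisible⇒no div = windows-zero (bitAt Z) b k′ _ q (λ w j w<q j<k → let hi , bit≡ = bits w<q in
        trans (bit≡ j) (∣⇒bits-zero _ k′ (∣m∣n⇒∣m+n (div w w<q) (2^k′∣2^b* hi)) j j<k)) 0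

      -- Each coefficient is a sum of these counts with factors 0 or 1, whatever the weights are.
      -- Hence no choice of coins produces a false positive.
      answer-no : (∀ C → C ∈ subs E → 2 ^ k′ ∣ covers# C) → answer# ≡ 0
      answer-no div = divisible⇒no λ w _ → ∣-∑ (subs E) λ C C∈ → ∣-trans (div C C∈) (n∣m*n (𝟙 (weight C ≟ w)))
        where
        ∣-∑ : ∀ xs {g} → (∀ C → C ∈ xs → 2 ^ k′ ∣ g C) → 2 ^ k′ ∣ ∑ xs g
        ∣-∑ []       h = (2 ^ k′) ∣0
        ∣-∑ (x ∷ xs) h = ∣m∣n⇒∣m+n (h x (here refl)) (∣-∑ xs λ y → h y ∘ there)

  _≟ᴱ_ : (e e′ : Arc) → Dec (e ≡ e′)
  _≟ᴱ_ = ×-≡-dec _≟ᶠ_ _≟ᶠ_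

  odd? : ∀ C → Dec (¬ 2 ^ k′ ∣ covers# C)
  odd? C = ¬? (2 ^ k′ ∣? covers# C)

  family : List (List Arc)
  family = filter odd? (subs E)

  idx-injective : ∀ e e′ → idx e ≡ idx e′ → e ≡ e′
  idx-injective (u , v) (u′ , v′) eq with p , r ← radix n {toℕ u} {toℕ u′} (toℕ<n v) (toℕ<n v′) (trans (cong (_+ toℕ v) (*-comm n (toℕ u))) (trans eq (cong (_+ toℕ v′) (*-comm (toℕ u′) n)))) =
    cong₂ _,_ (toℕ-injective p) (toℕ-injective r)

  arcWeight : Arc → (ℕ → ℕ) → ℕ
  arcWeight (u , v) f = ω f u v + ω f v u

  open Assignments {ℕ} {ℕ} _≟_ (values lg 0) using (_[_↦_]; ↦-≡; ↦-≢)

  private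
    untouched : ∀ f e {e′} t t′ → e ≢ e′ → (f [ idx e ↦ t ]) (idx e′) ≡ (f [ idx e ↦ t′ ]) (idx e′)
    untouched f e {e′} t t′ ne = trans (↦-≢ f (idx e) t (ne ∘ idx-injective e e′)) (sym (↦-≢ f (idx e) t′ (ne ∘ idx-injective e e′)))

    -- Two table entries enter the weight of an edge, but only the one in its listed direction is
    -- varied; the reverse entry is a constant offset. Since `E` lists no edge in both directions,
    -- varying the entry of `e` leaves all other edges alone.
    w-other : ∀ {e e′} → e ∈ E → e′ ∈ E → e ≢ e′ → ∀ f t t′ → arcWeight e′ (f [ idx e ↦ t ]) ≡ arcWeight e′ (f [ idx e ↦ t′ ])
    w-other {e} {u , v} e∈ e′∈ ne f t t′ = cong₂ _+_ (untouched f e t t′ ne)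
      (untouched f e {v , u} t t′ λ { refl → ne (unique-map-injective norm once e∈ e′∈ (norm-swap v u)) })

    w-self : ∀ {e} → e ∈ E → ∀ f t → arcWeight e (f [ idx e ↦ t ]) ≡ t + arcWeight e (f [ idx e ↦ 0 ])
    w-self {u , v} e∈ f t = trans (cong₂ _+_ (↦-≡ f (idx (u , v)) t) (untouched f (u , v) {v , u} t 0 loop))
        (cong (λ z → t + (z + (f [ idx (u , v) ↦ 0 ]) (idx (v , u)))) (sym (↦-≡ f (idx (u , v)) 0)))
      where
      loop : (u , v) ≢ (v , u)
      loop e with refl ← cong proj₁ e = contradiction (trans (sym (listed e∈)) (irrefl G u)) λ ()

  open Isolation lg _≟ᴱ_ {E} (unique-map⁻ norm once) idx arcWeight (λ e eq → cong₂ _+_ (eq _) (eq _)) w-other w-self family (λ C∈ → proj₁ (∈-filter⁻ odd? C∈)) public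

  -- Consider the coefficient at the weight of a lightest member `C₀` of the family. Edge sets
  -- outside the family contribute multiples of `2 ^ k′`, even if they have the same weight. Without
  -- a second family member of this weight the coefficient is therefore not divisible, contrary to
  -- the answer 0.
  no⇒bad : ∀ {C} → C ∈ subs E → ¬ 2 ^ k′ ∣ covers# C → ∀ f → (∀ i → f i ≤ four) → Value.answer# f ≡ 0 → Σ[ e ∈ Arc ] (e ∈ E × Bad e f)
  no⇒bad C∈ odd f bounded ans≡0 with C₀ , C₀∈ , least ← argmin (λ C → W C f) {family} (∈-filter⁺ odd? C∈ odd)
    with ∈-filter⁻ odd? {xs = subs E} C₀∈
  ... | C₀∈subs , odd₀ with Any.any? (λ C → ¬? (≡-dec _≟ᴱ_ C C₀) ×-dec ((W C f ≟ W C₀ f) ×-dec odd? C)) (subs E)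
  ...   | yes other with C₁ , C₁∈ , C₁≢C₀ , same , odd₁ ← find other =
    two-lightest⇒bad {f} C₀∈ (∈-filter⁺ odd? C₁∈ odd₁) (C₁≢C₀ ∘ sym) (All.tabulate (least _)) (All.tabulate λ C∈ → ≤-trans (≤-reflexive same) (least _ C∈))
  ...   | no none = contradiction (subst (2 ^ k′ ∣_) (trans (cong (_* covers# C₀) (𝟙-yes (W C₀ f ≟ W C₀ f) refl)) (+-identityʳ _))
      (∣-except (λ C → 𝟙 (W C f ≟ W C₀ f) * covers# C) (subs-Unique (unique-map⁻ norm once)) C₀∈subs others
        (Value.no⇒divisible f bounded ans≡0 (W C₀ f) (Value.light f bounded C₀ C₀∈subs)))) odd₀
    where
    others : ∀ C → C ∈ subs E → C ≢ C₀ → 2 ^ k′ ∣ 𝟙 (W C f ≟ W C₀ f) * covers# C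
    others C C∈ ne = ∣-𝟙 (W C f ≟ W C₀ f) λ e → decidable-stable (2 ^ k′ ∣? covers# C) λ odd → none (lose C∈ (ne , e , odd))

  idx< : ∀ e → idx e < n * n
  idx< (u , v) = ≤-trans (≤-reflexive (sym (+-suc (toℕ u * n) (toℕ v)))) (≤-trans (+-monoʳ-≤ (toℕ u * n) (toℕ<n v)) (≤-trans (≤-reflexive (+-comm (toℕ u * n) n)) (*-monoˡ-≤ n (toℕ<n u))))

-- The encoded input.

read-++ˡ : ∀ xs {ys i} → i < length xs → read (xs ++ ys) i ≡ read xs i
read-++ˡ (x ∷ xs) {i = zero}  p       = refl
read-++ˡ (x ∷ xs) {i = suc i} (s≤s p) = read-++ˡ xs p

read-++ʳ : ∀ xs {ys} i → read (xs ++ ys) (length xs + i) ≡ read ys i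
read-++ʳ []       i = refl
read-++ʳ (x ∷ xs) i = read-++ʳ xs i

read-tabulate : ∀ {n} (g : Fin n → ℕ) v → read (tabulate g) (toℕ v) ≡ g v
read-tabulate g zero    = refl
read-tabulate g (suc v) = read-tabulate (g ∘ suc) v

module _ {n k : ℕ} (f : Fin n → Fin k → ℕ) where

  product-length : ∀ xs → length (cartesianProductWith f xs (allFin k)) ≡ length xs * k
  product-length []       = refl
  product-length (x ∷ xs) = trans (length-++ (map (f x) (allFin k))) (cong₂ _+_ (trans (length-map (f x) (allFin k)) (length-tabulate {n = k} id)) (product-length xs))

  read-product : ∀ {m} (h : Fin m → Fin n) u v → read (cartesianProductWith f (tabulate h) (allFin k)) (toℕ u * k + toℕ v) ≡ f (h u) v
  read-product h zero v = trans (read-++ˡ (map (f (h zero)) (allFin k)) (subst (toℕ v <_) (sym (trans (length-map (f (h zero)) (allFin k)) (length-tabulate {n = k} id))) (toℕ<n v)))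
    (trans (cong (λ xs → read xs (toℕ v)) (map-tabulate id (f (h zero)))) (read-tabulate (f (h zero)) v))
  read-product h (suc u) v = trans (cong (read (map (f (h zero)) (allFin k) ++ rest)) (trans (+-assoc k (toℕ u * k) (toℕ v)) (cong (_+ (toℕ u * k + toℕ v)) (sym (trans (length-map (f (h zero)) (allFin k)) (length-tabulate {n = k} id))))))
    (trans (read-++ʳ (map (f (h zero)) (allFin k)) (toℕ u * k + toℕ v)) (read-product (h ∘ suc) u v))
    where
    rest : List ℕ
    rest = cartesianProductWith f (tabulate (h ∘ suc)) (allFin k)

module Encoding {n : ℕ} (G : Graph n) (k ℓ : ℕ) (F : RootedForest n) where

  private
    matrix parents : List ℕ
    matrix = cartesianProductWith (λ u v → bit (adj G u v)) (allFin n) (allFin n)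
    parents = map (λ v → maybe (λ u → suc (toℕ u)) 0 (parent F v)) (allFin n)

    matrix-length : length matrix ≡ n * n
    matrix-length = trans (product-length (λ u v → bit (adj G u v)) (allFin n)) (cong (_* n) (length-tabulate {n = n} id))

  read-adj : ∀ u v → read (encode G k ℓ F) (3 + toℕ u * n + toℕ v) ≡ bit (adj G u v)
  read-adj u v = trans (read-++ˡ matrix (subst (toℕ u * n + toℕ v <_) (sym matrix-length) inside))
      (read-product (λ u v → bit (adj G u v)) id u v)
    where
    inside : toℕ u * n + toℕ v < n * n
    inside = ≤-trans (≤-reflexive (sym (+-suc (toℕ u * n) (toℕ v)))) (≤-trans (+-monoʳ-≤ (toℕ u * n) (toℕ<n v)) (≤-trans (≤-reflexive (+-comm (toℕ u * n) n)) (*-monoˡ-≤ n (toℕ<n u))))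

  read-parent : ∀ v → read (encode G k ℓ F) (3 + n * n + toℕ v) ≡ code (parent F v)
  read-parent v = trans (cong (λ z → read (matrix ++ parents) (z + toℕ v)) (sym matrix-length)) (trans (read-++ʳ matrix (toℕ v))
    (trans (cong (λ xs → read xs (toℕ v)) (map-tabulate id (λ v → maybe (λ u → suc (toℕ u)) 0 (parent F v)))) (read-tabulate _ v)))

-- The sizes of the numbers and the run of the program.

table-bounded : ∀ lg m ρ f {c} → 2 ^ lg ≤ c → (∀ i → f i ≤ c) → ∀ i → table lg m ρ f i ≤ c
table-bounded lg zero    ρ f le bd i = bd i
table-bounded lg (suc m) ρ f {c} le bd i = table-bounded lg m _ _ le new i
  where
  new : ∀ i → upd f m (value 0 (Vec.take lg ρ)) i ≤ c
  new i with m ≡ᵇ i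
  ... | true  = ≤-trans (<⇒≤ (value< 0 (Vec.take lg ρ))) (≤-trans (≤-reflexive (+-identityʳ _)) le)
  ... | false = bd i

-- The traversal is paid for separately: `g` is the allowance that `tm` makes for its rounds, and
-- `s` is the time these rounds really take, which `g` need not cover.
budget : ∀ a κe r c w t g κg x y z s → a + suc (κe + (r + (c + (w + (t + ((s + κg) + (x + (y + z)))))))) ≤
         a + suc (κe + (1 + (r + (c + (w + (t + ((g + κg) + (x + (y + z))))))))) + s
budget a κe r c w t g κg x y z s = ≤-trans (m≤m+n _ (1 + g)) (≤-reflexive (eq a κe r c w t g κg x y z s))
  where
  eq : ∀ a κe r c w t g κg x y z s → a + (1 + (κe + (r + (c + (w + (t + ((s + κg) + (x + (y + z))))))))) + (1 + g) ≡
       a + (1 + (κe + (1 + (r + (c + (w + (t + ((g + κg) + (x + (y + z)))))))))) + s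
  eq = solve-∀

-- Equations between fields instead of definitions keep all constants symbolic during the
-- simulation. `B` is a common bound for loop rounds, indices and the bit lengths of values.
record Sizes (n : ℕ) : Set where
  field
    b four q Q h P B lg : ℕ
    b≡    : n * n + n * n + n + 1 ≡ b
    four≡ : n * n + n * n + n * n + n * n + 1 ≡ four
    q≡    : four * (n * n + n * n) + 1 ≡ q
    Q≡    : q * (n + 1) ≡ Q
    h≡    : 3 + (b * (Q + q) + (b * four + b * four)) ≡ h
    P≡    : (2 + h * (3 + n)) * n ≡ P
    lg≥   : n * n + n * n ≤ 2 ^ lg
    lg<   : ∀ j → j < lg → 2 ^ j < n * n + n * n
    lg≤   : 2 ^ lg ≤ four
    P<B   : suc P < B
    n<B   : suc n < B
    NN≤   : n * n ≤ B
    b≤    : b ≤ B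
    four≤ : four ≤ B
    q≤    : q ≤ B
    Q≤    : Q ≤ B
    bq≤   : b * q ≤ B
    b4≤   : b * four ≤ B
    h≤    : h ≤ B
    end≤  : q * b + (b * Q * n + b * q * n) + suc n ≤ B

module Execution {n : ℕ} (G : Graph n) (k ℓ : ℕ) (F : RootedForest n) (sizes : Sizes n) where
  open Sizes sizes
  open ForestFacts F

  inputs : List ℕ
  inputs = encode G k ℓ F

  open Encoding G k ℓ F

  I : ℕ
  I = B + 17

  17≤I : 17 ≤ I
  17≤I = m≤n+m 17 B

  B≤I : B ≤ I
  B≤I = m≤m+n B 17

  open Machine inputs I B B 17≤I
  open Phases inputs I B B 17≤I n B≤I ≤-refl

  -- Stated for arbitrary commands, so that their running times stay symbolic.
  pipeline : ∀ {C c₀ e c₁ c₂ c₃ c₄ g d c₅ c₆ c₇ s₀ s₁ s₂ s₃ s₄ s₅ s₆ s₇ s₈ s₉ ρ₀ ρ₁ ρ₂ ρ₃ ρ₄ ρ₅ ρ₆ ρ₇ ρ₈ ρ₉ s} →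
    C ≡ (c₀ ⨟ If e nop (c₁ ⨟ c₂ ⨟ c₃ ⨟ c₄ ⨟ While g d ⨟ c₅ ⨟ c₆ ⨟ c₇)) →
    Do c₀ s₀ ρ₀ s₁ ρ₁ → ev e s₁ ≡ 0 → Do c₁ s₁ ρ₁ s₂ ρ₂ → Do c₂ s₂ ρ₂ s₃ ρ₃ → Do c₃ s₃ ρ₃ s₄ ρ₄ → Do c₄ s₄ ρ₄ s₅ ρ₅ →
    Ex (While g d) s₅ ρ₅ s₆ ρ₆ (s + suc (κ g)) → Do c₅ s₆ ρ₆ s₇ ρ₇ → Do c₆ s₇ ρ₇ s₈ ρ₈ → Do c₇ s₈ ρ₈ s₉ ρ₉ →
    Ex C s₀ ρ₀ s₉ ρ₉ (tm B C + s)
  pipeline {c₀ = c₀} {e} {c₁} {c₂} {c₃} {c₄} {g} {d} {c₅} {c₆} {c₇} {s = s} refl x₀ e≡0 x₁ x₂ x₃ x₄ y x₅ x₆ x₇ =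
    within (budget (tm B c₀) (κ e) (tm B c₁) (tm B c₂) (tm B c₃) (tm B c₄) (B * suc (κ g + tm B d)) (suc (κ g)) (tm B c₅) (tm B c₆) (tm B c₇) s)
      (seqE x₀ (elseE e≡0 (seqE x₁ (seqE x₂ (seqE x₃ (seqE x₄ (seqE y (seqE x₅ (seqE x₆ x₇)))))))))

  rejection : ∀ {C c₀ e d s₀ s₁ ρ₀ ρ₁} → C ≡ (c₀ ⨟ If e nop d) → Do c₀ s₀ ρ₀ s₁ ρ₁ → ev e s₁ ≢ 0 → Ex C s₀ ρ₀ s₁ ρ₁ (tm B C)
  rejection refl x₀ e≢0 = x₀ ▸ ifT e≢0 nopE

  Z₀ : ℕ → ℕ
  Z₀ _ = 0

  k′ : ℕ
  k′ = suc (n ∸ (n ∸ k))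

  base : ℕ
  base = b * Q * n + b * q * (n ∸ ℓ)

  start : State
  start = st 0 0 0 0 0 0 0 0 0 0 0 0 0 0 0 0 0 0 Z₀ Z₀ Z₀ Z₀ Z₀ Z₀ Z₀

  Rep-start : Rep [] start
  Rep-start = rep (λ x → sym (zeros x)) (λ a i → sym (zerosᵃ a i)) z≤n []
    where
    zeros : ∀ x → getᵗ (proj₁ start) x ≡ 0
    zeros = getᵗ-replicate 18
      where
      replicateᵗ : ∀ k → Tup ℕ k
      replicateᵗ zero    = tt
      replicateᵗ (suc k) = 0 , replicateᵗ k
      getᵗ-replicate : ∀ k x → getᵗ (replicateᵗ k) x ≡ 0
      getᵗ-replicate (suc k) zero    = refl
      getᵗ-replicate (suc k) (suc x) = getᵗ-replicate k x
    zerosᵃ : ∀ a i → getᵗ (proj₂ start) a i ≡ 0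
    zerosᵃ = getᵗ-replicate 7
      where
      replicateᵗ : ∀ k → Tup (ℕ → ℕ) k
      replicateᵗ zero    = tt
      replicateᵗ (suc k) = Z₀ , replicateᵗ k
      getᵗ-replicate : ∀ k a i → getᵗ (replicateᵗ k) a i ≡ 0
      getᵗ-replicate (suc k) zero    i = refl
      getᵗ-replicate (suc k) (suc a) i = getᵗ-replicate k a i

  reject : n < ℓ → ∀ ρ → Σ[ fin ∈ State ] (getᵗ (proj₁ fin) vAns ≡ 0 × Ex MAIN start ρ fin ρ (tm B MAIN))
  reject n<ℓ ρ = _ , refl , rejection refl (asg (V≥ (<⇒≤ (<⇒≤ n<B)))) (m>n⇒m∸n≢0 n<ℓ)

  module _ (ρ : Vec Bool (n * n * lg)) where

    f : ℕ → ℕ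
    f = table lg (n * n) ρ Z₀

    wt : Fin n → Fin n → ℕ
    wt u v = b * f (toℕ u * n + toℕ v)

    open Weights (adj G) (b * Q) (b * (Q + q)) wt slots
    open Tree (parent F)

    Z : ℕ
    Z = forestAcc (depth F) nothing (λ _ → ∅) 1 (allFin n)

    private
      Row W : ℕ → ℕ
      Row = rows n n Z₀
      W = scaled b lg (n * n) ρ Z₀

      f≤ : ∀ i → f i ≤ four
      f≤ = table-bounded lg (n * n) ρ Z₀ lg≤ (λ _ → z≤n)

      cL≤h : b * (Q + q) < h
      cL≤h = ≤-trans (s≤s (m≤m+n (b * (Q + q)) _)) (≤-trans (m≤n+m _ 2) (≤-reflexive h≡))

      cQ≤cL : b * Q ≤ b * (Q + q)
      cQ≤cL = *-monoʳ-≤ b (m≤m+n Q q)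

      shift≤h : ∀ u v → 2 + (b * Q + wt u v + wt v u) ≤ h
      shift≤h u v = ≤-trans (s≤s (s≤s (≤-trans (≤-reflexive (+-assoc (b * Q) _ _)) (+-mono-≤ cQ≤cL (+-mono-≤ (*-monoʳ-≤ b (f≤ _)) (*-monoʳ-≤ b (f≤ _))))))) (≤-trans (n≤1+n _) (≤-reflexive h≡))

    open Traverse inputs I B B 17≤I {n} (adj G) (parent F) wt b q (b * Q) (b * (Q + q)) base Row W Z₀
      (λ u → rows≡ n n Z₀ (toℕ u) (toℕ<n u)) (λ u v → scaled≡ b lg (n * n) ρ Z₀ Z₀ (λ _ → sym (*-zeroʳ b)) (toℕ u * n + toℕ v))
      read-adj read-parent h (≤-trans cQ≤cL (<⇒≤ cL≤h)) cL≤h shift≤h h≤ h≤ n<B (≤-trans (<⇒≤ (<⇒≤ n<B)) B≤I) (<⇒≤ (<⇒≤ n<B))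
      using (cf; K; Φ; stepsF; stepsF≤; forestAcc≤; scanned; reflects; clear; module Levels)

    private
      n≤B : n ≤ B
      n≤B = <⇒≤ (<⇒≤ n<B)

      Φ≡ : Φ ^ n ≡ 2 ^ P
      Φ≡ = trans (cong (_^ n) (trans (cong (4 *_) (^-*-assoc 2 h (3 + n))) (sym (^-distribˡ-+-* 2 2 (h * (3 + n)))))) (trans (^-*-assoc 2 (2 + h * (3 + n)) n) (cong (2 ^_) P≡))

      Z≤ : Z ≤ 2 ^ P
      Z≤ = ≤-trans (forestAcc≤ (depth F) nothing (λ _ → ∅) 1 (allFin n)) (≤-reflexive (trans (+-identityʳ _) (trans (cong (Φ ^_) length-dfs) Φ≡)))

    traversal : Ex TRAVERSE (cf 1 0 1 Z₀ Z₀ Z₀ Z₀) [] (cf Z 0 (suc n) Z₀ Z₀ Z₀ Z₀) [] (stepsF (depth F) nothing (allFin n) * K + suc (κ guard))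
    traversal = Levels.scan (RootedForest.level F) (depth F) level≡ level≤depth (depth F) nothing (λ _ → ∅) 1 refl
      (reflects (λ _ → refl) (λ _ → refl)) (clear (λ _ _ → refl , refl , refl , refl)) (asc-allFin n)
      (≤-trans (≤-reflexive (trans (+-identityʳ _) (trans (cong (Φ ^_) length-dfs) Φ≡))) (^-monoʳ-≤ 2 (<⇒≤ (<⇒≤ P<B))))
      (doneE (scanned {suc n} refl))

    result : ℕ
    result = windows (bitAt Z) b k′ base q 0

    time≤ : ℕ
    time≤ = tm B MAIN + stepsF (depth F) nothing (allFin n) * K

    time≤-bound : time≤ ≤ 4 ^ depth F * (tm B MAIN + (n + (n + 2) * n) * stepTime B)
    time≤-bound = begin
        tm B MAIN + stepsF (depth F) nothing (allFin n) * K
      ≤⟨ +-mono-≤ (m≤n*m (tm B MAIN) (4 ^ depth F) {{m^n≢0 4 (depth F)}}) (*-monoˡ-≤ K (stepsF≤ (depth F) nothing (allFin n))) ⟩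
        4 ^ depth F * tm B MAIN + (length (allFin n) + (n + 2) * 4 ^ depth F * length dfs) * K
      ≡⟨ cong₂ (λ l m → 4 ^ depth F * tm B MAIN + (l + (n + 2) * 4 ^ depth F * m) * K) (length-tabulate {n = n} id) length-dfs ⟩
        4 ^ depth F * tm B MAIN + (n + (n + 2) * 4 ^ depth F * n) * K
      ≤⟨ +-monoʳ-≤ (4 ^ depth F * tm B MAIN) (*-monoˡ-≤ K (+-monoˡ-≤ ((n + 2) * 4 ^ depth F * n) (m≤n*m n (4 ^ depth F) {{m^n≢0 4 (depth F)}}))) ⟩
        4 ^ depth F * tm B MAIN + (4 ^ depth F * n + (n + 2) * 4 ^ depth F * n) * K
      ≡⟨ eq (4 ^ depth F) (tm B MAIN) n (n + 2) K ⟩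
        4 ^ depth F * (tm B MAIN + (n + (n + 2) * n) * K) ∎
      where
      open ≤-Reasoning
      eq : ∀ p t n m k → p * t + (p * n + m * p * n) * k ≡ p * (t + (n + m * n) * k)
      eq = solve-∀

    main : ℓ ≤ n → Σ[ fin ∈ State ] (getᵗ (proj₁ fin) vAns ≡ result × Ex MAIN start (toList ρ) fin [] time≤)
    -- The exponent is `suc P` and not `P` because `Z ≤ 2 ^ P` only ensures that `2 * Z` fits below
    -- it, as the search for a power exceeding `Z` requires.
    main ℓ≤n = finish (powersE {base = base} Z (suc P) P<B (≤-trans (*-monoʳ-≤ 2 Z≤) ≤-refl) (λ _ → refl))
      where
      open Setup Z₀ n≤B NN≤
      open ConstantsE ℓ (n * n) b four q Q (b * Q) (b * q) (b * (Q + q)) (b * Q * n) (b * q * (n ∸ ℓ)) base refl b≡ four≡ q≡ Q≡ refl refl (sym (*-distribˡ-+ b Q q)) refl refl refl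
        b≤ q≤ four≤ Q≤ (≤-trans cQ≤cL (≤-trans (<⇒≤ cL≤h) h≤)) bq≤ (≤-trans (<⇒≤ cL≤h) h≤)
        (≤-trans (+-monoʳ-≤ (b * Q * n) (*-monoʳ-≤ (b * q) (m∸n≤m n ℓ))) (≤-trans (≤-trans (m≤n+m _ (q * b)) (m≤m+n _ (suc n))) end≤))
      open WeightsE (n * n) b q (b * Q) (b * (Q + q)) base lg lg≥ lg< NN≤ (≤-trans (≤-trans (<⇒≤ (n<2^n lg)) lg≤) four≤) (≤-trans lg≤ four≤) (≤-trans (*-monoʳ-≤ b lg≤) b4≤)
      open ReadOut k (n * n) b q (b * Q) (b * (Q + q)) refl {0} {suc n} {Row} {W} {Z₀} {Z₀} {Z₀} {Z₀} {[]} using (powersE; bitsE; windowsE)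
      end′ : q * b + base + k′ ≤ B
      end′ = ≤-trans (+-mono-≤ (+-monoʳ-≤ (q * b) (+-monoʳ-≤ (b * Q * n) (*-monoʳ-≤ (b * q) (m∸n≤m n ℓ)))) (s≤s (m∸n≤m n (n ∸ k)))) end≤
      finish : Σ[ J ∈ ℕ ] (J < B × Z < 2 ^ J × Do POWERS (st 0 n (n * n) b q (b * Q) (b * (Q + q)) base 0 Z 0 0 0 (suc n) 0 0 0 0 Row W Z₀ Z₀ Z₀ Z₀ Z₀) []
                 (st 0 n (n * n) b q (b * Q) (b * (Q + q)) base 0 Z 0 0 0 (suc n) 0 0 J 0 Row W Z₀ Z₀ Z₀ Z₀ (pow J)) []) →
               Σ[ fin ∈ State ] (getᵗ (proj₁ fin) vAns ≡ result × Ex MAIN start (toList ρ) fin [] time≤)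
      finish (J , J<B , Z< , powers) = let u′ , win = windowsE (bitAt Z) {Z mod2^ 0} {base} {J} end′ q≤ in _ , refl ,
        pipeline {g = guard} {s = stepsF (depth F) nothing (allFin n) * K} refl (asg (V≥ n≤B)) (m≤n⇒m∸n≡0 ℓ≤n) rowsE constantsE (weightsE ρ)
          (asg (V≥ (≤-trans (s≤s z≤n) n<B)) ▸ asg (V≥ (≤-trans (s≤s z≤n) n<B))) traversal powers
          (bitsE Z (suc P) P<B (≤-trans (*-monoʳ-≤ 2 Z≤) ≤-refl) J<B Z<) win

-- Polynomial bounds.

Poly : (ℕ → ℕ) → Set
Poly f = Σ[ c ∈ ℕ ] (∀ n → f n ≤ c * suc n ^ c)

poly-const : ∀ a → Poly (λ _ → a)
poly-const a = a , λ n → m≤m*n a (suc n ^ a) {{m^n≢0 (suc n) a}}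

poly-id : Poly (λ n → n)
poly-id = 1 , λ n → ≤-trans (n≤1+n n) (≤-reflexive (eq n))
  where
  eq : ∀ n → 1 + n ≡ 1 * ((1 + n) * 1)
  eq = solve-∀

infixl 6 _⊹_
infixl 7 _⊛_

_⊹_ : ∀ {f g} → Poly f → Poly g → Poly (λ n → f n + g n)
(c , p) ⊹ (d , q) = c + d , λ n → ≤-trans (+-mono-≤
    (≤-trans (p n) (*-monoʳ-≤ c (^-monoʳ-≤ (suc n) (m≤m+n c d))))
    (≤-trans (q n) (*-monoʳ-≤ d (^-monoʳ-≤ (suc n) (m≤n+m d c)))))
  (≤-reflexive (sym (*-distribʳ-+ (suc n ^ (c + d)) c d)))

_⊛_ : ∀ {f g} → Poly f → Poly g → Poly (λ n → f n * g n)
(c , p) ⊛ (d , q) = c * d + (c + d) , λ n → ≤-trans (*-mono-≤ (p n) (q n)) (≤-trans (≤-reflexive (eq c d (suc n ^ c) (suc n ^ d)))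
  (≤-trans (≤-reflexive (cong (c * d *_) (sym (^-distribˡ-+-* (suc n) c d)))) (*-mono-≤ (m≤m+n (c * d) (c + d)) (^-monoʳ-≤ (suc n) (m≤n+m (c + d) (c * d))))))
  where
  eq : ∀ c d x y → c * x * (d * y) ≡ c * d * (x * y)
  eq = solve-∀

-- The command is fixed while n varies, so the nesting depth of its loops is constant, and each
-- level of nesting contributes one factor `f n`.
poly-tm : ∀ {f} → Poly f → ∀ c → Poly (λ n → tm (f n) c)
poly-tm p nop           = poly-const _
poly-tm p (x := e)      = poly-const _
poly-tm p (a [ i ]:= e) = poly-const _
poly-tm p (toss x)      = poly-const _
poly-tm p (c ⨟ d)       = poly-tm p c ⊹ poly-tm p d
poly-tm p (If e c d)    = poly-const 1 ⊹ (poly-const (κ e) ⊹ (poly-tm p c ⊹ poly-tm p d))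
poly-tm p (While e c)   = p ⊛ (poly-const 1 ⊹ (poly-const (κ e) ⊹ poly-tm p c)) ⊹ poly-const (suc (κ e))

least-power : ∀ m → Σ[ lg ∈ ℕ ] (m ≤ 2 ^ lg × ∀ j → j < lg → 2 ^ j < m)
least-power zero    = 0 , z≤n , λ _ ()
least-power (suc m) with lg , ge , lt ← least-power m with suc m ≤? 2 ^ lg
... | yes p = lg , p , λ j j<lg → m<n⇒m<1+n (lt j j<lg)
... | no ¬p = suc lg , ≤-trans (+-mono-≤ (m^n>0 2 lg) ge) (≤-reflexive (cong (2 ^ lg +_) (sym (+-identityʳ _)))) , below
  where
  below : ∀ j → j < suc lg → 2 ^ j < suc m
  below j j< with j ≟ lg
  ... | yes refl = ≰⇒> ¬p
  ... | no ne    = m<n⇒m<1+n (lt j (≤∧≢⇒< (s≤s⁻¹ j<) ne))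

least-power≤ : ∀ m lg → (∀ j → j < lg → 2 ^ j < m) → 2 ^ lg ≤ m + m + 1
least-power≤ m zero     lt = m≤n+m 1 (m + m)
least-power≤ m (suc lg) lt = ≤-trans (≤-trans (*-monoʳ-≤ 2 (<⇒≤ (lt lg ≤-refl))) (≤-reflexive (cong (m +_) (+-identityʳ m)))) (m≤m+n (m + m) 1)

module SizeOf (n : ℕ) where
  -- `2 ^ b` exceeds `3 ^ (n * n) * 2 ^ n`, which bounds the number of exponents. `four` bounds
  -- `2 ^ lg`, the least power of two from 2 n² on, and hence all weights; its summand 1 is for n =
  -- 0. `q` exceeds the weight of n² edges with two entries each, and `Q` the two lower digits.
  -- `2 ^ h` bounds each single factor, and `2 ^ P` is `Φ ^ n`, the bound on the whole sum.
  b four q Q h P : ℕ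
  b = n * n + n * n + n + 1
  four = n * n + n * n + n * n + n * n + 1
  q = four * (n * n + n * n) + 1
  Q = q * (n + 1)
  h = 3 + (b * (Q + q) + (b * four + b * four))
  P = (2 + h * (3 + n)) * n

abstract

  sizes : ∀ n → Sizes n
  sizes n = record
    { b = b ; four = four ; q = q ; Q = Q ; h = h ; P = P ; B = ∑ needed id ; lg = proj₁ (least-power (n * n + n * n))
    ; b≡ = refl ; four≡ = refl ; q≡ = refl ; Q≡ = refl ; h≡ = refl ; P≡ = refl
    ; lg≥ = proj₁ (proj₂ (least-power (n * n + n * n))) ; lg< = proj₂ (proj₂ (least-power (n * n + n * n)))
    ; lg≤ = ≤-trans (least-power≤ (n * n + n * n) _ (proj₂ (proj₂ (least-power (n * n + n * n))))) (≤-reflexive (cong (_+ 1) (sym (+-assoc (n * n + n * n) (n * n) (n * n)))))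
    ; P<B = at (here refl) ; n<B = at (there (here refl)) ; NN≤ = at (there (there (here refl))) ; b≤ = at (there (there (there (here refl))))
    ; four≤ = at (there (there (there (there (here refl))))) ; q≤ = at (there (there (there (there (there (here refl))))))
    ; Q≤ = at (there (there (there (there (there (there (here refl))))))) ; bq≤ = at (there (there (there (there (there (there (there (here refl))))))))
    ; b4≤ = at (there (there (there (there (there (there (there (there (here refl)))))))))
    ; h≤ = at (there (there (there (there (there (there (there (there (there (here refl))))))))))
    ; end≤ = at (there (there (there (there (there (there (there (there (there (there (here refl)))))))))))
    }
    where
    open SizeOf n
    -- `B` is the sum of all numbers that it has to dominate, so that it is visibly polynomial term
    -- by term.
    needed : List ℕ
    needed = suc (suc P) ∷ suc (suc n) ∷ n * n ∷ b ∷ four ∷ q ∷ Q ∷ b * q ∷ b * four ∷ h ∷ q * b + (b * Q * n + b * q * n) + suc n ∷ []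
    at : ∀ {x} → x ∈ needed → x ≤ ∑ needed id
    at = ∑-∈-≤ id

  sizes-poly : Poly (λ n → Sizes.B (sizes n))
  sizes-poly = (poly-const 2 ⊹ P) ⊹ ((poly-const 2 ⊹ n) ⊹ (n ⊛ n ⊹ (b ⊹ (four ⊹ (q ⊹ (Q ⊹ (b ⊛ q ⊹ (b ⊛ four ⊹ (h ⊹ (q ⊛ b ⊹ (b ⊛ Q ⊛ n ⊹ b ⊛ q ⊛ n) ⊹ (poly-const 1 ⊹ n) ⊹ poly-const 0))))))))))
    where
    n : Poly (λ n → n)
    n = poly-id
    b : Poly SizeOf.b
    b = n ⊛ n ⊹ n ⊛ n ⊹ n ⊹ poly-const 1
    four : Poly SizeOf.four
    four = n ⊛ n ⊹ n ⊛ n ⊹ n ⊛ n ⊹ n ⊛ n ⊹ poly-const 1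
    q : Poly SizeOf.q
    q = four ⊛ (n ⊛ n ⊹ n ⊛ n) ⊹ poly-const 1
    Q : Poly SizeOf.Q
    Q = q ⊛ (n ⊹ poly-const 1)
    h : Poly SizeOf.h
    h = poly-const 3 ⊹ (b ⊛ (Q ⊹ q) ⊹ (b ⊛ four ⊹ b ⊛ four))
    P : Poly SizeOf.P
    P = (poly-const 2 ⊹ h ⊛ (poly-const 3 ⊹ n)) ⊛ n

-- Error probability and conclusion.

half : ∀ c d .{{_ : NonZero d}} → 2 * c ≤ d → (ℤ.+ c ℚᵘ./ d) ≤ℚ ½
half c (suc d) le = *≤* (subst₂ ℤ._≤_ (pos-* c 2) (pos-* 1 (suc d)) (ℤ.+≤+ (≤-trans (≤-reflexive (*-comm c 2)) (≤-trans le (≤-reflexive (sym (+-identityʳ (suc d))))))))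

answer-zero : ∀ {P i c} (r : Run P i c) → read (Run.final r) 0 ≡ 0 → answer r ≡ false
answer-zero r e with read (Run.final r) 0
... | zero = refl

answer-not : ∀ {P i c} (r : Run P i c) → not (answer r) ≡ true → read (Run.final r) 0 ≡ 0
answer-not r e with read (Run.final r) 0
... | zero = refl

module Correctness {n : ℕ} (G : Graph n) (k ℓ : ℕ) (F : RootedForest n) (elim : IsEliminationForest G F) (sz : Sizes n) where
  open Sizes sz
  open Execution G k ℓ F sz
  open Machine inputs I B B 17≤I
  open ForestFacts F

  Coins : Set
  Coins = Vec Bool (n * n * lg)

  record Outcome (ρ : Coins) : Set where
    field
      run#    : Run (compile MAIN) (encode G k ℓ F) (toList ρ)
      time#   : time run# ≤ 4 ^ depth F * (tm B MAIN + (n + (n + 2) * n) * stepTime B)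
      space#  : space run# ≤ SB
      correct : ℓ ≤ n → read (Run.final run#) 0 ≡ result ρ
      rejects : n < ℓ → read (Run.final run#) 0 ≡ 0

  outcome : ∀ ρ → Outcome ρ
  outcome ρ = go (ℓ ≤? n)
    where
    go : Dec (ℓ ≤ n) → Outcome ρ
    go (yes ℓ≤n) = let fin , ans , e = main ρ ℓ≤n
                       m , t , s , exec , t≤ , s≤ , r = run e Rep-start in record
      { run# = record { time = t ; space = s ; exec = exec } ; time# = ≤-trans t≤ (time≤-bound ρ) ; space# = s≤
      ; correct = λ _ → trans (Rep.scalar r vAns) ans ; rejects = λ n<ℓ → contradiction ℓ≤n (<⇒≱ n<ℓ) }
    go (no ℓ≰n) = let fin , ans , e = reject (≰⇒> ℓ≰n) (toList ρ)
                      m , t , s , exec , t≤ , s≤ , r = run e Rep-start in record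
      { run# = record { time = t ; space = s ; exec = exec } ; time# = ≤-trans t≤ (≤-trans (m≤m+n (tm B MAIN) _) (m≤n*m _ (4 ^ depth F) {{m^n≢0 4 (depth F)}})) ; space# = s≤
      ; correct = λ ℓ≤n → contradiction ℓ≤n ℓ≰n ; rejects = λ _ → trans (Rep.scalar r vAns) ans }

  open Outcome

  2NN+n<b : 2 * (n * n) + n < b
  2NN+n<b = ≤-reflexive (trans (eq n) b≡)
    where
    eq : ∀ n → 1 + (2 * (n * n) + n) ≡ n * n + n * n + n + 1
    eq = solve-∀

  heavy : n * n * (four + four) < q
  heavy = ≤-reflexive (trans (eq n four) q≡)
    where
    eq : ∀ n f → 1 + n * n * (f + f) ≡ f * (n * n + n * n) + 1
    eq = solve-∀

  k′≤b : k′ ≤ b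
  k′≤b = ≤-trans (s≤s (≤-trans (m∸n≤m n (n ∸ k)) (m≤n+m n (2 * (n * n))))) 2NN+n<b

  module _ (ℓ≤n : ℓ ≤ n) where

    open Answer G dfs-unique dfs-complete length-dfs b q Q lg four k′ (trans (sym Q≡) (cong (q *_) (+-comm n 1))) 2NN+n<b heavy k′≤b ℓ≤n

    -- This is where the elimination property enters: sibling subtrees are separated, so the
    -- recursion along the forest equals the sum over the depth-first order.
    result≡ : ∀ ρ → result ρ ≡ Value.answer# (f ρ)
    result≡ ρ = cong (λ z → windows (bitAt z) b k′ base q 0)
      (Weights.Separated.forestAcc≡naive (adj G) (b * Q) (b * (Q + q)) (λ u v → b * ω (f ρ) u v) slots (parent F) (λ f p c c′ ne → separated {G} elim f p c c′ ne) (depth F) nothing (λ _ → ∅))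

    f≤four : ∀ ρ i → f ρ i ≤ four
    f≤four ρ = table-bounded lg (n * n) ρ (λ _ → 0) lg≤ (λ _ → z≤n)

    -- A count that is not divisible by `2 ^ k′` would give, by soundness for min(n, k), a cover
    -- with at most min(n, k) cycles, hence with at most `k`.
    no-instance : ¬ PartialCycleCover G k ℓ → ∀ ρ → result ρ ≡ 0
    no-instance none ρ = trans (result≡ ρ) (Value.answer-no (f ρ) (f≤four ρ) λ C C∈ → decidable-stable (2 ^ k′ ∣? covers# C) λ odd →
      none (weaken (CycleCovers.sound dfs-unique dfs-complete G E-lists C∈ {n ∸ (n ∸ k)} ℓ≤n odd)))
      where
      weaken : PartialCycleCover G (n ∸ (n ∸ k)) ℓ → PartialCycleCover G k ℓ
      weaken (C , cover , (cs , family , few) , cov) = C , cover , (cs , family , ≤-trans few (m∸[m∸n]≤n n k)) , cov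
        where
        m∸[m∸n]≤n : ∀ m n → m ∸ (m ∸ n) ≤ n
        m∸[m∸n]≤n m n with ≤-total n m
        ... | inj₁ le = ≤-reflexive (m∸[m∸n]≡n le)
        ... | inj₂ le = ≤-trans (m∸n≤m m (m ∸ n)) le

    errors : Coins → Bool
    errors ρ = not (answer (run# (outcome ρ)))

    -- A union bound over at most n² edges, each bad with probability at most 1 / 2 ^ lg; the choice
    -- of `lg` with 2 n² ≤ 2 ^ lg yields one half. The inequality is proved after multiplication by
    -- `2 ^ lg`.
    yes-instance : PartialCycleCover G k ℓ → 2 * count (n * n * lg) errors ≤ 2 ^ (n * n * lg)
    yes-instance cover = *-cancelˡ-≤ (2 ^ lg) {{m^n≢0 2 lg}} (begin
        2 ^ lg * (2 * count r errors)
      ≡⟨ swap (2 ^ lg) (count r errors) ⟩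
        2 * (2 ^ lg * count r errors)
      ≤⟨ *-monoʳ-≤ 2 (*-monoʳ-≤ (2 ^ lg) (≤-trans (≤-reflexive (count≡sumV r errors)) (sumV-mono r charge))) ⟩
        2 * (2 ^ lg * sumV r (λ ρ → ∑ E (λ e → 𝟙 (bad? e (f ρ)))))
      ≡⟨ cong (2 *_) (trans (cong (2 ^ lg *_) (sumV-∑ r E (λ e ρ → 𝟙 (bad? e (f ρ))))) (∑-*ˡ (2 ^ lg) E _)) ⟩
        2 * ∑ E (λ e → 2 ^ lg * sumV r (λ ρ → 𝟙 (bad? e (f ρ))))
      ≤⟨ *-monoʳ-≤ 2 (∑-mono E λ e e∈ → bad-count (n * n) e∈ (∈-downFrom⁺ (idx< e))) ⟩
        2 * ∑ E (λ _ → (2 ^ lg) ^ (n * n))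
      ≡⟨ trans (cong (2 *_) (∑-const E _)) (sym (*-assoc 2 (length E) _)) ⟩
        2 * length E * (2 ^ lg) ^ (n * n)
      ≤⟨ *-monoˡ-≤ ((2 ^ lg) ^ (n * n)) (≤-trans (*-monoʳ-≤ 2 E-length) (≤-trans (≤-reflexive (cong (n * n +_) (+-identityʳ _))) lg≥)) ⟩
        2 ^ lg * (2 ^ lg) ^ (n * n)
      ≡⟨ cong (2 ^ lg *_) (trans (^-*-assoc 2 lg (n * n)) (cong (2 ^_) (*-comm lg (n * n)))) ⟩
        2 ^ lg * 2 ^ r ∎)
      where
      open ≤-Reasoning
      r : ℕ
      r = n * n * lg
      swap : ∀ p c → p * (2 * c) ≡ 2 * (p * c)
      swap = solve-∀
      -- A cover with c cycles has 2 ^ c balanced orientations, and c ≤ min(n, k) < `k′`, so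
      -- `2 ^ k′` is too large to divide this number.
      witness : Σ[ C ∈ List (Degrees.Arc {n}) ] (C ∈ subs E × ¬ 2 ^ k′ ∣ covers# C)
      witness = let _ , C , C∈ , c , c≤k , c≤n , eq = CycleCovers.covering dfs-unique dfs-complete G E-lists cover in
        C , C∈ , λ div → contradiction (∣⇒≤ {{m^n≢0 2 c}} (subst (2 ^ k′ ∣_) eq div)) (<⇒≱ (^-monoʳ-< 2 ≤-refl (s≤s (both c c≤k c≤n))))
        where
        both : ∀ c → c ≤ k → c ≤ n → c ≤ n ∸ (n ∸ k)
        both c c≤k c≤n with ≤-total k n
        ... | inj₁ le = ≤-trans c≤k (≤-reflexive (sym (m∸[m∸n]≡n le)))
        ... | inj₂ le = ≤-trans c≤n (≤-reflexive (cong (n ∸_) (sym (m≤n⇒m∸n≡0 le))))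
      bad∈ : ∀ ρ → errors ρ ≡ true → Σ[ e ∈ Degrees.Arc {n} ] (e ∈ E × Bad e (f ρ))
      bad∈ ρ err = let _ , C∈ , odd = witness in no⇒bad C∈ odd (f ρ) (f≤four ρ)
        (trans (sym (result≡ ρ)) (trans (sym (correct (outcome ρ) ℓ≤n)) (answer-not (run# (outcome ρ)) err)))
      charge : ∀ ρ → bit (errors ρ) ≤ ∑ E (λ e → 𝟙 (bad? e (f ρ)))
      charge ρ = go (errors ρ) refl
        where
        go : ∀ b → errors ρ ≡ b → bit b ≤ ∑ E (λ e → 𝟙 (bad? e (f ρ)))
        go false err = z≤n
        go true  err = let e , e∈ , bad = bad∈ ρ err in
          ≤-trans (≤-reflexive (sym (𝟙-yes (bad? e (f ρ)) bad))) (∑-∈-≤ (λ e → 𝟙 (bad? e (f ρ))) e∈)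

  no⇒false : ¬ PartialCycleCover G k ℓ → ∀ ρ → answer (run# (outcome ρ)) ≡ false
  no⇒false none ρ = answer-zero (run# (outcome ρ)) (go (ℓ ≤? n))
    where
    go : Dec (ℓ ≤ n) → read (Run.final (run# (outcome ρ))) 0 ≡ 0
    go (yes ℓ≤n) = trans (correct (outcome ρ) ℓ≤n) (no-instance ℓ≤n none ρ)
    go (no ℓ≰n)  = rejects (outcome ρ) (≰⇒> ℓ≰n)

  yes⇒half : PartialCycleCover G k ℓ → Pr (λ ρ → not (answer (run# (outcome ρ)))) ≤ℚ ½
  yes⇒half cover = half _ (2 ^ (n * n * lg)) {{m^n≢0 2 (n * n * lg)}} (yes-instance ℓ≤n cover)
    where
    ℓ≤n : ℓ ≤ n
    ℓ≤n = ≤-trans (≤-reflexive (sym (proj₂ (proj₂ (proj₂ cover))))) (≤-trans (length-filter (λ v → degree (proj₁ cover) v ≟ 2) (allFin n)) (≤-reflexive (length-tabulate {n = n} id)))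

theorem1 :
    Σ[ P ∈ Program ] Σ[ c ∈ ℕ ] Σ[ d ∈ ℕ ]
      ((n : ℕ) (G : Graph n) (k ℓ : ℕ) (F : RootedForest n) → IsEliminationForest G F →
        Σ[ r ∈ ℕ ] Σ[ run ∈ ((ρ : Vec Bool r) → Run P (encode G k ℓ F) (toList ρ)) ]
          ((∀ ρ → time (run ρ) ≤ 4 ^ depth F * (c * suc n ^ c))
          × (∀ ρ → space (run ρ) ≤ d * suc n ^ d)
          × (¬ PartialCycleCover G k ℓ → ∀ ρ → answer (run ρ) ≡ false)
          × (PartialCycleCover G k ℓ → Pr (λ ρ → not (answer (run ρ))) ≤ℚ ½)))
theorem1 = compile MAIN , proj₁ timePoly , proj₁ spacePoly , λ n G k ℓ F elim →
  n * n * Sizes.lg (sizes n) , (λ ρ → run# (outcome G k ℓ F elim (sizes n) ρ)) ,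
  (λ ρ → ≤-trans (time# (outcome G k ℓ F elim (sizes n) ρ)) (*-monoʳ-≤ (4 ^ depth F) (proj₂ timePoly n))) ,
  (λ ρ → ≤-trans (space# (outcome G k ℓ F elim (sizes n) ρ)) (proj₂ spacePoly n)) ,
  no⇒false G k ℓ F elim (sizes n) , yes⇒half G k ℓ F elim (sizes n)
  where
  open Correctness using (outcome; no⇒false; yes⇒half)
  open Correctness.Outcome using (run#; time#; space#)
  timePoly : Poly (λ n → tm (Sizes.B (sizes n)) MAIN + (n + (n + 2) * n) * stepTime (Sizes.B (sizes n)))
  timePoly = poly-tm sizes-poly MAIN ⊹ (poly-id ⊹ (poly-id ⊹ poly-const 2) ⊛ poly-id) ⊛ (poly-const 1 ⊹ (poly-const (κ guard) ⊹ poly-tm sizes-poly STEP))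
  oct-poly : ∀ {f} → Poly f → Poly (λ n → oct (f n))
  oct-poly p = ((p ⊹ p) ⊹ (p ⊹ p)) ⊹ ((p ⊹ p) ⊹ (p ⊹ p))
  spacePoly : Poly (λ n → (oct (Sizes.B (sizes n) + 17) + 8) * (2 + Sizes.B (sizes n)))
  spacePoly = (oct-poly (sizes-poly ⊹ poly-const 17) ⊹ poly-const 8) ⊛ (poly-const 2 ⊹ sizes-poly)
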